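{- For every integer $t\ge 2$ and every $i\in\{1,2\}$, $$\Phi^{(i)}(2t+1) = 2+\frac{2}{2t-1}.$$
   Context: Graphs are finite and may contain multiple edges but no loops. The chromatic index $\chi'(G)$ is the minimum $k$ such that $G$ has a proper $k$-edge-coloring (adjacent edges, including parallel edges, receive different colors). A graph $G$ with maximum degree $\Delta(G)$ is class $1$ if $\chi'(G)=\Delta(G)$ and class $2$ otherwise. For a real number $r\ge 2$, a nowhere-zero $r$-flow in $G$ is a pair $(D,f)$ where $D$ is an orientation of $G$ and $f\colon E(G)\to[1,r-1]$ is a function such that $\sum_{e\in E^+(v)}f(e)=\sum_{e\in E^-(v)}f(e)$ for every vertex $v$, where $E^+(v)$ and $E^-(v)$ are the sets of outgoing and incoming arcs at $v$. The circular flow number is $\phi_c(G)=\inf\{r : G \text{ has a nowhere-zero } r\text{ -flow}\}$ (a graph with a bridge has no nowhere-zero flow, and then $\phi_c(G)=\infty$). Let $\mathcal{G}_{2t+1}$ be the set of all $(2t+1)$-regular class $1$ graphs $G$ such that there is no perfect matching $M$ of $G$ for which $G-M$ is bipartite. Define $$\Phi^{(1)}(2t+1)=\inf\{\phi_c(G) : G\in\mathcal{G}_{2t+1}\},$$ $$\Phi^{(2)}(2t+1)=\inf\{\phi_c(G) : G \text{ is a } (2t+1)\text{ -regular class } 2 \text{ graph}\}.$$ -}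

module Defs where

open import Data.Bool using (Bool; if_then_else_)
open import Data.Fin using (Fin)
open import Data.Fin.Properties using () renaming (_≟_ to _≟ᶠ_)
open import Data.Fin.Subset using (Subset; _∈_)
open import Data.Fin.Subset.Properties using (_∈?_)
open import Data.List using (List; filter; length; lookup; allFin; map; foldr)
open import Data.List.Extrema.Nat using (max)
open import Data.Nat as ℕ using (ℕ; NonZero)
import Data.Nat.Properties as ℕ
open import Data.Product using (Σ; ∃; ∃!; _×_; _,_; proj₁)
open import Data.Rational
  using (ℚ; 0ℚ; 1ℚ; ½; _+_; _-_; -_; _*_; _≤_; _<_; ∣_∣; _/_)
open import Data.Rational.Properties
open import Data.Rational.Solver using (module +-*-Solver)
open import Data.Integer using (+_)
open import Data.Sum using (_⊎_)
open import Function.Bundles using (_⇔_)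
open import Relation.Binary.PropositionalEquality
  using (_≡_; _≢_; refl; sym; trans; cong; subst; subst₂)
open import Relation.Nullary using (¬_; ¬?; Dec; _⊎-dec_)

------------------------------------------------------------------------
-- Real numbers: Cauchy sequences of rationals, compared up to _≃_

record ℝ : Set where
  field
    seq    : ℕ → ℚ
    cauchy : ∀ ε → 0ℚ < ε →
             ∃ λ N → ∀ m n → N ℕ.≤ m → N ℕ.≤ n → ∣ seq m - seq n ∣ ≤ ε

open ℝ public

private
  0<½* : ∀ {ε} → 0ℚ < ε → 0ℚ < ½ * ε
  0<½* {ε} 0<ε = subst (_< ½ * ε) (*-zeroʳ ½) (*-monoʳ-<-pos ½ 0<ε)

  ½+½ : ∀ ε → ½ * ε + ½ * ε ≡ ε
  ½+½ ε = trans (sym (*-distribʳ-+ ε ½ ½)) (*-identityˡ ε)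

  interchange : ∀ a b c d → (a - c) + (b - d) ≡ (a + b) - (c + d)
  interchange = solve 4 (λ a b c d →
    (a :- c) :+ (b :- d) := (a :+ b) :- (c :+ d)) refl
    where open +-*-Solver

fromℚ : ℚ → ℝ
fromℚ q .seq _ = q
fromℚ q .cauchy ε 0<ε =
  0 , λ _ _ _ _ → subst (λ z → ∣ z ∣ ≤ ε) (sym (+-inverseʳ q)) (<⇒≤ 0<ε)

infixl 6 _+ᴿ_
_+ᴿ_ : ℝ → ℝ → ℝ
(x +ᴿ y) .seq n = seq x n + seq y n
(x +ᴿ y) .cauchy ε 0<ε
  with cauchy x (½ * ε) (0<½* 0<ε) | cauchy y (½ * ε) (0<½* 0<ε)
... | N₁ , p | N₂ , q = N₁ ℕ.⊔ N₂ , λ m n N≤m N≤n →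
  subst₂ (λ a b → ∣ a ∣ ≤ b)
    (interchange (seq x m) (seq y m) (seq x n) (seq y n)) (½+½ ε)
    (≤-trans (∣p+q∣≤∣p∣+∣q∣ (seq x m - seq x n) (seq y m - seq y n))
      (+-mono-≤
        (p m n (ℕ.m⊔n≤o⇒m≤o N₁ N₂ N≤m) (ℕ.m⊔n≤o⇒m≤o N₁ N₂ N≤n))
        (q m n (ℕ.m⊔n≤o⇒n≤o N₁ N₂ N≤m) (ℕ.m⊔n≤o⇒n≤o N₁ N₂ N≤n))))

infix 4 _≃ᴿ_ _≤ᴿ_ _<ᴿ_

_≃ᴿ_ : ℝ → ℝ → Set
x ≃ᴿ y = ∀ ε → 0ℚ < ε → ∃ λ N → ∀ n → N ℕ.≤ n → ∣ seq x n - seq y n ∣ ≤ ε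

_≤ᴿ_ : ℝ → ℝ → Set
x ≤ᴿ y = ∀ ε → 0ℚ < ε → ∃ λ N → ∀ n → N ℕ.≤ n → seq x n ≤ seq y n + ε

_<ᴿ_ : ℝ → ℝ → Set
x <ᴿ y = ∃ λ ε → 0ℚ < ε × ∃ λ N → ∀ n → N ℕ.≤ n → seq x n + ε ≤ seq y n

------------------------------------------------------------------------
-- Extended reals, and infima of arbitrary families

-- An element x of [-∞, +∞] is given by the set of rationals q with x < q:
-- such sets are exactly the upward closed sets of rationals without a
-- least element.  The empty set is +∞ and the set of all rationals is -∞.
record ℝ∞ : Set₁ where
  field
    below   : ℚ → Set
    upper   : ∀ {p q} → below p → p < q → below q
    rounded : ∀ {q} → below q → ∃ λ p → p < q × below p

open ℝ∞ public

infix 4 _≃_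
_≃_ : ℝ∞ → ℝ∞ → Set
x ≃ y = ∀ q → below x q ⇔ below y q

finite : ℝ → ℝ∞
finite r .below q = r <ᴿ fromℚ q
finite r .upper (ε , 0<ε , N , h) p<q =
  ε , 0<ε , N , λ n N≤n → ≤-trans (h n N≤n) (<⇒≤ p<q)
finite r .rounded {q} (ε , 0<ε , N , h) =
  q - ½ε , q-½ε<q , ½ε , 0<½* 0<ε , N , λ n N≤n →
    subst (_≤ q - ½ε) (cancel (seq r n)) (+-mono-≤ (h n N≤n) ≤-refl)
  where
  ½ε : ℚ
  ½ε = ½ * ε
  q-½ε<q : q - ½ε < q
  q-½ε<q = subst (q - ½ε <_) (+-identityʳ q)
             (+-monoʳ-< q (neg-antimono-< (0<½* 0<ε)))
  assoc : ∀ a b → a + (b + b) - b ≡ a + b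
  assoc = solve 2 (λ a b → a :+ (b :+ b) :- b := a :+ b) refl
    where open +-*-Solver
  cancel : ∀ a → a + ε - ½ε ≡ a + ½ε
  cancel a = trans (cong (λ z → a + z - ½ε) (sym (½+½ ε))) (assoc a ½ε)

-- inf x < q exactly when some member of the family is < q.
inf : {I : Set} → (I → ℝ∞) → ℝ∞
inf x .below q = ∃ λ i → below (x i) q
inf x .upper (i , b) p<q = i , upper (x i) b p<q
inf x .rounded (i , b) with rounded (x i) b
... | p , p<q , b′ = p , p<q , i , b′

------------------------------------------------------------------------
-- Finite loopless multigraphs

-- The order of the two ends of an edge carries no meaning.
record Graph : Set where
  field
    #V #E     : ℕ
    end₁ end₂ : Fin #E → Fin #V
    loopless  : ∀ e → end₁ e ≢ end₂ e

module _ (G : Graph) where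
  open Graph G

  Vertex Edge : Set
  Vertex = Fin #V
  Edge   = Fin #E

  Incident : Edge → Vertex → Set
  Incident e v = end₁ e ≡ v ⊎ end₂ e ≡ v

  incident? : ∀ e v → Dec (Incident e v)
  incident? e v = (end₁ e ≟ᶠ v) ⊎-dec (end₂ e ≟ᶠ v)

  degree : Vertex → ℕ
  degree v = length (filter (λ e → incident? e v) (allFin #E))

  Δ : ℕ
  Δ = max 0 (map degree (allFin #V))

  Regular : ℕ → Set
  Regular k = ∀ v → degree v ≡ k

  Adjacent : Edge → Edge → Set
  Adjacent e f = e ≢ f × ∃ λ v → Incident e v × Incident f v

  EdgeColorable : ℕ → Set
  EdgeColorable k =
    Σ (Edge → Fin k) λ c → ∀ e f → Adjacent e f → c e ≢ c f

  IsChromaticIndex : ℕ → Set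
  IsChromaticIndex k =
    EdgeColorable k × (∀ j → EdgeColorable j → k ℕ.≤ j)

  Class1 Class2 : Set
  Class1 = IsChromaticIndex Δ
  Class2 = ¬ Class1

  Bipartite : Set
  Bipartite = Σ (Vertex → Bool) λ c → ∀ e → c (end₁ e) ≢ c (end₂ e)

  PerfectMatching : Subset #E → Set
  PerfectMatching M = ∀ v → ∃! _≡_ λ e → e ∈ M × Incident e v

  delete : Subset #E → Graph
  delete M = record
    { #V       = #V
    ; #E       = length rest
    ; end₁     = λ i → end₁ (lookup rest i)
    ; end₂     = λ i → end₂ (lookup rest i)
    ; loopless = λ i → loopless (lookup rest i)
    }
    where
    rest : List Edge
    rest = filter (λ e → ¬? (e ∈? M)) (allFin #E)

  -- true: directed from end₁ to end₂;  false: from end₂ to end₁.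
  Orientation : Set
  Orientation = Edge → Bool

  tail head : Orientation → Edge → Vertex
  tail D e = if D e then end₁ e else end₂ e
  head D e = if D e then end₂ e else end₁ e

  E⁺ E⁻ : Orientation → Vertex → List Edge
  E⁺ D v = filter (λ e → tail D e ≟ᶠ v) (allFin #E)
  E⁻ D v = filter (λ e → head D e ≟ᶠ v) (allFin #E)

  ∑ : List Edge → (Edge → ℝ) → ℝ
  ∑ es f = foldr (λ e s → f e +ᴿ s) (fromℚ 0ℚ) es

  IsNowhereZeroFlow : ℝ → Orientation → (Edge → ℝ) → Set
  IsNowhereZeroFlow r D f =
    (∀ e → fromℚ 1ℚ ≤ᴿ f e × f e ≤ᴿ r +ᴿ fromℚ (- 1ℚ)) ×
    (∀ v → ∑ (E⁺ D v) f ≃ᴿ ∑ (E⁻ D v) f)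

  HasNowhereZeroFlow : ℝ → Set
  HasNowhereZeroFlow r =
    fromℚ (+ 2 / 1) ≤ᴿ r × ∃ λ D → ∃ λ f → IsNowhereZeroFlow r D f

  φ-c : ℝ∞
  φ-c = inf {∃ HasNowhereZeroFlow} λ (r , _) → finite r

------------------------------------------------------------------------

𝒢 : ℕ → Graph → Set
𝒢 k G = Regular G k × Class1 G ×
  ¬ (∃ λ M → PerfectMatching G M × Bipartite (delete G M))

RegularClass2 : ℕ → Graph → Set
RegularClass2 k G = Regular G k × Class2 G

Φ⁽¹⁾ Φ⁽²⁾ : ℕ → ℝ∞
Φ⁽¹⁾ k = inf {∃ (𝒢 k)} λ (G , _) → φ-c G
Φ⁽²⁾ k = inf {∃ (RegularClass2 k)} λ (G , _) → φ-c G

2t-1≢0 : ∀ {t} → 2 ℕ.≤ t → NonZero (2 ℕ.* t ℕ.∸ 1)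
2t-1≢0 {t} 2≤t = ℕ.>-nonZero (ℕ.m<n⇒0<n∸m
  (ℕ.≤-trans 2≤t (ℕ.m≤m+n t (t ℕ.+ 0))))

{-# OPTIONS --safe #-}
-- Lower bound.  In a nowhere-zero r-flow with r < 2 + 2/(2t - 1) every vertex
-- has out-degree t or t + 1, and comparing flow values at the two ends of an
-- edge shows that each edge joins the two kinds of vertices.  So the graph is
-- bipartite; by König's theorem it is class 1, and any colour class is a
-- perfect matching with bipartite complement.
--
-- Upper bound.  Let a cubic graph carry an integer flow with values between n
-- and 3n + 2, and let each edge of a perfect matching join a vertex of
-- out-degree 2 to one of out-degree 1.  Adding t - 1 copies of these edges in
-- either direction gives a (2t + 1)-regular graph, and the flow extends to
-- show φ-c ≤ 2 + 2/(2t - 1) + 2/((2t - 1)n).  The cubic graph is a chain: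
-- starting from a single edge, the part built so far is substituted for a
-- spoke of the Petersen graph, and one edge of each of its two 5-cycles is cut.
-- Whatever the multiplicities of the spokes, in every edge colouring the two
-- cut edges behave like the two ends of a spoke, so that joining up the last
-- cuts leaves no colouring; whereas the net flow through a cut drops by 1 at
-- each step, from n to 0, and then the cuts can be joined.  This is the class 2
-- graph.  For a class 1 graph one end of the initial edge is expanded to a
-- triangle with thick legs.  With three colours the triangle acts as a vertex,
-- so no perfect matching has a bipartite complement, but five colours suffice.
module Submission where

open import Defs
open import Data.Bool using (Bool; true; false; if_then_else_)
open import Data.Empty using (⊥)
open import Data.Fin
  using (Fin; zero; suc; _↑ˡ_; _↑ʳ_; splitAt; join; combine; remQuot; toℕ; fromℕ<; inject₁; punchOut)
import Data.Fin as Fin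
open import Data.Fin.Patterns
open import Data.Fin.Properties
  using (splitAt-↑ˡ; splitAt-↑ʳ; splitAt⁻¹-↑ˡ; splitAt⁻¹-↑ʳ; splitAt-join; join-splitAt; remQuot-combine;
         combine-remQuot; pigeonhole; all?; any?; injective⇒≤; punchOut-injective; ¬∀⟶∃¬; toℕ≤pred[n];
         toℕ-fromℕ<; toℕ-inject₁; suc-injective; ↑ˡ-injective; ↑ʳ-injective)
  renaming (_≟_ to _≟ᶠ_)
open import Data.List using (List; []; _∷_; filter; length; tabulate; allFin)
open import Data.Nat using (ℕ; zero; suc; _≤_; _<_; z≤n; s≤s; _∸_) renaming (_+_ to _+ℕ_; _*_ to _*ℕ_)
import Data.Nat.Properties as ℕₚ
open import Data.Product using (Σ; ∃; _×_; _,_; proj₁; proj₂)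
open import Data.Sum using (_⊎_; inj₁; inj₂; map₂; swap)
import Data.Sum
open import Data.Sum.Properties using (inj₁-injective; inj₂-injective)
open import Data.Vec using (Vec; []; _∷_)
open import Level using (0ℓ)
open import Function using (_∘_; id)
open import Function.Bundles using (mk⇔)
open import Relation.Binary.PropositionalEquality
open import Relation.Nullary using (¬_; ¬?; Dec; yes; no; does; contradiction; _×-dec_; _⊎-dec_)
open import Relation.Nullary.Decidable using (toWitness; dec-true)
open import Data.Unit using (tt)
open import Relation.Unary using (Pred; Decidable)
open import Data.Nat.Solver using (module +-*-Solver)
open import Data.Integer using (+_)
import Data.Integer as ℤ
import Data.Integer.Solver as ℤ-Solver
import Data.Integer.Properties as ℤₚ
open import Data.Rational
  using (ℚ; 0ℚ; 1ℚ; _+_; _*_; _-_; -_; _/_; mkℚ; *<*; toℚᵘ)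
  renaming (_≤_ to _≤ℚ_; _<_ to _<ℚ_)
import Data.Rational as ℚ
import Data.Rational.Properties as ℚₚ
import Data.Rational.Unnormalised as ℚᵘ
import Data.Rational.Unnormalised.Properties as ℚᵘₚ
import Data.Rational.Solver as ℚ-Solver
import Data.List.Relation.Unary.Any as Any
open import Data.List.Relation.Unary.Any using (here; there)
import Data.List.Relation.Unary.All as All
open import Data.List.Relation.Unary.All using ([]; _∷_)
open import Data.List.Relation.Unary.AllPairs using ([]; _∷_)
open import Data.List.Relation.Unary.Unique.Propositional using (Unique)
import Data.List.Relation.Unary.Unique.Propositional.Properties as Uniqueₚ
open import Data.List.Membership.Propositional using (_∈_; find; lose)
import Data.List.Membership.Propositional.Properties as ∈ₚ
open import Data.Fin.Subset.Properties using (_∈?_)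
open import Relation.Binary using (DecidableEquality)
import Data.List as List
import Data.List.Relation.Unary.All.Properties as Allₚ
open import Data.List.Relation.Unary.Any.Properties using (lookup-index)
import Data.List.Extrema.Nat as Extrema
import Data.Fin.Subset as Subset
import Data.Vec as Vec
import Data.Vec.Properties as Vecₚ

-- Sums over Fin n

Σᶠ : (n : ℕ) → (Fin n → ℕ) → ℕ
Σᶠ zero    f = 0
Σᶠ (suc n) f = f zero +ℕ Σᶠ n (f ∘ suc)

Σᶠ-cong : ∀ n {f g : Fin n → ℕ} → (∀ i → f i ≡ g i) → Σᶠ n f ≡ Σᶠ n g
Σᶠ-cong zero    e = refl
Σᶠ-cong (suc n) e = cong₂ _+ℕ_ (e zero) (Σᶠ-cong n (e ∘ suc))

Σᶠ-zero : ∀ n → Σᶠ n (λ _ → 0) ≡ 0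
Σᶠ-zero zero    = refl
Σᶠ-zero (suc n) = Σᶠ-zero n

+ℕ-interchange : ∀ a b c d → (a +ℕ b) +ℕ (c +ℕ d) ≡ (a +ℕ c) +ℕ (b +ℕ d)
+ℕ-interchange = solve 4 (λ a b c d → (a :+ b) :+ (c :+ d) := (a :+ c) :+ (b :+ d)) refl
  where open +-*-Solver

Σᶠ-+ : ∀ n (f g : Fin n → ℕ) → Σᶠ n (λ i → f i +ℕ g i) ≡ Σᶠ n f +ℕ Σᶠ n g
Σᶠ-+ zero    f g = refl
Σᶠ-+ (suc n) f g = trans
  (cong (f zero +ℕ g zero +ℕ_) (Σᶠ-+ n (f ∘ suc) (g ∘ suc)))
  (+ℕ-interchange (f zero) (g zero) _ _)

Σᶠ-*ʳ : ∀ n (f : Fin n → ℕ) c → Σᶠ n (λ i → c *ℕ f i) ≡ c *ℕ Σᶠ n f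
Σᶠ-*ʳ zero    f c = sym (ℕₚ.*-zeroʳ c)
Σᶠ-*ʳ (suc n) f c = trans (cong (c *ℕ f zero +ℕ_) (Σᶠ-*ʳ n (f ∘ suc) c))
  (sym (ℕₚ.*-distribˡ-+ c (f zero) _))

Σᶠ-const : ∀ n c → Σᶠ n (λ _ → c) ≡ n *ℕ c
Σᶠ-const zero    c = refl
Σᶠ-const (suc n) c = cong (c +ℕ_) (Σᶠ-const n c)

Σᶠ-split : ∀ m n (f : Fin (m +ℕ n) → ℕ) →
  Σᶠ (m +ℕ n) f ≡ Σᶠ m (f ∘ (_↑ˡ n)) +ℕ Σᶠ n (f ∘ (m ↑ʳ_))
Σᶠ-split zero    n f = refl
Σᶠ-split (suc m) n f = trans (cong (f zero +ℕ_) (Σᶠ-split m n (f ∘ suc)))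
  (sym (ℕₚ.+-assoc (f zero) _ _))

Σᶠ-combine : ∀ m n (f : Fin (m *ℕ n) → ℕ) →
  Σᶠ (m *ℕ n) f ≡ Σᶠ m (λ x → Σᶠ n (λ j → f (combine x j)))
Σᶠ-combine zero    n f = refl
Σᶠ-combine (suc m) n f = trans (Σᶠ-split n (m *ℕ n) f)
  (cong (Σᶠ n (f ∘ (_↑ˡ m *ℕ n)) +ℕ_) (Σᶠ-combine m n (f ∘ (n ↑ʳ_))))

Σᶠ-≥ : ∀ n (f : Fin n → ℕ) i → f i ≤ Σᶠ n f
Σᶠ-≥ (suc n) f zero    = ℕₚ.m≤m+n _ _
Σᶠ-≥ (suc n) f (suc i) = ℕₚ.≤-trans (Σᶠ-≥ n (f ∘ suc) i) (ℕₚ.m≤n+m _ _)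

Σᶠ-≥₂ : ∀ n (f : Fin n → ℕ) i j → i ≢ j → f i +ℕ f j ≤ Σᶠ n f
Σᶠ-≥₂ (suc n) f zero    zero    i≢j = contradiction refl i≢j
Σᶠ-≥₂ (suc n) f zero    (suc j) i≢j = ℕₚ.+-monoʳ-≤ (f zero) (Σᶠ-≥ n (f ∘ suc) j)
Σᶠ-≥₂ (suc n) f (suc i) zero    i≢j = 
  ℕₚ.≤-trans (ℕₚ.≤-reflexive (ℕₚ.+-comm (f (suc i)) (f zero)))
    (ℕₚ.+-monoʳ-≤ (f zero) (Σᶠ-≥ n (f ∘ suc) i))
Σᶠ-≥₂ (suc n) f (suc i) (suc j) i≢j =
  ℕₚ.≤-trans (Σᶠ-≥₂ n (f ∘ suc) i j (i≢j ∘ cong suc)) (ℕₚ.m≤n+m _ _)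

-- An Iverson bracket weighted by `a`. Using `does` instead of matching on the decision lets it
-- reduce under `suc` at open arguments, so that the equations for `step` at old vertices hold by
-- computation.
[_≐_] : ∀ {n} → Fin n → Fin n → ℕ → ℕ
[ x ≐ v ] a = if does (x ≟ᶠ v) then a else 0

≐-* : ∀ {n} (x v : Fin n) a → [ x ≐ v ] a ≡ a *ℕ [ x ≐ v ] 1
≐-* x v a with does (x ≟ᶠ v)
... | true  = sym (ℕₚ.*-identityʳ a)
... | false = sym (ℕₚ.*-zeroʳ a)

≐-+ : ∀ {n} (x v : Fin n) a b → [ x ≐ v ] (a +ℕ b) ≡ [ x ≐ v ] a +ℕ [ x ≐ v ] b
≐-+ x v a b with does (x ≟ᶠ v)
... | true  = refl
... | false = refl

≐-refl : ∀ {n} (x : Fin n) a → [ x ≐ x ] a ≡ a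
≐-refl x a with x ≟ᶠ x
... | yes _  = refl
... | no x≢x = contradiction refl x≢x

infixr 5 _▹_
_▹_ : ∀ {A : Set} {k m} → Vec A k → (Fin m → A) → Fin (k +ℕ m) → A
([]       ▹ f) i       = f i
((x ∷ xs) ▹ f) zero    = x
((x ∷ xs) ▹ f) (suc i) = (xs ▹ f) i

-- Poles

-- Flow leaves through the dangling lines at u₁ and v₂ and enters through those
-- at u₂ and v₁; the net flow from {v₁, v₂} to {u₁, u₂} is s.
record Pole (n s : ℕ) : Set where
  field
    #V #E       : ℕ
    tl hd       : Fin #E → Fin #V
    val         : Fin #E → ℕ
    u₁ u₂ v₁ v₂ : Fin #V
    loopless    : ∀ e → tl e ≢ hd e
    bounds      : ∀ e → n ≤ val e × val e ≤ 3 *ℕ n +ℕ 2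
    conserves   : ∀ v →
      [ u₁ ≐ v ] (2 *ℕ n +ℕ 1 +ℕ s) +ℕ [ v₂ ≐ v ] n +ℕ
        Σᶠ #E (λ e → [ tl e ≐ v ] (val e)) ≡
      [ u₂ ≐ v ] (2 *ℕ n +ℕ 1) +ℕ [ v₁ ≐ v ] (n +ℕ s) +ℕ
        Σᶠ #E (λ e → [ hd e ≐ v ] (val e))
    s≤n         : s ≤ n

-- The start of the class 2 chain: one edge, with two dangling lines at either end. The whole net
-- flow crosses it, hence `s = n`.
spokePole : ∀ n → Pole n n
spokePole n = record
  { #V = 2 ; #E = 1
  ; tl = λ _ → 1F ; hd = λ _ → 0F ; val = λ _ → n
  ; u₁ = 0F ; u₂ = 0F ; v₁ = 1F ; v₂ = 1F
  ; loopless = λ _ ()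
  ; bounds = λ _ → ℕₚ.≤-refl , ℕₚ.≤-trans (ℕₚ.m≤n*m n 3) (ℕₚ.m≤m+n _ 2)
  ; conserves = λ { 0F → at-u n ; 1F → at-v n }
  ; s≤n = ℕₚ.≤-refl }
  where
  open +-*-Solver
  at-u : ∀ n → 2 *ℕ n +ℕ 1 +ℕ n +ℕ 0 +ℕ 0 ≡ 2 *ℕ n +ℕ 1 +ℕ 0 +ℕ (n +ℕ 0)
  at-u = solve 1 (λ n → con 2 :* n :+ con 1 :+ n :+ con 0 :+ con 0
                   := con 2 :* n :+ con 1 :+ con 0 :+ (n :+ con 0)) refl
  at-v : ∀ n → n +ℕ (n +ℕ 0) ≡ n +ℕ n +ℕ 0
  at-v = solve 1 (λ n → n :+ (n :+ con 0) := n :+ n :+ con 0) refl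

-- A spoke whose `u`-end is expanded: vertices 0-2 form the triangle, and vertex 3 is the other end.
-- The legs of the triangle are edge 0 and the dangling lines at `u₁` and `u₂`.
trianglePole : ∀ n → Pole n n
trianglePole n = record
  { #V = 4 ; #E = 4
  ; tl = tl ; hd = hd ; val = val
  ; u₁ = 1F ; u₂ = 2F ; v₁ = 3F ; v₂ = 3F
  ; loopless = λ { 0F () ; 1F () ; 2F () ; 3F () }
  ; bounds = λ { 0F → ℕₚ.≤-refl , n≤ ; 1F → ℕₚ.≤-refl , n≤
               ; 2F → ℕₚ.m≤m+n n 1 , ℕₚ.+-mono-≤ (ℕₚ.m≤n*m n 3) (s≤s z≤n)
               ; 3F → ℕₚ.m≤n*m n 2 , ℕₚ.≤-trans (ℕₚ.*-monoˡ-≤ n (s≤s (s≤s (z≤n {1})))) (ℕₚ.m≤m+n _ 2) }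
  ; conserves = λ { 0F → at-t₁ n ; 1F → at-t₂ n ; 2F → at-t₃ n ; 3F → at-v n }
  ; s≤n = ℕₚ.≤-refl }
  where
  tl hd : Fin 4 → Fin 4
  tl = (3F ∷ 2F ∷ 2F ∷ 0F ∷ []) ▹ λ ()
  hd = (0F ∷ 0F ∷ 1F ∷ 1F ∷ []) ▹ λ ()
  val : Fin 4 → ℕ
  val = (n ∷ n ∷ n +ℕ 1 ∷ 2 *ℕ n ∷ []) ▹ λ ()
  n≤ : n ≤ 3 *ℕ n +ℕ 2
  n≤ = ℕₚ.≤-trans (ℕₚ.m≤n*m n 3) (ℕₚ.m≤m+n _ 2)
  open +-*-Solver
  at-t₁ : ∀ n → 2 *ℕ n +ℕ 0 ≡ n +ℕ (n +ℕ 0)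
  at-t₁ = solve 1 (λ n → con 2 :* n :+ con 0 := n :+ (n :+ con 0)) refl
  at-t₂ : ∀ n → 2 *ℕ n +ℕ 1 +ℕ n +ℕ 0 +ℕ 0 ≡ n +ℕ 1 +ℕ (2 *ℕ n +ℕ 0)
  at-t₂ = solve 1 (λ n → con 2 :* n :+ con 1 :+ n :+ con 0 :+ con 0
                    := n :+ con 1 :+ (con 2 :* n :+ con 0)) refl
  at-t₃ : ∀ n → n +ℕ (n +ℕ 1 +ℕ 0) ≡ 2 *ℕ n +ℕ 1 +ℕ 0 +ℕ 0
  at-t₃ = solve 1 (λ n → n :+ (n :+ con 1 :+ con 0)
                    := con 2 :* n :+ con 1 :+ con 0 :+ con 0) refl
  at-v : ∀ n → n +ℕ (n +ℕ 0) ≡ n +ℕ n +ℕ 0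
  at-v = solve 1 (λ n → n :+ (n :+ con 0) := n :+ n :+ con 0) refl

-- In the Petersen graph with spokes 0-4, P takes the place of spoke 2, and the
-- edges 0-1 of the pentagon and 1-4 of the pentagram are cut.  Vertices 0-3 are
-- the outer ends of spokes 1, 3, 4, 0, and vertices 4-7 the inner ends of
-- spokes 1, 3, 0, 4; edges 0-3 are the lines of P, and edges 8-11 the spokes.
-- The old part is reversed, to keep the signs of the dangling lines.
step : ∀ {n s} → Pole n (suc s) → Pole n s
step {n} {s} P = record
  { #V = 8 +ℕ #V ; #E = 12 +ℕ #E
  ; tl = tl′ ; hd = hd′ ; val = val′
  ; u₁ = 0F ; u₂ = 3F ; v₁ = 7F ; v₂ = 4F
  ; loopless = loopless′
  ; bounds = bounds′
  ; conserves = conserves′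
  ; s≤n = s≤n′ }
  where
  open Pole P
  s≤n′ : s ≤ n
  s≤n′ = ℕₚ.≤-trans (ℕₚ.n≤1+n s) s≤n
  old : Fin #V → Fin (8 +ℕ #V)
  old v = suc (suc (suc (suc (suc (suc (suc (suc v)))))))
  tl′ hd′ : Fin (12 +ℕ #E) → Fin (8 +ℕ #V)
  tl′ = (7F ∷ old u₂ ∷ old v₁ ∷ 1F ∷ 5F ∷ 6F ∷ 3F ∷ 2F ∷ 4F ∷ 2F ∷ 1F ∷ 6F ∷ []) ▹ (old ∘ hd)
  hd′ = (old u₁ ∷ 6F ∷ 0F ∷ old v₂ ∷ 4F ∷ 5F ∷ 2F ∷ 1F ∷ 0F ∷ 7F ∷ 5F ∷ 3F ∷ []) ▹ (old ∘ tl)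
  -- The lines carrying `suc s` end at vertices 0 and 7, where one unit is traded for the constants
  -- 1 and 2, leaving `s` on the new dangling lines. Edge 6 attains the upper bound `3n + 2` of
  -- `Pole`.
  val′ : Fin (12 +ℕ #E) → ℕ
  val′ = (2 *ℕ n +ℕ 1 +ℕ suc s ∷ 2 *ℕ n +ℕ 1 ∷ n +ℕ suc s ∷ n
        ∷ 2 *ℕ n ∷ n ∷ 3 *ℕ n +ℕ 2 ∷ 2 *ℕ n
        ∷ n ∷ n +ℕ 2 ∷ n ∷ n +ℕ 1 ∷ []) ▹ val
  loopless′ : ∀ e → tl′ e ≢ hd′ e
  loopless′ 0F ()
  loopless′ 1F ()
  loopless′ 2F ()
  loopless′ 3F ()
  loopless′ 4F ()
  loopless′ 5F ()
  loopless′ 6F ()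
  loopless′ 7F ()
  loopless′ 8F ()
  loopless′ 9F ()
  loopless′ (suc 9F) ()
  loopless′ (suc (suc 9F)) ()
  loopless′ (suc (suc (suc (suc (suc (suc (suc (suc (suc (suc (suc (suc e)))))))))))) eq =
    loopless e (sym (old-injective eq))
    where
    old-injective : ∀ {x y} → old x ≡ old y → x ≡ y
    old-injective refl = refl
  k·n≤ : ∀ k → k ≤ 3 → k *ℕ n ≤ 3 *ℕ n +ℕ 2
  k·n≤ k k≤3 = ℕₚ.≤-trans (ℕₚ.*-monoˡ-≤ n k≤3) (ℕₚ.m≤m+n _ 2)
  n+ : ∀ k → k ≤ 2 → n ≤ n +ℕ k × n +ℕ k ≤ 3 *ℕ n +ℕ 2
  n+ k k≤2 = ℕₚ.m≤m+n n k , ℕₚ.+-mono-≤ (ℕₚ.m≤n*m n 3) k≤2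
  n≤ : n ≤ n × n ≤ 3 *ℕ n +ℕ 2
  n≤ = ℕₚ.≤-refl , ℕₚ.≤-trans (ℕₚ.m≤n*m n 3) (ℕₚ.m≤m+n _ 2)
  2n≤ : n ≤ 2 *ℕ n × 2 *ℕ n ≤ 3 *ℕ n +ℕ 2
  2n≤ = ℕₚ.m≤n*m n 2 , k·n≤ 2 (s≤s (s≤s z≤n))
  bounds′ : ∀ e → n ≤ val′ e × val′ e ≤ 3 *ℕ n +ℕ 2
  -- The line at `u₁` carries `2n + 1 + suc s`, which `s≤n` of `P` keeps at or below `3n + 1`.
  bounds′ 0F = ℕₚ.≤-trans (proj₁ 2n≤) (ℕₚ.≤-trans (ℕₚ.m≤m+n _ 1) (ℕₚ.m≤m+n _ (suc s)))
    , ℕₚ.≤-trans (ℕₚ.+-monoʳ-≤ (2 *ℕ n +ℕ 1) s≤n)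
      (ℕₚ.≤-trans (ℕₚ.≤-reflexive (lemma n)) (ℕₚ.+-monoʳ-≤ (3 *ℕ n) (s≤s z≤n)))
    where
    open +-*-Solver
    lemma : ∀ n → 2 *ℕ n +ℕ 1 +ℕ n ≡ 3 *ℕ n +ℕ 1
    lemma = solve 1 (λ n → con 2 :* n :+ con 1 :+ n := con 3 :* n :+ con 1) refl
  bounds′ 1F = ℕₚ.≤-trans (proj₁ 2n≤) (ℕₚ.m≤m+n _ 1)
    , ℕₚ.+-mono-≤ (ℕₚ.*-monoˡ-≤ n (s≤s (s≤s (z≤n {1})))) (s≤s z≤n)
  bounds′ 2F = ℕₚ.m≤m+n n _
    , ℕₚ.≤-trans (ℕₚ.+-monoʳ-≤ n s≤n) (ℕₚ.≤-trans (ℕₚ.≤-reflexive (lemma n)) (proj₂ 2n≤))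
    where
    open +-*-Solver
    lemma : ∀ n → n +ℕ n ≡ 2 *ℕ n
    lemma = solve 1 (λ n → n :+ n := con 2 :* n) refl
  bounds′ 3F = n≤
  bounds′ 4F = 2n≤
  bounds′ 5F = n≤
  bounds′ 6F = ℕₚ.≤-trans (proj₁ n≤) (proj₂ n≤) , ℕₚ.≤-refl
  bounds′ 7F = 2n≤
  bounds′ 8F = n≤
  bounds′ 9F = n+ 2 ℕₚ.≤-refl
  bounds′ (suc 9F) = n≤
  bounds′ (suc (suc 9F)) = n+ 1 (s≤s z≤n)
  bounds′ (suc (suc (suc (suc (suc (suc (suc (suc (suc (suc (suc (suc e)))))))))))) = bounds e
  open +-*-Solver
  conserves′ : ∀ v →
      [ 0F ≐ v ] (2 *ℕ n +ℕ 1 +ℕ s) +ℕ [ 4F ≐ v ] n +ℕ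
        Σᶠ (12 +ℕ #E) (λ e → [ tl′ e ≐ v ] (val′ e)) ≡
      [ 3F ≐ v ] (2 *ℕ n +ℕ 1) +ℕ [ 7F ≐ v ] (n +ℕ s) +ℕ
        Σᶠ (12 +ℕ #E) (λ e → [ hd′ e ≐ v ] (val′ e))
  conserves′ 0F rewrite Σᶠ-zero #E = lemma n s
    where
    lemma : ∀ n s → 2 *ℕ n +ℕ 1 +ℕ s +ℕ 0 +ℕ 0 ≡ n +ℕ suc s +ℕ (n +ℕ 0)
    lemma = solve 2 (λ n s → con 2 :* n :+ con 1 :+ s :+ con 0 :+ con 0
                     := n :+ (con 1 :+ s) :+ (n :+ con 0)) refl
  conserves′ 1F rewrite Σᶠ-zero #E = lemma n
    where
    lemma : ∀ n → n +ℕ (n +ℕ 0) ≡ 2 *ℕ n +ℕ 0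
    lemma = solve 1 (λ n → n :+ (n :+ con 0) := con 2 :* n :+ con 0) refl
  conserves′ 2F rewrite Σᶠ-zero #E = lemma n
    where
    lemma : ∀ n → 2 *ℕ n +ℕ (n +ℕ 2 +ℕ 0) ≡ 3 *ℕ n +ℕ 2 +ℕ 0
    lemma = solve 1 (λ n → con 2 :* n :+ (n :+ con 2 :+ con 0) := con 3 :* n :+ con 2 :+ con 0) refl
  conserves′ 3F rewrite Σᶠ-zero #E = lemma n
    where
    lemma : ∀ n → 3 *ℕ n +ℕ 2 +ℕ 0 ≡ 2 *ℕ n +ℕ 1 +ℕ 0 +ℕ (n +ℕ 1 +ℕ 0)
    lemma = solve 1 (λ n → con 3 :* n :+ con 2 :+ con 0
                     := con 2 :* n :+ con 1 :+ con 0 :+ (n :+ con 1 :+ con 0)) refl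
  conserves′ 4F rewrite Σᶠ-zero #E = lemma n
    where
    lemma : ∀ n → n +ℕ (n +ℕ 0) ≡ 2 *ℕ n +ℕ 0
    lemma = solve 1 (λ n → n :+ (n :+ con 0) := con 2 :* n :+ con 0) refl
  conserves′ 5F rewrite Σᶠ-zero #E = lemma n
    where
    lemma : ∀ n → 2 *ℕ n +ℕ 0 ≡ n +ℕ (n +ℕ 0)
    lemma = solve 1 (λ n → con 2 :* n :+ con 0 := n :+ (n :+ con 0)) refl
  conserves′ 6F rewrite Σᶠ-zero #E = lemma n
    where
    lemma : ∀ n → n +ℕ (n +ℕ 1 +ℕ 0) ≡ 2 *ℕ n +ℕ 1 +ℕ 0
    lemma = solve 1 (λ n → n :+ (n :+ con 1 :+ con 0) := con 2 :* n :+ con 1 :+ con 0) refl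
  conserves′ 7F rewrite Σᶠ-zero #E = lemma n s
    where
    lemma : ∀ n s → 2 *ℕ n +ℕ 1 +ℕ suc s +ℕ 0 ≡ n +ℕ s +ℕ (n +ℕ 2 +ℕ 0)
    lemma = solve 2 (λ n s → con 2 :* n :+ con 1 :+ (con 1 :+ s) :+ con 0
                     := n :+ s :+ (n :+ con 2 :+ con 0)) refl
  -- Both sides reduce to those of `conserves v`, interchanged by the reversal of the old edges; the
  -- dangling lines of `P` are now ordinary edges.
  conserves′ (suc (suc (suc (suc (suc (suc (suc (suc v)))))))) =
    trans (sym (ℕₚ.+-assoc ([ u₂ ≐ v ] _) ([ v₁ ≐ v ] _) _))
      (trans (sym (conserves v)) (ℕₚ.+-assoc ([ u₁ ≐ v ] _) ([ v₂ ≐ v ] _) _))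

-- The perfect matching to be thickened; a x has out-degree 2 and b x has
-- out-degree 1, dangling lines included.
record Thickening {n s} (P : Pole n s) : Set where
  open Pole P
  field
    #X      : ℕ
    edge    : Fin #X → Fin #E
    a b     : Fin #X → Fin #V
    ends    : ∀ x → (a x ≡ tl (edge x) × b x ≡ hd (edge x)) ⊎
                    (a x ≡ hd (edge x) × b x ≡ tl (edge x))
    out-degree : ∀ v → [ u₁ ≐ v ] 1 +ℕ [ v₂ ≐ v ] 1 +ℕ Σᶠ #E (λ e → [ tl e ≐ v ] 1)
                     ≡ 1 +ℕ Σᶠ #X (λ x → [ a x ≐ v ] 1)
    in-degree  : ∀ v → [ u₂ ≐ v ] 1 +ℕ [ v₁ ≐ v ] 1 +ℕ Σᶠ #E (λ e → [ hd e ≐ v ] 1)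
                     ≡ 1 +ℕ Σᶠ #X (λ x → [ b x ≐ v ] 1)
    perfect    : ∀ v → Σᶠ #X (λ x → [ a x ≐ v ] 1) +ℕ Σᶠ #X (λ x → [ b x ≐ v ] 1) ≡ 1

spokeThickening : ∀ n → Thickening (spokePole n)
spokeThickening n = record
  { #X = 1 ; edge = λ _ → 0F ; a = λ _ → 1F ; b = λ _ → 0F
  ; ends = λ _ → inj₁ (refl , refl)
  ; out-degree = λ { 0F → refl ; 1F → refl }
  ; in-degree  = λ { 0F → refl ; 1F → refl }
  ; perfect    = λ { 0F → refl ; 1F → refl } }

-- The four new spokes are added. On the old part `a` and `b` trade places, since reversal exchanges
-- out-degree 2 and out-degree 1.
stepThickening : ∀ {n s} {P : Pole n (suc s)} → Thickening P → Thickening (step P)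
stepThickening {n} {s} {P} T = record
  { #X = 4 +ℕ #X
  ; edge = (8F ∷ 9F ∷ suc 9F ∷ suc (suc 9F) ∷ []) ▹ (12 ↑ʳ_) ∘ edge
  ; a = (4F ∷ 2F ∷ 1F ∷ 6F ∷ []) ▹ (8 ↑ʳ_) ∘ b
  ; b = (0F ∷ 7F ∷ 5F ∷ 3F ∷ []) ▹ (8 ↑ʳ_) ∘ a
  ; ends = ends′
  ; out-degree = out′ ; in-degree = in′ ; perfect = perfect′ }
  where
  open Pole P
  open Thickening T
  module S = Pole (step P)
  ends′ : ∀ x → _
  ends′ 0F = inj₁ (refl , refl)
  ends′ 1F = inj₁ (refl , refl)
  ends′ 2F = inj₁ (refl , refl)
  ends′ 3F = inj₁ (refl , refl)
  ends′ (suc (suc (suc (suc x)))) with ends x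
  ... | inj₁ (p , q) = inj₁ (cong (8 ↑ʳ_) q , cong (8 ↑ʳ_) p)
  ... | inj₂ (p , q) = inj₂ (cong (8 ↑ʳ_) q , cong (8 ↑ʳ_) p)
  out′ : ∀ v → _
  out′ 0F rewrite Σᶠ-zero #E | Σᶠ-zero #X = refl
  out′ 1F rewrite Σᶠ-zero #E | Σᶠ-zero #X = refl
  out′ 2F rewrite Σᶠ-zero #E | Σᶠ-zero #X = refl
  out′ 3F rewrite Σᶠ-zero #E | Σᶠ-zero #X = refl
  out′ 4F rewrite Σᶠ-zero #E | Σᶠ-zero #X = refl
  out′ 5F rewrite Σᶠ-zero #E | Σᶠ-zero #X = refl
  out′ 6F rewrite Σᶠ-zero #E | Σᶠ-zero #X = refl
  out′ 7F rewrite Σᶠ-zero #E | Σᶠ-zero #X = refl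
  out′ (suc (suc (suc (suc (suc (suc (suc (suc v)))))))) =
    trans (sym (ℕₚ.+-assoc ([ u₂ ≐ v ] 1) ([ v₁ ≐ v ] 1) _)) (in-degree v)
  in′ : ∀ v → _
  in′ 0F rewrite Σᶠ-zero #E | Σᶠ-zero #X = refl
  in′ 1F rewrite Σᶠ-zero #E | Σᶠ-zero #X = refl
  in′ 2F rewrite Σᶠ-zero #E | Σᶠ-zero #X = refl
  in′ 3F rewrite Σᶠ-zero #E | Σᶠ-zero #X = refl
  in′ 4F rewrite Σᶠ-zero #E | Σᶠ-zero #X = refl
  in′ 5F rewrite Σᶠ-zero #E | Σᶠ-zero #X = refl
  in′ 6F rewrite Σᶠ-zero #E | Σᶠ-zero #X = refl
  in′ 7F rewrite Σᶠ-zero #E | Σᶠ-zero #X = refl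
  in′ (suc (suc (suc (suc (suc (suc (suc (suc v)))))))) =
    trans (sym (ℕₚ.+-assoc ([ u₁ ≐ v ] 1) ([ v₂ ≐ v ] 1) _)) (out-degree v)
  perfect′ : ∀ v → _
  perfect′ 0F rewrite Σᶠ-zero #X = refl
  perfect′ 1F rewrite Σᶠ-zero #X = refl
  perfect′ 2F rewrite Σᶠ-zero #X = refl
  perfect′ 3F rewrite Σᶠ-zero #X = refl
  perfect′ 4F rewrite Σᶠ-zero #X = refl
  perfect′ 5F rewrite Σᶠ-zero #X = refl
  perfect′ 6F rewrite Σᶠ-zero #X = refl
  perfect′ 7F rewrite Σᶠ-zero #X = refl
  perfect′ (suc (suc (suc (suc (suc (suc (suc (suc v)))))))) =
    trans (ℕₚ.+-comm (Σᶠ #X (λ x → [ b x ≐ v ] 1)) _) (perfect v)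

triangleThickening : ∀ n → Thickening (step (trianglePole (suc n)))
triangleThickening n = record
  { #X = 6
  ; edge = (suc (suc (suc 9F)) ∷ 0F ∷ 1F ∷ 6F ∷ 8F ∷ suc 9F ∷ []) ▹ λ ()
  ; a = (t 0F ∷ t 1F ∷ 6F ∷ 2F ∷ 4F ∷ 1F ∷ []) ▹ λ ()
  ; b = (t 3F ∷ 7F ∷ t 2F ∷ 3F ∷ 0F ∷ 5F ∷ []) ▹ λ ()
  ; ends = λ { 0F → inj₁ (refl , refl) ; 1F → inj₂ (refl , refl) ; 2F → inj₂ (refl , refl)
             ; 3F → inj₂ (refl , refl) ; 4F → inj₁ (refl , refl) ; 5F → inj₁ (refl , refl) }
  ; out-degree = λ { 0F → refl ; 1F → refl ; 2F → refl ; 3F → refl ; 4F → refl ; 5F → refl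
                   ; 6F → refl ; 7F → refl ; 8F → refl ; 9F → refl
                   ; (suc 9F) → refl ; (suc (suc 9F)) → refl }
  ; in-degree  = λ { 0F → refl ; 1F → refl ; 2F → refl ; 3F → refl ; 4F → refl ; 5F → refl
                   ; 6F → refl ; 7F → refl ; 8F → refl ; 9F → refl
                   ; (suc 9F) → refl ; (suc (suc 9F)) → refl }
  ; perfect    = λ { 0F → refl ; 1F → refl ; 2F → refl ; 3F → refl ; 4F → refl ; 5F → refl
                   ; 6F → refl ; 7F → refl ; 8F → refl ; 9F → refl
                   ; (suc 9F) → refl ; (suc (suc 9F)) → refl } }
  where
  t : Fin 4 → Fin 12
  t = 8 ↑ʳ_

-- Regular graphs from poles

length-filter-tabulate : ∀ {A : Set} {P : Pred A 0ℓ} (P? : Decidable P) m (g : Fin m → A) →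
  length (filter P? (tabulate g)) ≡ Σᶠ m (λ i → if does (P? (g i)) then 1 else 0)
length-filter-tabulate P? zero    g = refl
length-filter-tabulate P? (suc m) g with does (P? (g zero))
... | true  = cong suc (length-filter-tabulate P? m (g ∘ suc))
... | false = length-filter-tabulate P? m (g ∘ suc)

degree-Σ : ∀ (G : Graph) (let open Graph G) v →
  degree G v ≡ Σᶠ #E (λ e → [ end₁ e ≐ v ] 1) +ℕ Σᶠ #E (λ e → [ end₂ e ≐ v ] 1)
degree-Σ G v = trans (length-filter-tabulate (λ e → incident? G e v) #E id)
  (trans (Σᶠ-cong #E split) (Σᶠ-+ #E _ _))
  where
  open Graph G
  split : ∀ e → (if does (incident? G e v) then 1 else 0) ≡ [ end₁ e ≐ v ] 1 +ℕ [ end₂ e ≐ v ] 1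
  split e with end₁ e ≟ᶠ v | end₂ e ≟ᶠ v
  ... | yes p | yes q = contradiction (trans p (sym q)) (loopless e)
  ... | yes p | no  _ = refl
  ... | no  _ | yes q = refl
  ... | no  _ | no  _ = refl

Apart : ∀ {n s} → Pole n s → Set
Apart P = u₁ ≢ u₂ × v₁ ≢ v₂ where open Pole P

-- Joins u₁ to u₂ and v₂ to v₁, and adds r parallel copies of each thickened
-- edge in either direction.
module Closing {n : ℕ} (P : Pole n 0) (apart : Apart P) (T : Thickening P) (r : ℕ) where
  open Pole P
  open Thickening T

  -- Edges before numbering: the closed cubic graph on the left; on the right, for each thickened
  -- edge, `r` copies from `a` to `b` and `r` copies back. Arguments are made here and carried over
  -- to `Fin #Ê` by `decode` and `encode`.
  Ê : Set
  Ê = Fin (2 +ℕ #E) ⊎ (Fin #X × (Fin r ⊎ Fin r))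

  #Ê : ℕ
  #Ê = (2 +ℕ #E) +ℕ #X *ℕ (r +ℕ r)

  unpair : Fin #X × Fin (r +ℕ r) → Fin #X × (Fin r ⊎ Fin r)
  unpair (x , j) = x , splitAt r j

  decode : Fin #Ê → Ê
  decode e = map₂ (unpair ∘ remQuot (r +ℕ r)) (splitAt (2 +ℕ #E) e)

  encode : Ê → Fin #Ê
  encode (inj₁ e)       = e ↑ˡ (#X *ℕ (r +ℕ r))
  encode (inj₂ (x , z)) = (2 +ℕ #E) ↑ʳ combine x (join r r z)

  decode-encode : ∀ e → decode (encode e) ≡ e
  decode-encode (inj₁ e) =
    cong (map₂ (unpair ∘ remQuot (r +ℕ r))) (splitAt-↑ˡ (2 +ℕ #E) e (#X *ℕ (r +ℕ r)))
  decode-encode (inj₂ (x , z)) = trans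
    (cong (map₂ (unpair ∘ remQuot (r +ℕ r)))
      (splitAt-↑ʳ (2 +ℕ #E) (#X *ℕ (r +ℕ r)) (combine x (join r r z))))
    (cong inj₂ (trans (cong unpair (remQuot-combine x (join r r z))) (cong (x ,_) (splitAt-join r r z))))

  encode-decode : ∀ e → encode (decode e) ≡ e
  encode-decode e with splitAt (2 +ℕ #E) e in eq
  ... | inj₁ i = splitAt⁻¹-↑ˡ eq
  ... | inj₂ y = trans (cong ((2 +ℕ #E) ↑ʳ_) (trans
    (cong (combine (proj₁ (remQuot {#X} (r +ℕ r) y))) (join-splitAt r r _))
    (combine-remQuot {#X} (r +ℕ r) y))) (splitAt⁻¹-↑ʳ eq)

  Σ-decode : (f : Ê → ℕ) → Σᶠ #Ê (f ∘ decode) ≡ Σᶠ (2 +ℕ #E) (f ∘ inj₁) +ℕ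
    Σᶠ #X (λ x → Σᶠ r (λ j → f (inj₂ (x , inj₁ j))) +ℕ Σᶠ r (λ j → f (inj₂ (x , inj₂ j))))
  Σ-decode f = trans (Σᶠ-split (2 +ℕ #E) (#X *ℕ (r +ℕ r)) (f ∘ decode))
    (cong₂ _+ℕ_ (Σᶠ-cong (2 +ℕ #E) (λ e → cong f (decode-encode (inj₁ e))))
      (trans (Σᶠ-combine #X (r +ℕ r) _) (Σᶠ-cong #X λ x →
        trans (Σᶠ-split r r _) (cong₂ _+ℕ_
          (Σᶠ-cong r (λ j → cong f (decode-encode (inj₂ (x , inj₁ j)))))
          (Σᶠ-cong r (λ j → cong f (decode-encode (inj₂ (x , inj₂ j)))))))))

  tl° hd° : Fin (2 +ℕ #E) → Fin #V
  tl° = (u₁ ∷ v₂ ∷ []) ▹ tl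
  hd° = (u₂ ∷ v₁ ∷ []) ▹ hd

  val° : Fin (2 +ℕ #E) → ℕ
  val° = (2 *ℕ n +ℕ 1 ∷ n ∷ []) ▹ val

  loopless° : ∀ e → tl° e ≢ hd° e
  loopless° 0F            = proj₁ apart
  loopless° 1F            = proj₂ apart ∘ sym
  loopless° (suc (suc e)) = loopless e

  bounds° : ∀ e → n ≤ val° e × val° e ≤ 3 *ℕ n +ℕ 2
  bounds° 0F = ℕₚ.≤-trans (ℕₚ.m≤n*m n 2) (ℕₚ.m≤m+n _ 1)
    , ℕₚ.+-mono-≤ (ℕₚ.*-monoˡ-≤ n (s≤s (s≤s (z≤n {1})))) (s≤s z≤n)
  bounds° 1F = ℕₚ.≤-refl , ℕₚ.≤-trans (ℕₚ.m≤n*m n 3) (ℕₚ.m≤m+n _ 2)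
  bounds° (suc (suc e)) = bounds e

  tl^ hd^ : Ê → Fin #V
  tl^ (inj₁ e)            = tl° e
  tl^ (inj₂ (x , inj₁ _)) = a x
  tl^ (inj₂ (x , inj₂ _)) = b x
  hd^ (inj₁ e)            = hd° e
  hd^ (inj₂ (x , inj₁ _)) = b x
  hd^ (inj₂ (x , inj₂ _)) = a x

  a≢b : ∀ x → a x ≢ b x
  a≢b x eq with ends x
  ... | inj₁ (p , q) = loopless (edge x) (trans (sym p) (trans eq q))
  ... | inj₂ (p , q) = loopless (edge x) (trans (sym q) (trans (sym eq) p))

  loopless^ : ∀ e → tl^ e ≢ hd^ e
  loopless^ (inj₁ e)            = loopless° e
  loopless^ (inj₂ (x , inj₁ _)) = a≢b x
  loopless^ (inj₂ (x , inj₂ _)) = a≢b x ∘ sym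

  graph : Graph
  graph = record { #V = #V ; #E = #Ê ; end₁ = tl^ ∘ decode ; end₂ = hd^ ∘ decode
                 ; loopless = loopless^ ∘ decode }

  -- Raising all base edges by `2rn` creates a net outflow of `2rn` at `a x`, where one more base
  -- edge leaves than enters. The copies bring in `r(2r + 3)n` and take out `r(2r + 1)n`, which
  -- cancels it; at `b x` all signs are opposite.
  val^ : Ê → ℕ
  val^ (inj₁ e)            = val° e +ℕ 2 *ℕ r *ℕ n
  val^ (inj₂ (x , inj₁ _)) = (2 *ℕ r +ℕ 1) *ℕ n
  val^ (inj₂ (x , inj₂ _)) = (2 *ℕ r +ℕ 3) *ℕ n

  bounds^ : ∀ e → (2 *ℕ r +ℕ 1) *ℕ n ≤ val^ e × val^ e ≤ (2 *ℕ r +ℕ 3) *ℕ n +ℕ 2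
  bounds^ (inj₁ e) =
    ℕₚ.≤-trans (ℕₚ.≤-reflexive (lemma₁ r n)) (ℕₚ.+-monoˡ-≤ (2 *ℕ r *ℕ n) (proj₁ (bounds° e)))
    , ℕₚ.≤-trans (ℕₚ.+-monoˡ-≤ (2 *ℕ r *ℕ n) (proj₂ (bounds° e))) (ℕₚ.≤-reflexive (lemma₂ r n))
    where
    open +-*-Solver
    lemma₁ : ∀ r n → (2 *ℕ r +ℕ 1) *ℕ n ≡ n +ℕ 2 *ℕ r *ℕ n
    lemma₁ = solve 2 (λ r n → (con 2 :* r :+ con 1) :* n := n :+ con 2 :* r :* n) refl
    lemma₂ : ∀ r n → 3 *ℕ n +ℕ 2 +ℕ 2 *ℕ r *ℕ n ≡ (2 *ℕ r +ℕ 3) *ℕ n +ℕ 2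
    lemma₂ = solve 2 (λ r n → con 3 :* n :+ con 2 :+ con 2 :* r :* n
                      := (con 2 :* r :+ con 3) :* n :+ con 2) refl
  bounds^ (inj₂ (x , inj₁ _)) = ℕₚ.≤-refl ,
    ℕₚ.≤-trans (ℕₚ.*-monoˡ-≤ n (ℕₚ.+-monoʳ-≤ (2 *ℕ r) (s≤s (z≤n {2})))) (ℕₚ.m≤m+n _ 2)
  bounds^ (inj₂ (x , inj₂ _)) = ℕₚ.*-monoˡ-≤ n (ℕₚ.+-monoʳ-≤ (2 *ℕ r) (s≤s (z≤n {2}))) , ℕₚ.m≤m+n _ 2

  α β : Fin #V → ℕ
  α v = Σᶠ #X (λ x → [ a x ≐ v ] 1)
  β v = Σᶠ #X (λ x → [ b x ≐ v ] 1)

  out° : ∀ v → Σᶠ (2 +ℕ #E) (λ e → [ tl° e ≐ v ] 1) ≡ 1 +ℕ α v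
  out° v = trans (sym (ℕₚ.+-assoc ([ u₁ ≐ v ] 1) _ _)) (out-degree v)

  in° : ∀ v → Σᶠ (2 +ℕ #E) (λ e → [ hd° e ≐ v ] 1) ≡ 1 +ℕ β v
  in° v = trans (sym (ℕₚ.+-assoc ([ u₂ ≐ v ] 1) _ _)) (in-degree v)

  conserves° : ∀ v → Σᶠ (2 +ℕ #E) (λ e → [ tl° e ≐ v ] (val° e)) ≡
                     Σᶠ (2 +ℕ #E) (λ e → [ hd° e ≐ v ] (val° e))
  conserves° v with conserves v
  ... | eq rewrite ℕₚ.+-identityʳ (2 *ℕ n +ℕ 1) | ℕₚ.+-identityʳ n =
    trans (sym (ℕₚ.+-assoc ([ u₁ ≐ v ] _) ([ v₂ ≐ v ] n) _))
      (trans eq (ℕₚ.+-assoc ([ u₂ ≐ v ] _) ([ v₁ ≐ v ] n) _))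

  Σ-parallel : ∀ (y z : Fin #X → Fin #V) p q v →
    Σᶠ #X (λ x → Σᶠ r (λ _ → [ y x ≐ v ] p) +ℕ Σᶠ r (λ _ → [ z x ≐ v ] q)) ≡
    r *ℕ p *ℕ Σᶠ #X (λ x → [ y x ≐ v ] 1) +ℕ r *ℕ q *ℕ Σᶠ #X (λ x → [ z x ≐ v ] 1)
  Σ-parallel y z p q v = trans
    (Σᶠ-cong #X λ x → cong₂ _+ℕ_ (scale (y x) p) (scale (z x) q))
    (trans (Σᶠ-+ #X _ _) (cong₂ _+ℕ_ (Σᶠ-*ʳ #X _ (r *ℕ p)) (Σᶠ-*ʳ #X _ (r *ℕ q))))
    where
    scale : ∀ w p → Σᶠ r (λ _ → [ w ≐ v ] p) ≡ r *ℕ p *ℕ [ w ≐ v ] 1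
    scale w p = trans (Σᶠ-const r _) (trans (cong (r *ℕ_) (≐-* w v p)) (sym (ℕₚ.*-assoc r p _)))

  regular : Regular graph (2 *ℕ r +ℕ 3)
  regular v = trans (degree-Σ graph v) (trans
    (cong₂ _+ℕ_
      (trans (Σ-decode (λ e → [ tl^ e ≐ v ] 1)) (cong₂ _+ℕ_ (out° v) (Σ-parallel a b 1 1 v)))
      (trans (Σ-decode (λ e → [ hd^ e ≐ v ] 1)) (cong₂ _+ℕ_ (in° v) (Σ-parallel b a 1 1 v))))
    (count r (α v) (β v) (perfect v)))
    where
    open +-*-Solver
    count : ∀ r α β → α +ℕ β ≡ 1 →
      1 +ℕ α +ℕ (r *ℕ 1 *ℕ α +ℕ r *ℕ 1 *ℕ β) +ℕ (1 +ℕ β +ℕ (r *ℕ 1 *ℕ β +ℕ r *ℕ 1 *ℕ α)) ≡ 2 *ℕ r +ℕ 3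
    count r α β eq = trans (expand r α β) (trans (cong (λ z → z +ℕ 2 +ℕ 2 *ℕ r *ℕ z) eq) (collect r))
      where
      expand : ∀ r α β →
        1 +ℕ α +ℕ (r *ℕ 1 *ℕ α +ℕ r *ℕ 1 *ℕ β) +ℕ (1 +ℕ β +ℕ (r *ℕ 1 *ℕ β +ℕ r *ℕ 1 *ℕ α)) ≡
        (α +ℕ β) +ℕ 2 +ℕ 2 *ℕ r *ℕ (α +ℕ β)
      expand = solve 3 (λ r α β →
        con 1 :+ α :+ (r :* con 1 :* α :+ r :* con 1 :* β) :+ (con 1 :+ β :+ (r :* con 1 :* β :+ r :* con 1 :* α))
        := (α :+ β) :+ con 2 :+ con 2 :* r :* (α :+ β)) refl
      collect : ∀ r → 1 +ℕ 2 +ℕ 2 *ℕ r *ℕ 1 ≡ 2 *ℕ r +ℕ 3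
      collect = solve 1 (λ r → con 1 :+ con 2 :+ con 2 :* r :* con 1 := con 2 :* r :+ con 3) refl

  conserves^ : ∀ v → Σᶠ #Ê (λ e → [ tl^ (decode e) ≐ v ] (val^ (decode e))) ≡
                     Σᶠ #Ê (λ e → [ hd^ (decode e) ≐ v ] (val^ (decode e)))
  conserves^ v = begin
    Σᶠ #Ê (λ e → [ tl^ (decode e) ≐ v ] (val^ (decode e)))
      ≡⟨ Σ-decode (λ e → [ tl^ e ≐ v ] (val^ e)) ⟩
    _ ≡⟨ cong₂ _+ℕ_ (trans (shifted tl°) (cong (λ z → F +ℕ h *ℕ z) (out° v))) (Σ-parallel a b lo hi v) ⟩
    F +ℕ h *ℕ (1 +ℕ α v) +ℕ (r *ℕ lo *ℕ α v +ℕ r *ℕ hi *ℕ β v)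
      ≡⟨ balance r n F (α v) (β v) (perfect v) ⟩
    F +ℕ h *ℕ (1 +ℕ β v) +ℕ (r *ℕ lo *ℕ β v +ℕ r *ℕ hi *ℕ α v)
      ≡⟨ cong (λ z → z +ℕ h *ℕ (1 +ℕ β v) +ℕ (r *ℕ lo *ℕ β v +ℕ r *ℕ hi *ℕ α v)) (conserves° v) ⟩
    F′ +ℕ h *ℕ (1 +ℕ β v) +ℕ (r *ℕ lo *ℕ β v +ℕ r *ℕ hi *ℕ α v)
      ≡⟨ cong₂ _+ℕ_ (trans (shifted hd°) (cong (λ z → F′ +ℕ h *ℕ z) (in° v))) (Σ-parallel b a lo hi v) ⟨
    _ ≡⟨ Σ-decode (λ e → [ hd^ e ≐ v ] (val^ e)) ⟨
    Σᶠ #Ê (λ e → [ hd^ (decode e) ≐ v ] (val^ (decode e))) ∎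
    where
    open ≡-Reasoning
    F F′ : ℕ
    F  = Σᶠ (2 +ℕ #E) (λ e → [ tl° e ≐ v ] (val° e))
    F′ = Σᶠ (2 +ℕ #E) (λ e → [ hd° e ≐ v ] (val° e))
    h lo hi : ℕ
    h  = 2 *ℕ r *ℕ n
    lo = (2 *ℕ r +ℕ 1) *ℕ n
    hi = (2 *ℕ r +ℕ 3) *ℕ n
    shifted : ∀ (y : Fin (2 +ℕ #E) → Fin #V) →
      Σᶠ (2 +ℕ #E) (λ e → [ y e ≐ v ] (val° e +ℕ h)) ≡
      Σᶠ (2 +ℕ #E) (λ e → [ y e ≐ v ] (val° e)) +ℕ h *ℕ Σᶠ (2 +ℕ #E) (λ e → [ y e ≐ v ] 1)
    shifted y = trans
      (Σᶠ-cong (2 +ℕ #E) λ e → trans (≐-+ (y e) v (val° e) h) (cong ([ y e ≐ v ] (val° e) +ℕ_) (≐-* (y e) v h)))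
      (trans (Σᶠ-+ (2 +ℕ #E) (λ e → [ y e ≐ v ] (val° e)) (λ e → h *ℕ [ y e ≐ v ] 1))
        (cong (Σᶠ (2 +ℕ #E) (λ e → [ y e ≐ v ] (val° e)) +ℕ_) (Σᶠ-*ʳ (2 +ℕ #E) (λ e → [ y e ≐ v ] 1) h)))
    balance : ∀ r n F α β → α +ℕ β ≡ 1 →
      F +ℕ 2 *ℕ r *ℕ n *ℕ (1 +ℕ α) +ℕ (r *ℕ ((2 *ℕ r +ℕ 1) *ℕ n) *ℕ α +ℕ r *ℕ ((2 *ℕ r +ℕ 3) *ℕ n) *ℕ β) ≡
      F +ℕ 2 *ℕ r *ℕ n *ℕ (1 +ℕ β) +ℕ (r *ℕ ((2 *ℕ r +ℕ 1) *ℕ n) *ℕ β +ℕ r *ℕ ((2 *ℕ r +ℕ 3) *ℕ n) *ℕ α)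
    balance r n F zero       .1         refl = at-b r n F
      where
      open +-*-Solver
      at-b : ∀ r n F →
        F +ℕ 2 *ℕ r *ℕ n *ℕ 1 +ℕ (r *ℕ ((2 *ℕ r +ℕ 1) *ℕ n) *ℕ 0 +ℕ r *ℕ ((2 *ℕ r +ℕ 3) *ℕ n) *ℕ 1) ≡
        F +ℕ 2 *ℕ r *ℕ n *ℕ 2 +ℕ (r *ℕ ((2 *ℕ r +ℕ 1) *ℕ n) *ℕ 1 +ℕ r *ℕ ((2 *ℕ r +ℕ 3) *ℕ n) *ℕ 0)
      at-b = solve 3 (λ r n F →
        F :+ con 2 :* r :* n :* con 1 :+ (r :* ((con 2 :* r :+ con 1) :* n) :* con 0 :+ r :* ((con 2 :* r :+ con 3) :* n) :* con 1)
        := F :+ con 2 :* r :* n :* con 2 :+ (r :* ((con 2 :* r :+ con 1) :* n) :* con 1 :+ r :* ((con 2 :* r :+ con 3) :* n) :* con 0)) refl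
    balance r n F (suc zero) zero       refl = sym (balance r n F 0 1 refl)

-- Flows with rational values

-- Recursive, so that homomorphism laws follow by induction and numerals such as `ι 2` and `ι 8`
-- evaluate to constants in the ring solver.
ι : ℕ → ℚ
ι zero    = 0ℚ
ι (suc k) = 1ℚ + ι k

ι-+ : ∀ j k → ι (j +ℕ k) ≡ ι j + ι k
ι-+ zero    k = sym (ℚₚ.+-identityˡ (ι k))
ι-+ (suc j) k = trans (cong (λ z → 1ℚ + z) (ι-+ j k)) (sym (ℚₚ.+-assoc 1ℚ (ι j) (ι k)))

ι-* : ∀ j k → ι (j *ℕ k) ≡ ι j * ι k
ι-* zero    k = sym (ℚₚ.*-zeroˡ (ι k))
ι-* (suc j) k = begin
  ι (k +ℕ j *ℕ k)       ≡⟨ ι-+ k (j *ℕ k) ⟩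
  ι k + ι (j *ℕ k)      ≡⟨ cong₂ _+_ (sym (ℚₚ.*-identityˡ (ι k))) (ι-* j k) ⟩
  1ℚ * ι k + ι j * ι k  ≡⟨ ℚₚ.*-distribʳ-+ (ι k) 1ℚ (ι j) ⟨
  (1ℚ + ι j) * ι k      ∎
  where open ≡-Reasoning

0≤ι : ∀ k → 0ℚ ≤ℚ ι k
0≤ι zero    = ℚₚ.≤-refl
0≤ι (suc k) = ℚₚ.+-mono-≤ (ℚₚ.nonNegative⁻¹ 1ℚ) (0≤ι k)

ι-mono : ∀ {j k} → j ≤ k → ι j ≤ℚ ι k
ι-mono {k = k} z≤n = 0≤ι k
ι-mono (s≤s j≤k) = ℚₚ.+-monoʳ-≤ 1ℚ (ι-mono j≤k)

suc-/ : ∀ j k → + suc j / suc k ≡ + 1 / suc k + + j / suc k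
suc-/ j k = ℚₚ.toℚᵘ-injective (begin
  toℚᵘ (+ suc j / suc k)                        ≈⟨ ℚₚ.toℚᵘ-fromℚᵘ (ℚᵘ.mkℚᵘ (+ suc j) k) ⟩
  ℚᵘ.mkℚᵘ (+ suc j) k                           ≈⟨ ℚᵘ.*≡* (lemma (+ j) (+ suc k)) ⟩
  ℚᵘ.mkℚᵘ (+ 1) k ℚᵘ.+ ℚᵘ.mkℚᵘ (+ j) k
    ≈⟨ ℚᵘₚ.+-cong (ℚₚ.toℚᵘ-fromℚᵘ (ℚᵘ.mkℚᵘ (+ 1) k)) (ℚₚ.toℚᵘ-fromℚᵘ (ℚᵘ.mkℚᵘ (+ j) k)) ⟨
  toℚᵘ (+ 1 / suc k) ℚᵘ.+ toℚᵘ (+ j / suc k)    ≈⟨ ℚₚ.toℚᵘ-homo-+ (+ 1 / suc k) (+ j / suc k) ⟨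
  toℚᵘ (+ 1 / suc k + + j / suc k)              ∎)
  where
  open ℚᵘₚ.≃-Reasoning
  open ℤ-Solver.+-*-Solver
  lemma : ∀ j k → (+ 1 ℤ.+ j) ℤ.* (k ℤ.* k) ≡ (+ 1 ℤ.* k ℤ.+ j ℤ.* k) ℤ.* k
  lemma = solve 2 (λ j k → (con (+ 1) :+ j) :* (k :* k) := (con (+ 1) :* k :+ j :* k) :* k) refl

k/k≡1 : ∀ k → + suc k / suc k ≡ 1ℚ
k/k≡1 k = ℚₚ.toℚᵘ-injective (ℚᵘₚ.≃-trans (ℚₚ.toℚᵘ-fromℚᵘ (ℚᵘ.mkℚᵘ (+ suc k) k))
  (ℚᵘ.*≡* (ℤₚ.*-comm (+ suc k) (+ 1))))

/≡ι* : ∀ j k → + j / suc k ≡ ι j * (+ 1 / suc k)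
/≡ι* zero    k = trans (ℚₚ.toℚᵘ-injective (ℚᵘₚ.≃-trans (ℚₚ.toℚᵘ-fromℚᵘ (ℚᵘ.mkℚᵘ (+ 0) k)) (ℚᵘ.*≡* refl)))
                   (sym (ℚₚ.*-zeroˡ (+ 1 / suc k)))
/≡ι* (suc j) k = begin
  + suc j / suc k                            ≡⟨ suc-/ j k ⟩
  + 1 / suc k + + j / suc k                  ≡⟨ cong₂ _+_ (sym (ℚₚ.*-identityˡ (+ 1 / suc k))) (/≡ι* j k) ⟩
  1ℚ * (+ 1 / suc k) + ι j * (+ 1 / suc k)   ≡⟨ ℚₚ.*-distribʳ-+ (+ 1 / suc k) 1ℚ (ι j) ⟨
  (1ℚ + ι j) * (+ 1 / suc k)                 ∎
  where open ≡-Reasoning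

ι*/ : ∀ j k → ι (suc k) * (+ j / suc k) ≡ ι j
ι*/ j k = begin
  ι (suc k) * (+ j / suc k)           ≡⟨ cong (ι (suc k) *_) (/≡ι* j k) ⟩
  ι (suc k) * (ι j * (+ 1 / suc k))   ≡⟨ commute (ι (suc k)) (ι j) (+ 1 / suc k) ⟩
  ι j * (ι (suc k) * (+ 1 / suc k))   ≡⟨ cong (ι j *_) (trans (sym (/≡ι* (suc k) k)) (k/k≡1 k)) ⟩
  ι j * 1ℚ                            ≡⟨ ℚₚ.*-identityʳ (ι j) ⟩
  ι j                                 ∎
  where
  open ≡-Reasoning
  open ℚ-Solver.+-*-Solver
  commute : ∀ a b c → a * (b * c) ≡ b * (a * c)
  commute = solve 3 (λ a b c → a :* (b :* c) := b :* (a :* c)) refl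

-- The multiplier is the denominator of `q`; the product is its numerator, a positive integer.
archimedean : ∀ q → 0ℚ <ℚ q → ∃ λ d → 1ℚ ≤ℚ ι (suc d) * q
archimedean q@(mkℚ (+ suc k) d _) 0<q = d , subst (1ℚ ≤ℚ_)
  (sym (trans (cong (ι (suc d) *_) (sym (ℚₚ.↥p/↧p≡p q))) (ι*/ (suc k) d)))
  (subst (_≤ℚ ι (suc k)) (ℚₚ.+-identityʳ 1ℚ) (ι-mono {1} {suc k} (s≤s z≤n)))
archimedean (mkℚ (+ zero) d _) (*<* (ℤ.+<+ ()))
archimedean (mkℚ (ℤ.-[1+ k ]) d _) (*<* ())

seq-∑ : ∀ (G : Graph) {P : Pred (Edge G) 0ℓ} (P? : Decidable P) (val : Edge G → ℕ) x k m (g : Fin m → Edge G) →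
  seq (∑ G (filter P? (tabulate g)) (λ e → fromℚ (ι (val e) * x))) k ≡
  ι (Σᶠ m (λ i → if does (P? (g i)) then val (g i) else 0)) * x
seq-∑ G P? val x k zero    g = sym (ℚₚ.*-zeroˡ x)
seq-∑ G P? val x k (suc m) g with does (P? (g zero))
... | false = seq-∑ G P? val x k m (g ∘ suc)
... | true  = begin
  ι (val (g zero)) * x + _                 ≡⟨ cong (λ z → ι (val (g zero)) * x + z) (seq-∑ G P? val x k m (g ∘ suc)) ⟩
  ι (val (g zero)) * x + ι rest * x        ≡⟨ ℚₚ.*-distribʳ-+ x (ι (val (g zero))) (ι rest) ⟨
  (ι (val (g zero)) + ι rest) * x          ≡⟨ cong (_* x) (ι-+ (val (g zero)) rest) ⟨
  ι (val (g zero) +ℕ rest) * x             ∎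
  where
  open ≡-Reasoning
  rest : ℕ
  rest = Σᶠ m (λ i → if does (P? (g (suc i))) then val (g (suc i)) else 0)

fromℚ-mono : ∀ {p q} → p ≤ℚ q → fromℚ p ≤ᴿ fromℚ q
fromℚ-mono {p} {q} p≤q ε 0<ε = 0 , λ _ _ → ℚₚ.≤-trans p≤q
  (subst (_≤ℚ q + ε) (ℚₚ.+-identityʳ q) (ℚₚ.+-monoʳ-≤ q (ℚₚ.<⇒≤ 0<ε)))

seq-≃ : ∀ (x y : ℝ) → (∀ k → seq x k ≡ seq y k) → x ≃ᴿ y
seq-≃ x y eq ε 0<ε = 0 , λ k _ → subst (λ z → ℚ.∣ z ∣ ≤ℚ ε)
  (sym (trans (cong (_- seq y k) (eq k)) (ℚₚ.+-inverseʳ (seq y k)))) (ℚₚ.<⇒≤ 0<ε)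

-- Scaling the integer circulation by `x` and directing each edge from `end₁` to `end₂` gives a flow
-- of constant sequences; `q - R` is the gap that makes `R` strictly less than `q`.
φ-c-below : ∀ G (let open Graph G) (val : Fin #E → ℕ) →
  (∀ v → Σᶠ #E (λ e → [ end₁ e ≐ v ] (val e)) ≡ Σᶠ #E (λ e → [ end₂ e ≐ v ] (val e))) →
  ∀ x R → ι 2 ≤ℚ R → (∀ e → 1ℚ ≤ℚ ι (val e) * x × ι (val e) * x ≤ℚ R + - 1ℚ) →
  ∀ {q} → R <ℚ q → below (φ-c G) q
φ-c-below G val conserves x R 2≤R bounds {q} R<q =
  (fromℚ R , flow) , q - R , 0<q-R , 0 , λ _ _ → ℚₚ.≤-reflexive (cancel R q)
  where
  open Graph G
  flow : HasNowhereZeroFlow G (fromℚ R)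
  flow = fromℚ-mono 2≤R , (λ _ → true) , (λ e → fromℚ (ι (val e) * x))
    , (λ e → fromℚ-mono (proj₁ (bounds e)) , fromℚ-mono (proj₂ (bounds e)))
    , λ v → seq-≃ (∑ G (E⁺ G (λ _ → true) v) (λ e → fromℚ (ι (val e) * x)))
                  (∑ G (E⁻ G (λ _ → true) v) (λ e → fromℚ (ι (val e) * x))) λ k →
        trans (seq-∑ G (λ e → end₁ e ≟ᶠ v) val x k #E id)
          (trans (cong (λ z → ι z * x) (conserves v)) (sym (seq-∑ G (λ e → end₂ e ≟ᶠ v) val x k #E id)))
  0<q-R : 0ℚ <ℚ q - R
  0<q-R = subst (_<ℚ q - R) (ℚₚ.+-inverseʳ R) (ℚₚ.+-monoˡ-< (- R) R<q)
  cancel : ∀ R q → R + (q - R) ≡ q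
  cancel = solve 2 (λ R q → R :+ (q :- R) := q) refl
    where open ℚ-Solver.+-*-Solver

-- Edge colourings of poles

-- The pairs `p q` and `z w` consist of the same two different colours, as at the two ends of an
-- edge in a 3-edge-colouring. One constructor for each bijection lets unification do the colour
-- chasing.
data Matched {C : Set} : C → C → C → C → Set where
  straight : ∀ {p q} → p ≢ q → Matched p q p q
  cross    : ∀ {p q} → p ≢ q → Matched p q q p

-- The Petersen graph is not 3-edge-colourable; with one spoke opened up and
-- one edge of either 5-cycle cut, this says that the two cuts are again
-- related like the two ends of a spoke.
petersen-matched : ∀ {C : Set} {U₁ U₂ V₁ V₂ U₁′ U₂′ V₁′ V₂′ E₄ E₅ E₆ E₇ : C} →
  Matched U₁ U₂ V₁ V₂ → Matched E₄ V₂′ V₁ U₁′ → Matched V₂ E₇ E₄ E₅ →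
  Matched E₆ E₇ U₁ V₁′ → Matched E₅ U₂ E₆ U₂′ → Matched U₁′ U₂′ V₁′ V₂′
-- Of the 32 patterns all but three identify two colours that have to differ; in those three the new
-- cuts are matched.
petersen-matched (straight p0) (straight _) (straight _) (straight _) (straight _) = contradiction refl p0
petersen-matched (straight p0) (straight _) (straight _) (straight _) (cross _) = contradiction refl p0
petersen-matched (straight p0) (straight _) (straight _) (cross _) (straight _) = contradiction refl p0
petersen-matched (straight p0) (straight _) (straight _) (cross _) (cross _) = contradiction refl p0
petersen-matched (straight p0) (straight _) (cross _) (straight _) (straight _) = contradiction refl p0
petersen-matched (straight p0) (straight _) (cross _) (straight _) (cross _) = contradiction refl p0
petersen-matched (straight _) (straight _) (cross _) (cross _) (straight p4) = contradiction refl p4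
petersen-matched (straight _) (straight _) (cross _) (cross _) (cross p4) = contradiction refl p4
petersen-matched (straight _) (cross _) (straight _) (straight p3) (straight _) = contradiction refl p3
petersen-matched (straight p0) (cross _) (straight _) (straight _) (cross _) = contradiction refl p0
petersen-matched (straight _) (cross _) (straight _) (cross p3) (straight _) = contradiction refl p3
petersen-matched (straight _) (cross _) (straight _) (cross p3) (cross _) = straight p3
petersen-matched (straight p0) (cross _) (cross _) (straight _) (straight _) = contradiction refl p0
petersen-matched (straight p0) (cross _) (cross _) (straight _) (cross _) = contradiction refl p0
petersen-matched (straight _) (cross p1) (cross _) (cross _) (straight _) = contradiction refl p1
petersen-matched (straight _) (cross p1) (cross _) (cross _) (cross _) = contradiction refl p1
petersen-matched (cross p0) (straight _) (straight _) (straight _) (straight _) = contradiction refl p0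
petersen-matched (cross p0) (straight _) (straight _) (straight _) (cross _) = contradiction refl p0
petersen-matched (cross p0) (straight _) (straight _) (cross _) (straight _) = contradiction refl p0
petersen-matched (cross p0) (straight _) (straight _) (cross _) (cross _) = contradiction refl p0
petersen-matched (cross _) (straight p1) (cross _) (straight _) (straight _) = cross (p1 ∘ sym)
petersen-matched (cross p0) (straight _) (cross _) (straight _) (cross _) = contradiction refl p0
petersen-matched (cross p0) (straight _) (cross _) (cross _) (straight _) = contradiction refl p0
petersen-matched (cross p0) (straight _) (cross _) (cross _) (cross _) = contradiction refl p0
petersen-matched (cross _) (cross _) (straight p2) (straight _) (straight _) = contradiction refl p2
petersen-matched (cross p0) (cross _) (straight _) (straight _) (cross _) = contradiction refl p0
petersen-matched (cross _) (cross _) (straight p2) (cross _) (straight _) = contradiction refl p2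
petersen-matched (cross _) (cross _) (straight p2) (cross _) (cross _) = contradiction refl p2
petersen-matched (cross _) (cross p1) (cross _) (straight _) (straight _) = straight p1
petersen-matched (cross p0) (cross _) (cross _) (straight _) (cross _) = contradiction refl p0
petersen-matched (cross _) (cross _) (cross p2) (cross _) (straight _) = contradiction refl p2
petersen-matched (cross _) (cross _) (cross p2) (cross _) (cross _) = contradiction refl p2

matched : ∀ {C : Set} {p q z w : C} → p ≢ q → z ≢ w →
  z ≡ p ⊎ z ≡ q → w ≡ p ⊎ w ≡ q → Matched p q z w
matched p≢q z≢w (inj₁ refl) (inj₁ refl) = contradiction refl z≢w
matched p≢q z≢w (inj₁ refl) (inj₂ refl) = straight p≢q
matched p≢q z≢w (inj₂ refl) (inj₁ refl) = cross p≢q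
matched p≢q z≢w (inj₂ refl) (inj₂ refl) = contradiction refl z≢w

module Colourings {n s : ℕ} (P : Pole n s) where
  open Pole P

  -- Indices 0-3 are the dangling lines at `u₁`, `u₂`, `v₁`, `v₂`; edge `e` has index `4 ↑ʳ e`.
  Inc : Fin (4 +ℕ #E) → Fin #V → Set
  Inc 0F                            v = u₁ ≡ v
  Inc 1F                            v = u₂ ≡ v
  Inc 2F                            v = v₁ ≡ v
  Inc 3F                            v = v₂ ≡ v
  Inc (suc (suc (suc (suc e))))     v = tl e ≡ v ⊎ hd e ≡ v

  Proper : ∀ {C : Set} → (Fin (4 +ℕ #E) → C) → Set
  Proper c = ∀ e f v → e ≢ f → Inc e v → Inc f v → c e ≢ c f

  -- What the two applications have in common: it holds at every edge of a proper 3-edge-colouring,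
  -- and at a thickened edge of a `(2r + 3)`-edge-colouring restricted to the cubic graph.
  MatchedAt : ∀ {C : Set} → (Fin (4 +ℕ #E) → C) → Fin (4 +ℕ #E) → Set
  MatchedAt c e = ∀ v w x y z → v ≢ w → Inc e v → Inc e w →
    x ≢ e → y ≢ e → z ≢ e → x ≢ y → Inc x v → Inc y v → Inc z w → c z ≡ c x ⊎ c z ≡ c y

  at-edge : ∀ {C : Set} {c : Fin (4 +ℕ #E) → C} → Proper c → ∀ {e} → MatchedAt c e →
    ∀ v w x y z t → v ≢ w → Inc e v → Inc e w →
    x ≢ e → y ≢ e → z ≢ e → t ≢ e → x ≢ y → z ≢ t →
    Inc x v → Inc y v → Inc z w → Inc t w → Matched (c x) (c y) (c z) (c t)
  at-edge pr m v w x y z t v≢w ev ew x≢e y≢e z≢e t≢e x≢y z≢t xv yv zw tw =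
    matched (pr x y v x≢y xv yv) (pr z t w z≢t zw tw)
      (m v w x y z v≢w ev ew x≢e y≢e z≢e x≢y xv yv zw)
      (m v w x y t v≢w ev ew x≢e y≢e t≢e x≢y xv yv tw)

  -- `sp` selects the edges assumed to be matched: the thickened ones for class 2, all of them for
  -- class 1.
  Transmits : {I : Set} → (I → Fin #E) → Set₁
  Transmits {I} sp = ∀ {C : Set} (c : Fin (4 +ℕ #E) → C) → Proper c →
    (∀ i → MatchedAt c (4 ↑ʳ sp i)) → Matched (c 0F) (c 1F) (c 2F) (c 3F)

open Colourings

spoke-transmits : ∀ n → Transmits (spokePole n) {Fin 1} (λ _ → 0F)
spoke-transmits n c pr m = at-edge (spokePole n) {c = c} pr (m 0F) 0F 1F 0F 1F 2F 3F (λ ()) (inj₂ refl) (inj₁ refl)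
  (λ ()) (λ ()) (λ ()) (λ ()) (λ ()) (λ ()) refl refl refl refl

-- Each leg is forced to have the colour of the opposite side of the triangle, so the two `u`-lines
-- have the colours of the two sides at vertex 0, and edge 0 passes these on to the `v`-lines.
triangle-transmits : ∀ n → Transmits (trianglePole n) {Fin 4} id
triangle-transmits n c pr m = go
  (at-edge T {c = c} pr (m 3F) 0F 1F 5F 4F 6F 0F (λ ()) (inj₁ refl) (inj₂ refl)
    (λ ()) (λ ()) (λ ()) (λ ()) (λ ()) (λ ()) (inj₂ refl) (inj₂ refl) (inj₂ refl) refl)
  (at-edge T {c = c} pr (m 1F) 0F 2F 7F 4F 6F 1F (λ ()) (inj₂ refl) (inj₁ refl)
    (λ ()) (λ ()) (λ ()) (λ ()) (λ ()) (λ ()) (inj₁ refl) (inj₂ refl) (inj₁ refl) refl)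
  (at-edge T {c = c} pr (m 0F) 0F 3F 5F 7F 2F 3F (λ ()) (inj₂ refl) (inj₁ refl)
    (λ ()) (λ ()) (λ ()) (λ ()) (λ ()) (λ ()) (inj₂ refl) (inj₁ refl) refl refl)
  (pr 5F 6F 2F (λ ()) (inj₁ refl) (inj₁ refl))
  (pr 7F 6F 1F (λ ()) (inj₂ refl) (inj₂ refl))
  where
  T : Pole n n
  T = trianglePole n
  go : ∀ {C : Set} {a b k S U₁ U₂ V₁ V₂ : C} → Matched b S k U₁ → Matched a S k U₂ → Matched b a V₁ V₂ →
    b ≢ k → a ≢ k → Matched U₁ U₂ V₁ V₂
  go (straight _) _            _ b≢k a≢k = contradiction refl b≢k
  go (cross _)    (straight _) _ b≢k a≢k = contradiction refl a≢k
  go (cross _)    (cross _)    r b≢k a≢k = r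

module _ {n s : ℕ} (P : Pole n (suc s)) where
  open Pole P

  -- The dangling lines of `P` are edges 0-3 of `step P` and hence have indices 4-7, after the new
  -- dangling lines.
  inherit : Fin (4 +ℕ #E) → Fin (16 +ℕ #E)
  inherit = (4F ∷ 5F ∷ 6F ∷ 7F ∷ []) ▹ (16 ↑ʳ_)

  private
    -- A left inverse of `inherit`, from which injectivity follows; `0F` is a default value outside
    -- the image.
    retract : Fin (16 +ℕ #E) → Fin (4 +ℕ #E)
    retract = (0F ∷ 0F ∷ 0F ∷ 0F ∷ 0F ∷ 1F ∷ 2F ∷ 3F ∷ 0F ∷ 0F ∷ 0F ∷ 0F ∷ 0F ∷ 0F ∷ 0F ∷ 0F ∷ []) ▹ (4 ↑ʳ_)

    retract-inherit : ∀ e → retract (inherit e) ≡ e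
    retract-inherit 0F = refl
    retract-inherit 1F = refl
    retract-inherit 2F = refl
    retract-inherit 3F = refl
    retract-inherit (suc (suc (suc (suc e)))) = refl

    inherit-≢ : ∀ {e f} → e ≢ f → inherit e ≢ inherit f
    inherit-≢ {e} {f} e≢f eq =
      e≢f (trans (sym (retract-inherit e)) (trans (cong retract eq) (retract-inherit f)))

    inherit-Inc : ∀ e v → Inc P e v → Inc (step P) (inherit e) (8 ↑ʳ v)
    inherit-Inc 0F v p = inj₂ (cong (8 ↑ʳ_) p)
    inherit-Inc 1F v p = inj₁ (cong (8 ↑ʳ_) p)
    inherit-Inc 2F v p = inj₁ (cong (8 ↑ʳ_) p)
    inherit-Inc 3F v p = inj₂ (cong (8 ↑ʳ_) p)
    inherit-Inc (suc (suc (suc (suc e)))) v (inj₁ p) = inj₂ (cong (8 ↑ʳ_) p)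
    inherit-Inc (suc (suc (suc (suc e)))) v (inj₂ p) = inj₁ (cong (8 ↑ʳ_) p)

    old-≢ : ∀ {v w : Fin #V} → v ≢ w → 8 ↑ʳ v ≢ 8 ↑ʳ w
    old-≢ v≢w refl = v≢w refl

  -- The restriction of the colouring to `P` gives the first relation by hypothesis, the four new
  -- spokes give the others, and `petersen-matched` combines the five.
  step-transmits : ∀ {I I′ : Set} (sp : I → Fin #E) (sp′ : I′ → Fin (12 +ℕ #E)) → Transmits P sp →
    (∀ (k : Fin 4) → ∃ λ i → sp′ i ≡ 8 ↑ʳ (k ↑ˡ #E)) → (∀ i → ∃ λ i′ → sp′ i′ ≡ 12 ↑ʳ sp i) →
    Transmits (step P) sp′
  step-transmits sp sp′ tr new old c pr m = petersen-matched
    (tr (c ∘ inherit)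
      (λ e f v e≢f ev fv → pr _ _ _ (inherit-≢ e≢f) (inherit-Inc e v ev) (inherit-Inc f v fv))
      (λ i v w x y z v≢w ev ew x≢e y≢e z≢e x≢y xv yv zw →
        atSpoke (proj₁ (old i)) _ (proj₂ (old i)) (8 ↑ʳ v) (8 ↑ʳ w) (inherit x) (inherit y) (inherit z)
          (old-≢ v≢w) (inherit-Inc _ v ev) (inherit-Inc _ w ew)
          (inherit-≢ {x} x≢e) (inherit-≢ {y} y≢e) (inherit-≢ {z} z≢e) (inherit-≢ {x} {y} x≢y)
          (inherit-Inc x v xv) (inherit-Inc y v yv) (inherit-Inc z w zw)))
    -- `spoke 0F` to `spoke 3F` are edges 8-11, that is, spokes 1, 4, 3, 0 of the Petersen graph.
    (rel (spoke 0F) 4F 0F 8F 3F 6F 0F (λ ()) (inj₁ refl) (inj₂ refl)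
      (λ ()) (λ ()) (λ ()) (λ ()) (λ ()) (λ ()) (inj₂ refl) refl (inj₂ refl) refl)
    (rel (spoke 2F) 1F 5F 7F (suc (suc 9F)) 8F 9F (λ ()) (inj₁ refl) (inj₂ refl)
      (λ ()) (λ ()) (λ ()) (λ ()) (λ ()) (λ ()) (inj₁ refl) (inj₂ refl) (inj₁ refl) (inj₂ refl))
    (rel (spoke 1F) 2F 7F (suc 9F) (suc (suc 9F)) 4F 2F (λ ()) (inj₁ refl) (inj₂ refl)
      (λ ()) (λ ()) (λ ()) (λ ()) (λ ()) (λ ()) (inj₂ refl) (inj₁ refl) (inj₁ refl) refl)
    (rel (spoke 3F) 6F 3F 9F 5F (suc 9F) 1F (λ ()) (inj₁ refl) (inj₂ refl)
      (λ ()) (λ ()) (λ ()) (λ ()) (λ ()) (λ ()) (inj₁ refl) (inj₂ refl) (inj₁ refl) refl)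
    where
    atSpoke : ∀ i e → sp′ i ≡ e → MatchedAt (step P) c (4 ↑ʳ e)
    atSpoke i e eq = subst (λ e → MatchedAt (step P) c (4 ↑ʳ e)) eq (m i)
    spoke : ∀ (k : Fin 4) → MatchedAt (step P) c (12 ↑ʳ (k ↑ˡ #E))
    spoke k = atSpoke (proj₁ (new k)) _ (proj₂ (new k))
    rel : ∀ {e} → MatchedAt (step P) c e → ∀ v w x y z t → _
    rel {e} = at-edge (step P) {c = c} pr {e}

-- Edge colourings of closed poles

module Closed {n : ℕ} (P : Pole n 0) (apart : Apart P) (T : Thickening P) (r : ℕ) where
  open Pole P
  open Thickening T
  open Closing P apart T r public

  Inc° : Fin (2 +ℕ #E) → Fin #V → Set
  Inc° e v = tl° e ≡ v ⊎ hd° e ≡ v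

  Proper° : ∀ {C : Set} → (Fin (2 +ℕ #E) → C) → Set
  Proper° c = ∀ e f v → e ≢ f → Inc° e v → Inc° f v → c e ≢ c f

  MatchedAt° : ∀ {C : Set} → (Fin (2 +ℕ #E) → C) → Fin (2 +ℕ #E) → Set
  MatchedAt° c e = ∀ v w x y z → v ≢ w → Inc° e v → Inc° e w →
    x ≢ e → y ≢ e → z ≢ e → x ≢ y → Inc° x v → Inc° y v → Inc° z w → c z ≡ c x ⊎ c z ≡ c y

  glue : Fin (4 +ℕ #E) → Fin (2 +ℕ #E)
  glue = (0F ∷ 0F ∷ 1F ∷ 1F ∷ []) ▹ (2 ↑ʳ_)

  glue-Inc : ∀ e v → Inc P e v → Inc° (glue e) v
  glue-Inc 0F v p = inj₁ p
  glue-Inc 1F v p = inj₂ p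
  glue-Inc 2F v p = inj₂ p
  glue-Inc 3F v p = inj₁ p
  glue-Inc (suc (suc (suc (suc e)))) v p = p

  -- `glue` is not injective, but by `apart` the two halves of a joined line never meet at a vertex.
  glue-≢ : ∀ e f v → e ≢ f → Inc P e v → Inc P f v → glue e ≢ glue f
  glue-≢ 0F 0F v e≢f p q _ = e≢f refl
  glue-≢ 0F 1F v e≢f p q _ = proj₁ apart (trans p (sym q))
  glue-≢ 0F 2F v e≢f p q ()
  glue-≢ 0F 3F v e≢f p q ()
  glue-≢ 0F (suc (suc (suc (suc f)))) v e≢f p q ()
  glue-≢ 1F 0F v e≢f p q _ = proj₁ apart (trans q (sym p))
  glue-≢ 1F 1F v e≢f p q _ = e≢f refl
  glue-≢ 1F 2F v e≢f p q ()
  glue-≢ 1F 3F v e≢f p q ()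
  glue-≢ 1F (suc (suc (suc (suc f)))) v e≢f p q ()
  glue-≢ 2F 2F v e≢f p q _ = e≢f refl
  glue-≢ 2F 3F v e≢f p q _ = proj₂ apart (trans p (sym q))
  glue-≢ 3F 2F v e≢f p q _ = proj₂ apart (trans q (sym p))
  glue-≢ 3F 3F v e≢f p q _ = e≢f refl
  glue-≢ (suc (suc (suc (suc e)))) (suc (suc (suc (suc f)))) v e≢f p q refl = e≢f refl

  glue-edge : ∀ x e → x ≢ 4 ↑ʳ e → glue x ≢ 2 ↑ʳ e
  glue-edge (suc (suc (suc (suc x)))) e x≢e refl = x≢e refl

  -- Joining gives the lines at `u₁` and `u₂` the same colour, whereas the first two colours of
  -- `Matched` differ.
  closed-unmatched : ∀ {I : Set} {sp : I → Fin #E} → Transmits P sp →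
    ∀ {C : Set} (c : Fin (2 +ℕ #E) → C) → Proper° c → ¬ (∀ i → MatchedAt° c (2 ↑ʳ sp i))
  closed-unmatched {sp = sp} tr c pr m = same (tr (c ∘ glue)
    (λ e f v e≢f ev fv → pr _ _ v (glue-≢ e f v e≢f ev fv) (glue-Inc e v ev) (glue-Inc f v fv))
    (λ i v w x y z v≢w ev ew x≢e y≢e z≢e x≢y xv yv zw →
      m i v w (glue x) (glue y) (glue z) v≢w ev ew
        (glue-edge x _ x≢e) (glue-edge y _ y≢e) (glue-edge z _ z≢e) (glue-≢ x y v x≢y xv yv)
        (glue-Inc x v xv) (glue-Inc y v yv) (glue-Inc z w zw)))
    where
    same : ∀ {C : Set} {p q q′ : C} → Matched p p q q′ → ⊥
    same (straight p≢p) = p≢p refl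
    same (cross p≢p)    = p≢p refl

  Inc^ : Ê → Fin #V → Set
  Inc^ e v = tl^ e ≡ v ⊎ hd^ e ≡ v

  encode-Incident : ∀ e v → Inc^ e v → Incident graph (encode e) v
  encode-Incident e v = subst (λ e → Inc^ e v) (sym (decode-encode e))

  encode-≢ : ∀ {e f} → e ≢ f → encode e ≢ encode f
  encode-≢ {e} {f} e≢f eq = e≢f (trans (sym (decode-encode e)) (trans (cong decode eq) (decode-encode f)))

  copy : Fin #X → Fin (1 +ℕ (r +ℕ r)) → Ê
  copy x zero    = inj₁ (2 ↑ʳ edge x)
  copy x (suc j) = inj₂ (x , splitAt r j)

  copy-Inc : ∀ x j v → Inc° (2 ↑ʳ edge x) v → Inc^ (copy x j) v
  copy-Inc x zero    v p = p
  copy-Inc x (suc j) v p with splitAt r j | ends x | p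
  ... | inj₁ _ | inj₁ (p₁ , p₂) | inj₁ q = inj₁ (trans p₁ q)
  ... | inj₁ _ | inj₁ (p₁ , p₂) | inj₂ q = inj₂ (trans p₂ q)
  ... | inj₁ _ | inj₂ (p₁ , p₂) | inj₁ q = inj₂ (trans p₂ q)
  ... | inj₁ _ | inj₂ (p₁ , p₂) | inj₂ q = inj₁ (trans p₁ q)
  ... | inj₂ _ | inj₁ (p₁ , p₂) | inj₁ q = inj₂ (trans p₁ q)
  ... | inj₂ _ | inj₁ (p₁ , p₂) | inj₂ q = inj₁ (trans p₂ q)
  ... | inj₂ _ | inj₂ (p₁ , p₂) | inj₁ q = inj₁ (trans p₂ q)
  ... | inj₂ _ | inj₂ (p₁ , p₂) | inj₂ q = inj₂ (trans p₁ q)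

  copy-≢ : ∀ x {i j} → i ≢ j → copy x i ≢ copy x j
  copy-≢ x {zero}  {zero}  i≢j _  = i≢j refl
  copy-≢ x {suc i} {suc j} i≢j eq = i≢j (cong suc (begin
    i                           ≡⟨ join-splitAt r r i ⟨
    join r r (splitAt r i)      ≡⟨ cong (join r r) (cong proj₂ (inj₂-injective eq)) ⟩
    join r r (splitAt r j)      ≡⟨ join-splitAt r r j ⟩
    j                           ∎))
    where open ≡-Reasoning

  other-≢-copy : ∀ x {e} j → e ≢ 2 ↑ʳ edge x → inj₁ e ≢ copy x j
  other-≢-copy x zero e≢ refl = e≢ refl

  -- Of the 2r + 3 colours, 2r + 1 are used on the parallel copies.
  restriction-matched : (c : EdgeColorable graph (2 *ℕ r +ℕ 3)) → ∀ x →
    MatchedAt° (λ e → proj₁ c (encode (inj₁ e))) (2 ↑ʳ edge x)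
  restriction-matched (c , proper) e v w x y z v≢w ev ew x≢e y≢e z≢e x≢y xv yv zw
    with c (encode (inj₁ z)) ≟ᶠ c (encode (inj₁ x)) | c (encode (inj₁ z)) ≟ᶠ c (encode (inj₁ y))
  ... | yes z≡x | _       = inj₁ z≡x
  ... | _       | yes z≡y = inj₂ z≡y
  -- If `z` differed from both, then `x`, `y`, `z` and the `2r + 1` parallel edges would have
  -- `2r + 4` different colours.
  ... | no  z≢x | no  z≢y = contradiction same (distinct _ _ (ℕₚ.<⇒≢ i<j ∘ cong toℕ))
    where
    items : Fin (3 +ℕ (1 +ℕ (r +ℕ r))) → Ê
    items = (inj₁ x ∷ inj₁ y ∷ inj₁ z ∷ []) ▹ copy e
    col : Ê → Fin (2 *ℕ r +ℕ 3)
    col = c ∘ encode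
    diff : ∀ f g u → f ≢ g → Inc^ f u → Inc^ g u → col f ≢ col g
    diff f g u f≢g fu gu = proper (encode f) (encode g)
      (encode-≢ f≢g , u , encode-Incident f u fu , encode-Incident g u gu)
    distinct : ∀ i j → i ≢ j → col (items i) ≢ col (items j)
    distinct 0F 0F i≢j = contradiction refl i≢j
    distinct 0F 1F i≢j = diff _ _ v (x≢y ∘ inj₁-injective) xv yv
    distinct 0F 2F i≢j = z≢x ∘ sym
    distinct 0F (suc (suc (suc j))) i≢j = diff _ _ v (other-≢-copy e j x≢e) xv (copy-Inc e j v ev)
    distinct 1F 0F i≢j = diff _ _ v (x≢y ∘ sym ∘ inj₁-injective) yv xv
    distinct 1F 1F i≢j = contradiction refl i≢j
    distinct 1F 2F i≢j = z≢y ∘ sym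
    distinct 1F (suc (suc (suc j))) i≢j = diff _ _ v (other-≢-copy e j y≢e) yv (copy-Inc e j v ev)
    distinct 2F 0F i≢j = z≢x
    distinct 2F 1F i≢j = z≢y
    distinct 2F 2F i≢j = contradiction refl i≢j
    distinct 2F (suc (suc (suc j))) i≢j = diff _ _ w (other-≢-copy e j z≢e) zw (copy-Inc e j w ew)
    distinct (suc (suc (suc i))) 0F i≢j = diff _ _ v (other-≢-copy e i x≢e ∘ sym) (copy-Inc e i v ev) xv
    distinct (suc (suc (suc i))) 1F i≢j = diff _ _ v (other-≢-copy e i y≢e ∘ sym) (copy-Inc e i v ev) yv
    distinct (suc (suc (suc i))) 2F i≢j = diff _ _ w (other-≢-copy e i z≢e ∘ sym) (copy-Inc e i w ew) zw
    distinct (suc (suc (suc i))) (suc (suc (suc j))) i≢j =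
      diff _ _ v (copy-≢ e (i≢j ∘ cong (3 ↑ʳ_))) (copy-Inc e i v ev) (copy-Inc e j v ev)
    few : 2 *ℕ r +ℕ 3 < 3 +ℕ (1 +ℕ (r +ℕ r))
    few = ℕₚ.≤-reflexive (lemma r)
      where
      open +-*-Solver
      lemma : ∀ r → 1 +ℕ (2 *ℕ r +ℕ 3) ≡ 3 +ℕ (1 +ℕ (r +ℕ r))
      lemma = solve 1 (λ r → con 1 :+ (con 2 :* r :+ con 3) := con 3 :+ (con 1 :+ (r :+ r))) refl
    clash : ∃ λ i → ∃ λ j → i Fin.< j × col (items i) ≡ col (items j)
    clash = pigeonhole few (col ∘ items)
    i<j : toℕ (proj₁ clash) < toℕ (proj₁ (proj₂ clash))
    i<j = proj₁ (proj₂ (proj₂ clash))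
    same : col (items (proj₁ clash)) ≡ col (items (proj₁ (proj₂ clash)))
    same = proj₂ (proj₂ (proj₂ clash))

  restriction-proper : (c : EdgeColorable graph (2 *ℕ r +ℕ 3)) →
    Proper° (λ e → proj₁ c (encode (inj₁ e)))
  restriction-proper (c , proper) e f v e≢f ev fv = proper (encode (inj₁ e)) (encode (inj₁ f))
    (encode-≢ (e≢f ∘ inj₁-injective) , v , encode-Incident (inj₁ e) v ev , encode-Incident (inj₁ f) v fv)

  not-colourable : Transmits P edge → ¬ EdgeColorable graph (2 *ℕ r +ℕ 3)
  not-colourable tr c =
    closed-unmatched tr (λ e → proj₁ c (encode (inj₁ e))) (restriction-proper c) (restriction-matched c)

-- Class 1 colourings from five colours

meets : ∀ {m} → Fin m → Fin m → Fin m → Fin 5 → Fin 5 → ℕ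
meets y z v p k = ([ y ≐ v ] 1 +ℕ [ z ≐ v ] 1) *ℕ [ p ≐ k ] 1

meets≥1 : ∀ {m} (y z v : Fin m) {p k} → y ≡ v ⊎ z ≡ v → p ≡ k → 1 ≤ meets y z v p k
meets≥1 y z v {p} (inj₁ refl) refl rewrite ≐-refl y 1 | ≐-refl p 1 = s≤s z≤n
meets≥1 y z v {p} (inj₂ refl) refl rewrite ≐-refl z 1 | ≐-refl p 1 =
  ℕₚ.≤-trans (ℕₚ.m≤n+m 1 ([ y ≐ z ] 1)) (ℕₚ.≤-reflexive (sym (ℕₚ.*-identityʳ _)))

meets-comm : ∀ {m} (y z v : Fin m) p k → meets y z v p k ≡ meets z y v p k
meets-comm y z v p k = cong (_*ℕ [ p ≐ k ] 1) (ℕₚ.+-comm ([ y ≐ v ] 1) ([ z ≐ v ] 1))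

-- Each thickened edge is present three times; extra colours two of the copies.
record Painting {n s} {P : Pole n s} (T : Thickening P) : Set where
  open Pole P
  open Thickening T
  field
    -- Colours 1 and 0 are reserved for the dangling lines at the `u`'s and at the `v`'s. Properness
    -- is expressed by counting: each vertex sees each of the five colours exactly once.
    paint : Fin #E → Fin 5
    extra : Fin #X → Fin 2 → Fin 5
    once  : ∀ v k →
      meets u₁ u₂ v 1F k +ℕ (meets v₂ v₁ v 0F k +ℕ Σᶠ #E (λ e → meets (tl e) (hd e) v (paint e) k))
        +ℕ Σᶠ #X (λ x → Σᶠ 2 (λ i → meets (a x) (b x) v (extra x i) k)) ≡ 1

-- With three colours the legs of the triangle would have pairwise different colours; here all three
-- thick legs use colours 1 and 4, so the triangle does not act as a vertex. The counts are checked
-- by evaluation.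
trianglePainting : ∀ n → Painting (triangleThickening n)
trianglePainting n = record
  { paint = paint ; extra = extra
  ; once = λ v k → toWitness {a? = all? λ v → all? λ k → total v k ℕₚ.≟ 1} tt v k }
  where
  open Pole (step (trianglePole (suc n)))
  open Thickening (triangleThickening n)
  paint : Fin 16 → Fin 5
  paint = (4F ∷ 4F ∷ 0F ∷ 2F ∷ 1F ∷ 2F ∷ 4F ∷ 1F ∷ 4F ∷ 3F ∷ 4F ∷ 3F ∷ 4F ∷ 2F ∷ 3F ∷ 0F ∷ []) ▹ λ ()
  extra : Fin 6 → Fin 2 → Fin 5
  extra = (  ((1F ∷ 3F ∷ []) ▹ λ ()) ∷ ((1F ∷ 2F ∷ []) ▹ λ ()) ∷ ((0F ∷ 1F ∷ []) ▹ λ ())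
           ∷ ((0F ∷ 2F ∷ []) ▹ λ ()) ∷ ((2F ∷ 3F ∷ []) ▹ λ ()) ∷ ((0F ∷ 3F ∷ []) ▹ λ ()) ∷ []) ▹ λ ()
  total : Fin 12 → Fin 5 → ℕ
  total v k = meets u₁ u₂ v 1F k +ℕ (meets v₂ v₁ v 0F k +ℕ Σᶠ 16 (λ e → meets (tl e) (hd e) v (paint e) k))
        +ℕ Σᶠ 6 (λ x → Σᶠ 2 (λ i → meets (a x) (b x) v (extra x i) k))

-- The new spokes take colours 2, 3 and 4, and colours 0 and 1 alternate along the remaining paths
-- of the two 5-cycles, in agreement with the reserved colours of old and new dangling lines.
stepPainting : ∀ {n s} {P : Pole n (suc s)} {T : Thickening P} → Painting T → Painting (stepThickening T)
stepPainting {n} {s} {P} {T} p = record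
  { paint = (1F ∷ 1F ∷ 0F ∷ 0F ∷ 1F ∷ 0F ∷ 0F ∷ 1F ∷ 4F ∷ 4F ∷ 4F ∷ 4F ∷ []) ▹ paint
  ; extra = (new ∷ new ∷ new ∷ new ∷ []) ▹ extra
  ; once = once′ }
  where
  open Pole P
  open Thickening T
  open Painting p
  new : Fin 2 → Fin 5
  new = (2F ∷ 3F ∷ []) ▹ λ ()
  once′ : ∀ v k → _
  once′ 0F rewrite Σᶠ-zero #E | Σᶠ-zero #X = λ { 0F → refl ; 1F → refl ; 2F → refl ; 3F → refl ; 4F → refl }
  once′ 1F rewrite Σᶠ-zero #E | Σᶠ-zero #X = λ { 0F → refl ; 1F → refl ; 2F → refl ; 3F → refl ; 4F → refl }
  once′ 2F rewrite Σᶠ-zero #E | Σᶠ-zero #X = λ { 0F → refl ; 1F → refl ; 2F → refl ; 3F → refl ; 4F → refl }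
  once′ 3F rewrite Σᶠ-zero #E | Σᶠ-zero #X = λ { 0F → refl ; 1F → refl ; 2F → refl ; 3F → refl ; 4F → refl }
  once′ 4F rewrite Σᶠ-zero #E | Σᶠ-zero #X = λ { 0F → refl ; 1F → refl ; 2F → refl ; 3F → refl ; 4F → refl }
  once′ 5F rewrite Σᶠ-zero #E | Σᶠ-zero #X = λ { 0F → refl ; 1F → refl ; 2F → refl ; 3F → refl ; 4F → refl }
  once′ 6F rewrite Σᶠ-zero #E | Σᶠ-zero #X = λ { 0F → refl ; 1F → refl ; 2F → refl ; 3F → refl ; 4F → refl }
  once′ 7F rewrite Σᶠ-zero #E | Σᶠ-zero #X = λ { 0F → refl ; 1F → refl ; 2F → refl ; 3F → refl ; 4F → refl }
  once′ (suc (suc (suc (suc (suc (suc (suc (suc v)))))))) k = trans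
    (cong₂ (λ S X → (0 +ℕ U₁) *ℕ D₁ +ℕ ((U₂ +ℕ 0) *ℕ D₁ +ℕ ((V₁ +ℕ 0) *ℕ D₀ +ℕ ((0 +ℕ V₂) *ℕ D₀ +ℕ S))) +ℕ X)
      (Σᶠ-cong #E λ e → meets-comm (hd e) (tl e) v (paint e) k)
      (Σᶠ-cong #X λ x → Σᶠ-cong 2 λ i → meets-comm (b x) (a x) v (extra x i) k))
    (trans (rearrange U₁ U₂ V₁ V₂ D₁ D₀ _ _) (once v k))
    where
    U₁ U₂ V₁ V₂ D₁ D₀ : ℕ
    U₁ = [ u₁ ≐ v ] 1
    U₂ = [ u₂ ≐ v ] 1
    V₁ = [ v₁ ≐ v ] 1
    V₂ = [ v₂ ≐ v ] 1
    D₁ = [ 1F ≐ k ] 1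
    D₀ = [ 0F ≐ k ] 1
    open +-*-Solver
    rearrange : ∀ U₁ U₂ V₁ V₂ D₁ D₀ S X →
      (0 +ℕ U₁) *ℕ D₁ +ℕ ((U₂ +ℕ 0) *ℕ D₁ +ℕ ((V₁ +ℕ 0) *ℕ D₀ +ℕ ((0 +ℕ V₂) *ℕ D₀ +ℕ S))) +ℕ X ≡
      (U₁ +ℕ U₂) *ℕ D₁ +ℕ ((V₂ +ℕ V₁) *ℕ D₀ +ℕ S) +ℕ X
    rearrange = solve 8 (λ U₁ U₂ V₁ V₂ D₁ D₀ S X →
      (con 0 :+ U₁) :* D₁ :+ ((U₂ :+ con 0) :* D₁ :+ ((V₁ :+ con 0) :* D₀ :+ ((con 0 :+ V₂) :* D₀ :+ S))) :+ X
      := (U₁ :+ U₂) :* D₁ :+ ((V₂ :+ V₁) :* D₀ :+ S) :+ X) refl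

module Painted {n : ℕ} (P : Pole n 0) (apart : Apart P) (T : Thickening P) (p : Painting T) (r : ℕ) where
  open Pole P
  open Thickening T
  open Painting p
  open Closed P apart T (suc r)

  paint° : Fin (2 +ℕ #E) → Fin 5
  paint° = (1F ∷ 0F ∷ []) ▹ paint

  #C : ℕ
  #C = 5 +ℕ (r +ℕ r)

  -- One copy in either direction is coloured by `extra`. The other `2r` copies take fresh colours,
  -- the same for every thickened edge, as these form a matching.
  colour : Ê → Fin #C
  colour (inj₁ e)                = paint° e ↑ˡ (r +ℕ r)
  colour (inj₂ (x , inj₁ zero))    = extra x 0F ↑ˡ (r +ℕ r)
  colour (inj₂ (x , inj₁ (suc j))) = 5 ↑ʳ (j ↑ˡ r)
  colour (inj₂ (x , inj₂ zero))    = extra x 1F ↑ˡ (r +ℕ r)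
  colour (inj₂ (x , inj₂ (suc j))) = 5 ↑ʳ (r ↑ʳ j)

  -- A view that merges the two directions of copies, reducing the comparison of two edges to nine
  -- cases.
  data Kind : Ê → Set where
    base  : ∀ e → Kind (inj₁ e)
    first : ∀ x i e → colour e ≡ extra x i ↑ˡ (r +ℕ r) → (∀ v → Inc^ e v → a x ≡ v ⊎ b x ≡ v) →
            (e ≡ inj₂ (x , ((inj₁ zero ∷ inj₂ zero ∷ []) ▹ λ ()) i)) → Kind e
    later : ∀ x j e → colour e ≡ 5 ↑ʳ j → (∀ v → Inc^ e v → a x ≡ v ⊎ b x ≡ v) →
            e ≡ inj₂ (x , Data.Sum.map suc suc (splitAt r j)) → Kind e

  kind : ∀ e → Kind e
  kind (inj₁ e) = base e
  kind (inj₂ (x , inj₁ zero)) = first x 0F _ refl (λ v → id) refl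
  kind (inj₂ (x , inj₂ zero)) = first x 1F _ refl (λ v → swap) refl
  kind (inj₂ (x , inj₁ (suc j))) = later x (j ↑ˡ r) _ refl (λ v → id)
    (cong (λ z → inj₂ (x , Data.Sum.map suc suc z)) (sym (splitAt-↑ˡ r j r)))
  kind (inj₂ (x , inj₂ (suc j))) = later x (r ↑ʳ j) _ refl (λ v → swap)
    (cong (λ z → inj₂ (x , Data.Sum.map suc suc z)) (sym (splitAt-↑ʳ r r j)))

  private
    SE SX : Fin #V → Fin 5 → ℕ
    SE v k = Σᶠ (2 +ℕ #E) (λ e → meets (tl° e) (hd° e) v (paint° e) k)
    SX v k = Σᶠ #X (λ x → Σᶠ 2 (λ i → meets (a x) (b x) v (extra x i) k))

  base-copy : ∀ e x i v → Inc° e v → a x ≡ v ⊎ b x ≡ v → paint° e ≢ extra x i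
  base-copy e x i v ev xv eq = ℕₚ.<-irrefl refl (ℕₚ.≤-trans
    (ℕₚ.+-mono-≤
      (ℕₚ.≤-trans (meets≥1 (tl° e) (hd° e) v ev eq) (Σᶠ-≥ (2 +ℕ #E) (λ e → meets (tl° e) (hd° e) v (paint° e) (extra x i)) e))
      (ℕₚ.≤-trans (meets≥1 (a x) (b x) v {extra x i} xv refl)
        (ℕₚ.≤-trans (Σᶠ-≥ 2 (λ j → meets (a x) (b x) v (extra x j) (extra x i)) i)
          (Σᶠ-≥ #X (λ x′ → Σᶠ 2 (λ j → meets (a x′) (b x′) v (extra x′ j) (extra x i))) x))))
    (ℕₚ.≤-reflexive (once v (extra x i))))

  same-spoke : ∀ x y v → a x ≡ v ⊎ b x ≡ v → a y ≡ v ⊎ b y ≡ v → x ≡ y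
  same-spoke x y v xv yv with x ≟ᶠ y
  ... | yes x≡y = x≡y
  ... | no  x≢y = contradiction (ℕₚ.≤-trans
    (ℕₚ.≤-trans (ℕₚ.+-mono-≤ (touch x xv) (touch y yv)) (Σᶠ-≥₂ #X (λ x → [ a x ≐ v ] 1 +ℕ [ b x ≐ v ] 1) x y x≢y))
    (ℕₚ.≤-reflexive (trans (Σᶠ-+ #X _ _) (perfect v)))) (ℕₚ.<-irrefl refl)
    where
    touch : ∀ x → a x ≡ v ⊎ b x ≡ v → 1 ≤ [ a x ≐ v ] 1 +ℕ [ b x ≐ v ] 1
    touch x (inj₁ refl) = ℕₚ.≤-trans (ℕₚ.≤-reflexive (sym (≐-refl (a x) 1))) (ℕₚ.m≤m+n _ _)
    touch x (inj₂ refl) = ℕₚ.≤-trans (ℕₚ.≤-reflexive (sym (≐-refl (b x) 1))) (ℕₚ.m≤n+m _ _)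

  ↑ˡ≢↑ʳ : ∀ {k m} (i : Fin k) (j : Fin m) → i ↑ˡ m ≢ k ↑ʳ j
  ↑ˡ≢↑ʳ (suc i) j eq = ↑ˡ≢↑ʳ i j (suc-injective eq)

  proper : ∀ e f v → e ≢ f → Inc^ e v → Inc^ f v → colour e ≢ colour f
  proper e f v e≢f ev fv eq with kind e | kind f
  ... | base e | base f = ℕₚ.<-irrefl refl (ℕₚ.≤-trans
    (ℕₚ.+-mono-≤ (meets≥1 (tl° e) (hd° e) v ev (↑ˡ-injective _ _ _ eq)) (meets≥1 (tl° f) (hd° f) v {paint° f} fv refl))
    (ℕₚ.≤-trans (Σᶠ-≥₂ (2 +ℕ #E) (λ e → meets (tl° e) (hd° e) v (paint° e) (paint° f)) e f (e≢f ∘ cong inj₁))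
      (ℕₚ.≤-trans (ℕₚ.m≤m+n _ _) (ℕₚ.≤-reflexive (once v (paint° f))))))
  ... | base e | first x i _ c inc _ = base-copy e x i v ev (inc v fv) (↑ˡ-injective _ _ _ (trans eq c))
  ... | base e | later x j _ c _ _ = ↑ˡ≢↑ʳ (paint° e) j (trans eq c)
  ... | first x i _ c inc _ | base f = base-copy f x i v fv (inc v ev) (↑ˡ-injective _ _ _ (trans (sym eq) c))
  ... | later x j _ c _ _ | base f = ↑ˡ≢↑ʳ (paint° f) j (trans (sym eq) c)
  ... | first x i _ c _ _ | later y j _ d _ _ = ↑ˡ≢↑ʳ (extra x i) j (trans (sym c) (trans eq d))
  ... | later x j _ c _ _ | first y i _ d _ _ = ↑ˡ≢↑ʳ (extra y i) j (trans (sym d) (trans (sym eq) c))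
  ... | later x i _ c inc p | later y j _ d inc′ q with same-spoke x y v (inc v ev) (inc′ v fv)
  ...   | refl with ↑ʳ-injective 5 i j (trans (sym c) (trans eq d))
  ...     | refl = e≢f (trans p (sym q))
  proper e f v e≢f ev fv eq | first x i _ c inc p | first y j _ d inc′ q
    with same-spoke x y v (inc v ev) (inc′ v fv)
  ... | refl = ℕₚ.<-irrefl refl (ℕₚ.≤-trans
    (ℕₚ.+-mono-≤ (meets≥1 (a x) (b x) v (inc v ev) (↑ˡ-injective _ _ _ (trans (sym c) (trans eq d))))
                 (meets≥1 (a x) (b x) v {extra x j} (inc v ev) refl))
    (ℕₚ.≤-trans (Σᶠ-≥₂ 2 (λ l → meets (a x) (b x) v (extra x l) (extra x j)) i j (λ { refl → e≢f (trans p (sym q)) }))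
      (ℕₚ.≤-trans (Σᶠ-≥ #X (λ x′ → Σᶠ 2 (λ l → meets (a x′) (b x′) v (extra x′ l) (extra x j))) x)
        (ℕₚ.≤-trans (ℕₚ.m≤n+m _ _) (ℕₚ.≤-reflexive (once v (extra x j)))))))

  colourable : EdgeColorable graph (2 *ℕ suc r +ℕ 3)
  colourable = subst (EdgeColorable graph) (count r)
    ( colour ∘ decode
    , λ e f (e≢f , v , ev , fv) → proper (decode e) (decode f) v
        (λ eq → e≢f (trans (sym (encode-decode e)) (trans (cong encode eq) (encode-decode f)))) ev fv )
    where
    open +-*-Solver
    count : ∀ r → 5 +ℕ (r +ℕ r) ≡ 2 *ℕ suc r +ℕ 3
    count = solve 1 (λ r → con 5 :+ (r :+ r) := con 2 :* (con 1 :+ r) :+ con 3) refl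

-- König's line colouring theorem

exchange : ∀ {k} → Fin k → Fin k → Fin k → Fin k
exchange α β c with c ≟ᶠ α | c ≟ᶠ β
... | yes _ | _     = β
... | no  _ | yes _ = α
... | no  _ | no  _ = c

exchange-involutive : ∀ {k} (α β c : Fin k) → exchange α β (exchange α β c) ≡ c
exchange-involutive α β c with c ≟ᶠ α | c ≟ᶠ β
exchange-involutive α β c | yes p | _ with β ≟ᶠ α | β ≟ᶠ β
... | yes q | _     = trans q (sym p)
... | no  _ | yes _ = sym p
... | no  _ | no β≢β = contradiction refl β≢β
exchange-involutive α β c | no _ | yes p with α ≟ᶠ α | α ≟ᶠ β
... | yes _ | _ = sym p
... | no α≢α | _ = contradiction refl α≢α
exchange-involutive α β c | no c≢α | no c≢β with c ≟ᶠ α | c ≟ᶠ β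
... | yes p | _     = contradiction p c≢α
... | no  _ | yes p = contradiction p c≢β
... | no  _ | no  _ = refl

exchange-injective : ∀ {k} (α β : Fin k) {c d} → exchange α β c ≡ exchange α β d → c ≡ d
exchange-injective α β {c} {d} eq = trans (sym (exchange-involutive α β c))
  (trans (cong (exchange α β) eq) (exchange-involutive α β d))

module König {E : Set} (_≟ᴱ_ : DecidableEquality E) {N : ℕ} (l r : E → Fin N) (k : ℕ) where

  -- Degree at most `k + 1`, put as the absence of `k + 2` different edges at a vertex; in this form
  -- it passes to sublists without counting.
  Bounded : (E → Fin N) → List E → Set
  Bounded side es = ∀ v (g : Fin (suc (suc k)) → E) → (∀ i j → g i ≡ g j → i ≡ j) →
    ¬ (∀ i → g i ∈ es × side (g i) ≡ v)

  Colouring : List E → (E → Fin (suc k)) → Set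
  Colouring es c = ∀ {e f} → e ∈ es → f ∈ es → e ≢ f → l e ≡ l f ⊎ r e ≡ r f → c e ≢ c f

  Missing : (E → Fin N) → List E → (E → Fin (suc k)) → Fin N → Fin (suc k) → Set
  Missing side es c v α = ∀ {f} → f ∈ es → side f ≡ v → c f ≢ α

  -- If all colours were present at the end of `e`, one edge of each colour together with `e` would
  -- be `k + 2` edges there.
  missing : ∀ side {e es} → (∀ {f} → f ∈ es → e ≢ f) → Bounded side (e ∷ es) → ∀ c →
    ∃ (Missing side es c (side e))
  missing side {e} {es} e∉es bounded c with all? (λ α → present? α)
    where
    present? : ∀ α → Dec (Any.Any (λ f → side f ≡ side e × c f ≡ α) es)
    present? α = Any.any? (λ f → side f ≟ᶠ side e ×-dec c f ≟ᶠ α) es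
  ... | yes present = contradiction members (bounded (side e) g g-injective)
    where
    at : ∀ α → ∃ λ f → f ∈ es × side f ≡ side e × c f ≡ α
    at α = find (present α)
    g : Fin (suc (suc k)) → E
    g zero    = e
    g (suc α) = proj₁ (at α)
    members : ∀ i → g i ∈ e ∷ es × side (g i) ≡ side e
    members zero    = here refl , refl
    members (suc α) = there (proj₁ (proj₂ (at α))) , proj₁ (proj₂ (proj₂ (at α)))
    g-injective : ∀ i j → g i ≡ g j → i ≡ j
    g-injective zero    zero    _  = refl
    g-injective zero    (suc β) eq = contradiction eq (e∉es (proj₁ (proj₂ (at β))))
    g-injective (suc α) zero    eq = contradiction (sym eq) (e∉es (proj₁ (proj₂ (at α))))
    g-injective (suc α) (suc β) eq = cong suc (trans (sym (proj₂ (proj₂ (proj₂ (at α)))))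
      (trans (cong c eq) (proj₂ (proj₂ (proj₂ (at β))))))
  ... | no ¬present with ¬∀⟶∃¬ (suc k) _ (λ α → Any.any? (λ f → side f ≟ᶠ side e ×-dec c f ≟ᶠ α) es) ¬present
  ...   | α , absent = α , λ f∈es f≡v cf≡α → absent (lose f∈es (f≡v , cf≡α))

  -- Step follows an α-edge to the left and a β-edge back to the right, so Chain
  -- consists of the right vertices on the α-β path that starts at y.
  module Kempe (es : List E) (c : E → Fin (suc k)) (proper : Colouring es c) (y : Fin N)
    (α β : Fin (suc k)) (β∉y : Missing r es c y β) where

    Step : Fin N → Fin N → Set
    Step u v = Any.Any (λ f → (r f ≡ u × c f ≡ α) ×
                 Any.Any (λ g → l g ≡ l f × c g ≡ β × r g ≡ v) es) es

    step? : ∀ u v → Dec (Step u v)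
    step? u v = Any.any? (λ f → (r f ≟ᶠ u ×-dec c f ≟ᶠ α) ×-dec
      Any.any? (λ g → l g ≟ᶠ l f ×-dec (c g ≟ᶠ β ×-dec r g ≟ᶠ v)) es) es

    unique : ∀ {f g} → f ∈ es → g ∈ es → c f ≡ c g → l f ≡ l g ⊎ r f ≡ r g → f ≡ g
    unique {f} {g} f∈ g∈ eq meet with f ≟ᴱ g
    ... | yes f≡g = f≡g
    ... | no  f≢g = contradiction eq (proper f∈ g∈ f≢g meet)

    step-injective : ∀ {u u′ v} → Step u v → Step u′ v → u ≡ u′
    step-injective s s′ with find s | find s′
    ... | f , f∈ , (rf , cf) , t | f′ , f′∈ , (rf′ , cf′) , t′ with find t | find t′
    ...   | g , g∈ , lg , cg , rg | g′ , g′∈ , lg′ , cg′ , rg′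
      with unique g∈ g′∈ (trans cg (sym cg′)) (inj₂ (trans rg (sym rg′)))
    ...     | refl with unique f∈ f′∈ (trans cf (sym cf′)) (inj₁ (trans (sym lg) lg′))
    ...       | refl = trans (sym rf) rf′

    no-step-y : ∀ {u} → ¬ Step u y
    no-step-y s with find s
    ... | f , f∈ , _ , t with find t
    ...   | g , g∈ , _ , cg , rg = β∉y g∈ rg cg

    Reach : ℕ → Fin N → Set
    Reach zero    v = v ≡ y
    Reach (suc i) v = ∃ λ u → Reach i u × Step u v

    reach? : ∀ i v → Dec (Reach i v)
    reach? zero    v = v ≟ᶠ y
    reach? (suc i) v = any? (λ u → reach? i u ×-dec step? u v)

    -- `Step` is injective and `y` has no predecessor, so two ways back from a vertex run in
    -- parallel and reach `y` together.
    depth-unique : ∀ i j {v} → Reach i v → Reach j v → i ≡ j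
    depth-unique zero    zero    _    _    = refl
    depth-unique zero    (suc j) refl (u , _ , s) = contradiction s no-step-y
    depth-unique (suc i) zero    (u , _ , s) refl = contradiction s no-step-y
    depth-unique (suc i) (suc j) (u , p , s) (u′ , p′ , s′) with step-injective s s′
    ... | refl = cong suc (depth-unique i j p p′)

    reach-below : ∀ m {v} → Reach m v → ∀ i → i ≤ m → ∃ (Reach i)
    reach-below zero    p i z≤n = _ , p
    reach-below (suc m) p i i≤1+m with ℕₚ.m≤n⇒m<n∨m≡n i≤1+m
    ... | inj₂ refl      = _ , p
    ... | inj₁ (s≤s i≤m) = reach-below m (proj₁ (proj₂ p)) i i≤m

    -- A vertex at depth `N` would give `N + 1` depths, two of them with the same vertex, against
    -- `depth-unique`. Hence the bounded search in `Chain` finds the whole path and `Chain` is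
    -- closed under `Step`.
    ¬reach-N : ∀ {v} → ¬ Reach N v
    ¬reach-N p = ℕₚ.<⇒≢ (proj₁ (proj₂ (proj₂ clash)))
      (depth-unique _ _ (proj₂ (at (proj₁ clash)))
        (subst (Reach _) (sym (proj₂ (proj₂ (proj₂ clash)))) (proj₂ (at (proj₁ (proj₂ clash))))))
      where
      at : (i : Fin (suc N)) → ∃ (Reach (toℕ i))
      at i = reach-below N p (toℕ i) (toℕ≤pred[n] i)
      clash : ∃ λ i → ∃ λ j → i Fin.< j × proj₁ (at i) ≡ proj₁ (at j)
      clash = pigeonhole ℕₚ.≤-refl (proj₁ ∘ at)

    Chain : Fin N → Set
    Chain v = ∃ λ (i : Fin (suc N)) → Reach (toℕ i) v

    chain? : ∀ v → Dec (Chain v)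
    chain? v = any? (λ i → reach? (toℕ i) v)

    forward : ∀ {u v} → Chain u → Step u v → Chain v
    forward {u} {v} (i , p) s with ℕₚ.m≤n⇒m<n∨m≡n (toℕ≤pred[n] i)
    ... | inj₁ i<N = fromℕ< (s≤s i<N) , subst (λ j → Reach j v) (sym (toℕ-fromℕ< (s≤s i<N))) (u , p , s)
    ... | inj₂ i≡N = contradiction (subst (λ j → Reach j u) i≡N p) ¬reach-N

    backward : ∀ {u v} → Chain v → Step u v → Chain u
    backward (zero  , refl)        s = contradiction s no-step-y
    backward {u} (suc i , u′ , p , s′) s = inject₁ i ,
      subst (λ w → Reach (toℕ (inject₁ i)) w) (step-injective s′ s) (subst (λ j → Reach j u′) (sym (toℕ-inject₁ i)) p)

    recolour : ∀ {v} → Dec (Chain v) → Fin (suc k) → Fin (suc k)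
    recolour (yes _) d = exchange α β d
    recolour (no  _) d = d

    -- Whether an edge is recoloured depends on its right end only, so conflicts at right ends are
    -- excluded at once and only left ends need the path structure.
    flip : E → Fin (suc k)
    flip f = recolour (chain? (r f)) (c f)

    link : ∀ {f g} → f ∈ es → g ∈ es → l f ≡ l g → c f ≡ α → c g ≡ β → Step (r f) (r g)
    link f∈ g∈ lf≡lg cf cg = lose f∈ ((refl , cf) , lose g∈ (sym lf≡lg , cg , refl))

    -- An `α`-edge and a `β`-edge with a common left end are linked by `Step`, so the chain contains
    -- both right ends or neither.
    flip-mixed : ∀ {f g} → f ∈ es → g ∈ es → f ≢ g → l f ≡ l g → Chain (r f) → ¬ Chain (r g) →
      exchange α β (c f) ≢ c g
    flip-mixed {f} {g} f∈ g∈ f≢g lf≡lg cf ¬cg eq with c f ≟ᶠ α | c f ≟ᶠ β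
    ... | yes p | _     = ¬cg (forward cf (link f∈ g∈ lf≡lg p (sym eq)))
    ... | no  _ | yes p = ¬cg (backward cf (link g∈ f∈ (sym lf≡lg) (sym eq) p))
    ... | no  _ | no  _ = proper f∈ g∈ f≢g (inj₁ lf≡lg) eq

    flip-proper : Colouring es flip
    flip-proper {f} {g} f∈ g∈ f≢g meet = go (chain? (r f)) (chain? (r g)) meet
      where
      go : (p : Dec (Chain (r f))) (q : Dec (Chain (r g))) → l f ≡ l g ⊎ r f ≡ r g →
        recolour p (c f) ≢ recolour q (c g)
      go (yes _)  (yes _)  _        eq = proper f∈ g∈ f≢g meet (exchange-injective α β eq)
      go (no  _)  (no  _)  _        eq = proper f∈ g∈ f≢g meet eq
      go (yes cf) (no ¬cg) (inj₁ p) eq = flip-mixed f∈ g∈ f≢g p cf ¬cg eq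
      go (no ¬cf) (yes cg) (inj₁ p) eq = flip-mixed g∈ f∈ (f≢g ∘ sym) (sym p) cg ¬cf (sym eq)
      go (yes cf) (no ¬cg) (inj₂ p) eq = ¬cg (subst Chain p cf)
      go (no ¬cf) (yes cg) (inj₂ p) eq = ¬cf (subst Chain (sym p) cg)

    exchange-α : ∀ {d} → exchange α β d ≡ α → d ≡ β
    exchange-α {d} eq = trans (sym (exchange-involutive α β d)) (trans (cong (exchange α β) eq) at-α)
      where
      at-α : exchange α β α ≡ β
      at-α with α ≟ᶠ α
      ... | yes _  = refl
      ... | no α≢α = contradiction refl α≢α

    flip-misses-y : Missing r es flip y α
    flip-misses-y {f} f∈ refl = go (chain? (r f))
      where
      go : (p : Dec (Chain (r f))) → recolour p (c f) ≢ α
      go (yes _) eq = β∉y f∈ refl (exchange-α eq)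
      go (no ¬c) eq = ¬c (zero , refl)

    -- An edge at `x` that becomes `α` was the `β`-edge by which the chain enters its right end; the
    -- chain then came to `x` along an `α`-edge, and `x` has none.
    flip-misses-x : ∀ {x} → Missing l es c x α → Missing l es flip x α
    flip-misses-x {x} α∉x {f} f∈ lf = go (chain? (r f))
      where
      go : (p : Dec (Chain (r f))) → recolour p (c f) ≢ α
      go (no  _)              eq = α∉x f∈ lf eq
      go (yes (zero , p))     eq = β∉y f∈ p (exchange-α eq)
      go (yes (suc i , u , _ , s)) eq with find s
      ... | f₁ , f₁∈ , (_ , cf₁) , t with find t
      ...   | g , g∈ , lg , cg , rg with unique g∈ f∈ (trans cg (sym (exchange-α eq))) (inj₂ rg)
      ...     | refl = α∉x f₁∈ (trans (sym lg) lf) cf₁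

  extend : ∀ {e es} c → Colouring es c → (∀ {f} → f ∈ es → e ≢ f) → ∀ {α} →
    Missing l es c (l e) α → Missing r es c (r e) α →
    Colouring (e ∷ es) (λ f → if does (f ≟ᴱ e) then α else c f)
  extend {e} c proper e∉ α∉l α∉r {f} {g} f∈ g∈ f≢g meet eq with f ≟ᴱ e | g ≟ᴱ e
  ... | yes refl | yes refl = f≢g refl
  ... | yes refl | no g≢e with g∈ | meet
  ...   | here g≡e | _      = g≢e g≡e
  ...   | there g∈′ | inj₁ p = α∉l g∈′ (sym p) (sym eq)
  ...   | there g∈′ | inj₂ p = α∉r g∈′ (sym p) (sym eq)
  extend {e} c proper e∉ α∉l α∉r {f} {g} f∈ g∈ f≢g meet eq | no f≢e | yes refl with f∈ | meet
  ... | here f≡e | _      = f≢e f≡e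
  ... | there f∈′ | inj₁ p = α∉l f∈′ p eq
  ... | there f∈′ | inj₂ p = α∉r f∈′ p eq
  extend {e} c proper e∉ α∉l α∉r {f} {g} f∈ g∈ f≢g meet eq | no f≢e | no g≢e with f∈ | g∈
  ... | here f≡e | _        = f≢e f≡e
  ... | there _  | here g≡e = g≢e g≡e
  ... | there f∈′ | there g∈′ = proper f∈′ g∈′ f≢g meet eq

  -- Induction on the edges. A colour `α` is missing at the left end of `e` and a colour `β` at the
  -- right end; exchanging them along the chain from the right end makes `α` missing at both, and
  -- `e` receives it.
  könig : ∀ es → Unique es → Bounded l es → Bounded r es → ∃ (Colouring es)
  könig []       _          _  _  = (λ _ → zero) , λ ()
  könig (e ∷ es) (e∉ ∷ uni) bl br =
    _ , extend flip flip-proper fresh (flip-misses-x (proj₂ mx)) flip-misses-y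
    where
    fresh : ∀ {f} → f ∈ es → e ≢ f
    fresh = All.lookup e∉
    rest : ∃ (Colouring es)
    rest = könig es uni
      (λ v g inj m → bl v g inj (λ i → there (proj₁ (m i)) , proj₂ (m i)))
      (λ v g inj m → br v g inj (λ i → there (proj₁ (m i)) , proj₂ (m i)))
    mx : ∃ (Missing l es (proj₁ rest) (l e))
    mx = missing l fresh bl (proj₁ rest)
    my : ∃ (Missing r es (proj₁ rest) (r e))
    my = missing r fresh br (proj₁ rest)
    open Kempe es (proj₁ rest) (proj₂ rest) (r e) (proj₁ mx) (proj₁ my) (proj₂ my)

-- The lower bound

∑ℚ : ∀ {A : Set} → (A → ℚ) → List A → ℚ
∑ℚ g []       = 0ℚ
∑ℚ g (e ∷ es) = g e + ∑ℚ g es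

seq-∑ℚ : ∀ G (f : Edge G → ℝ) es k → seq (∑ G es f) k ≡ ∑ℚ (λ e → seq (f e) k) es
seq-∑ℚ G f []       k = refl
seq-∑ℚ G f (e ∷ es) k = cong (λ z → seq (f e) k + z) (seq-∑ℚ G f es k)

ι-suc-* : ∀ m q → ι (suc m) * q ≡ q + ι m * q
ι-suc-* m q = trans (ℚₚ.*-distribʳ-+ q 1ℚ (ι m)) (cong (λ z → z + ι m * q) (ℚₚ.*-identityˡ q))

ι-monoˡ : ∀ {j m q} → 0ℚ ≤ℚ q → j ≤ m → ι j * q ≤ℚ ι m * q
ι-monoˡ {q = q} 0≤q j≤m = ℚₚ.*-monoʳ-≤-nonNeg q {{ℚ.nonNegative 0≤q}} (ι-mono j≤m)

module Sums {A : Set} (g : A → ℚ) {lo hi : ℚ} (lo≤ : ∀ e → lo ≤ℚ g e) (≤hi : ∀ e → g e ≤ℚ hi) where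

  ∑-≥ : ∀ es → ι (length es) * lo ≤ℚ ∑ℚ g es
  ∑-≥ []       = ℚₚ.≤-reflexive (ℚₚ.*-zeroˡ lo)
  ∑-≥ (e ∷ es) = ℚₚ.≤-trans (ℚₚ.≤-reflexive (ι-suc-* (length es) lo)) (ℚₚ.+-mono-≤ (lo≤ e) (∑-≥ es))

  ∑-≤ : ∀ es → ∑ℚ g es ≤ℚ ι (length es) * hi
  ∑-≤ []       = ℚₚ.≤-reflexive (sym (ℚₚ.*-zeroˡ hi))
  ∑-≤ (e ∷ es) = ℚₚ.≤-trans (ℚₚ.+-mono-≤ (≤hi e) (∑-≤ es)) (ℚₚ.≤-reflexive (sym (ι-suc-* (length es) hi)))

  private
    exchange-+ : ∀ a b c → a + (b + c) ≡ b + (a + c)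
    exchange-+ = solve 3 (λ a b c → a :+ (b :+ c) := b :+ (a :+ c)) refl
      where open ℚ-Solver.+-*-Solver

  ∑-∈-≥ : ∀ {e es m} → e ∈ es → length es ≡ suc m → g e + ι m * lo ≤ℚ ∑ℚ g es
  ∑-∈-≥ {e} {_ ∷ es} (here refl) refl = ℚₚ.+-monoʳ-≤ (g e) (∑-≥ es)
  ∑-∈-≥ {e} {f ∷ f′ ∷ es} (there e∈) refl = ℚₚ.≤-trans
    (ℚₚ.≤-reflexive (trans (cong (λ z → g e + z) (ι-suc-* (length es) lo)) (exchange-+ (g e) lo _)))
    (ℚₚ.+-mono-≤ (lo≤ f) (∑-∈-≥ e∈ refl))

  ∑-∈-≤ : ∀ {e es m} → e ∈ es → length es ≡ suc m → ∑ℚ g es ≤ℚ g e + ι m * hi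
  ∑-∈-≤ {e} {_ ∷ es} (here refl) refl = ℚₚ.+-monoʳ-≤ (g e) (∑-≤ es)
  ∑-∈-≤ {e} {f ∷ f′ ∷ es} (there e∈) refl = ℚₚ.≤-trans
    (ℚₚ.+-mono-≤ (≤hi f) (∑-∈-≤ e∈ refl))
    (ℚₚ.≤-reflexive (sym (trans (cong (λ z → g e + z) (ι-suc-* (length es) hi)) (exchange-+ (g e) hi _))))

  ∈-length : ∀ {e : A} {es} → e ∈ es → ∃ λ m → length es ≡ suc m
  ∈-length {es = _ ∷ es} _ = length es , refl

  module _ (0≤lo : 0ℚ ≤ℚ lo) {δ : ℚ} {t : ℕ} {X Y : List A} (balance : ∑ℚ g X ≤ℚ ∑ℚ g Y + δ) where

    0≤hi : A → 0ℚ ≤ℚ hi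
    0≤hi e = ℚₚ.≤-trans 0≤lo (ℚₚ.≤-trans (lo≤ e) (≤hi e))

    -- At a vertex with majority side `X`, the edge `e` and at least `t` further edges of value at
    -- least `lo` are balanced by at most `t` edges of value at most `hi`.
    light : ∀ {e} → e ∈ X → suc t ≤ length X → length Y ≤ t → g e + ι t * lo ≤ℚ ι t * hi + δ
    light {e} e∈X t<X Y≤t with ∈-length e∈X
    ... | m , eq = begin
      g e + ι t * lo         ≤⟨ ℚₚ.+-monoʳ-≤ (g e) (ι-monoˡ 0≤lo (ℕₚ.≤-pred (subst (suc t ≤_) eq t<X))) ⟩
      g e + ι m * lo         ≤⟨ ∑-∈-≥ e∈X eq ⟩
      ∑ℚ g X                 ≤⟨ balance ⟩
      ∑ℚ g Y + δ             ≤⟨ ℚₚ.+-monoˡ-≤ δ (∑-≤ Y) ⟩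
      ι (length Y) * hi + δ  ≤⟨ ℚₚ.+-monoˡ-≤ δ (ι-monoˡ (0≤hi e) Y≤t) ⟩
      ι t * hi + δ           ∎
      where
      open ℚₚ.≤-Reasoning

    -- Here `e` lies on the minority side: with at most `t - 1` others, each at most `hi`, it has to
    -- balance `t + 1` edges of value at least `lo`.
    heavy : ∀ {e} → e ∈ Y → suc t ≤ length X → length Y ≤ t → ι (suc t) * lo ≤ℚ g e + ι (t ∸ 1) * hi + δ
    heavy {e} e∈Y t<X Y≤t with ∈-length e∈Y
    ... | m , eq = begin
      ι (suc t) * lo              ≤⟨ ι-monoˡ 0≤lo t<X ⟩
      ι (length X) * lo           ≤⟨ ∑-≥ X ⟩
      ∑ℚ g X                      ≤⟨ balance ⟩
      ∑ℚ g Y + δ                  ≤⟨ ℚₚ.+-monoˡ-≤ δ (∑-∈-≤ e∈Y eq) ⟩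
      g e + ι m * hi + δ          ≤⟨ ℚₚ.+-monoˡ-≤ δ (ℚₚ.+-monoʳ-≤ (g e) (ι-monoˡ (0≤hi e) (ℕₚ.∸-monoˡ-≤ 1 (subst (_≤ t) eq Y≤t)))) ⟩
      g e + ι (t ∸ 1) * hi + δ    ∎
      where open ℚₚ.≤-Reasoning

-- For `δ = 0` the inequality is `w + 2 ≤ w(R - 1)`, that is, `R ≥ 2 + 2/w`. The margin `8δ` absorbs
-- the errors: what is left over is `6(wδ - δ) + 2δ`, which is positive.
no-slack : ∀ w v R δ → 1 ≤ w → 0ℚ <ℚ δ → ι w * v ≡ ι 2 → R + ι 8 * δ ≤ℚ ι 2 + v →
  ¬ (ι (w +ℕ 2) * (1ℚ - δ) ≤ℚ ι w * (R + - 1ℚ + δ) + (δ + δ))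
no-slack w v R δ 1≤w 0<δ wv≡2 R≤ bad = ℚₚ.<-irrefl refl (begin-strict
  S                                                ≡⟨ ℚₚ.+-identityʳ S ⟨
  S + 0ℚ                                           <⟨ ℚₚ.+-monoʳ-< S 0<excess ⟩
  S + (y + y + y + y + y + y + (δ + δ))            ≡⟨ expand W R δ ⟨
  (W + ι 2) * (1ℚ - δ) + W * (R + ι 8 * δ)
    ≤⟨ ℚₚ.+-mono-≤ (subst (λ z → z * (1ℚ - δ) ≤ℚ W * (R + - 1ℚ + δ) + (δ + δ)) (ι-+ w 2) bad)
        (ℚₚ.*-monoˡ-≤-nonNeg W {{ℚ.nonNegative (0≤ι w)}} R≤) ⟩
  W * (R + - 1ℚ + δ) + (δ + δ) + W * (ι 2 + v)
    ≡⟨ cong (λ z → W * (R + - 1ℚ + δ) + (δ + δ) + z)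
        (trans (ℚₚ.*-distribˡ-+ W (ι 2) v) (cong (λ z → W * ι 2 + z) wv≡2)) ⟩
  S                                                ∎)
  where
  open ℚₚ.≤-Reasoning
  W S y : ℚ
  W = ι w
  S = W * (R + - 1ℚ + δ) + (δ + δ) + (W * ι 2 + ι 2)
  y = W * δ - δ
  0≤y : 0ℚ ≤ℚ y
  0≤y = subst (_≤ℚ y) (ℚₚ.+-inverseʳ δ) (ℚₚ.+-monoˡ-≤ (- δ)
    (ℚₚ.≤-trans (ℚₚ.≤-reflexive (sym (trans (cong (_* δ) (ℚₚ.+-identityʳ 1ℚ)) (ℚₚ.*-identityˡ δ))))
      (ι-monoˡ {1} {w} (ℚₚ.<⇒≤ 0<δ) 1≤w)))
  0<excess : 0ℚ <ℚ y + y + y + y + y + y + (δ + δ)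
  0<excess = ℚₚ.+-mono-≤-<
    (ℚₚ.+-mono-≤ (ℚₚ.+-mono-≤ (ℚₚ.+-mono-≤ (ℚₚ.+-mono-≤ (ℚₚ.+-mono-≤ 0≤y 0≤y) 0≤y) 0≤y) 0≤y) 0≤y)
    (ℚₚ.+-mono-< 0<δ 0<δ)
  expand : ∀ W R δ → (W + ι 2) * (1ℚ - δ) + W * (R + ι 8 * δ) ≡
    W * (R + - 1ℚ + δ) + (δ + δ) + (W * ι 2 + ι 2) +
      ((W * δ - δ) + (W * δ - δ) + (W * δ - δ) + (W * δ - δ) + (W * δ - δ) + (W * δ - δ) + (δ + δ))
  expand = solve 3 (λ W R δ →
    (W :+ con (ι 2)) :* (con 1ℚ :- δ) :+ W :* (R :+ con (ι 8) :* δ) :=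
    W :* (R :+ con (- 1ℚ) :+ δ) :+ (δ :+ δ) :+ (W :* con (ι 2) :+ con (ι 2)) :+
      ((W :* δ :- δ) :+ (W :* δ :- δ) :+ (W :* δ :- δ) :+ (W :* δ :- δ) :+ (W :* δ :- δ) :+ (W :* δ :- δ) :+ (δ :+ δ))) refl
    where open ℚ-Solver.+-*-Solver

∣p∣≤q⇒p≤q : ∀ {p q} → ℚ.∣ p ∣ ≤ℚ q → p ≤ℚ q
∣p∣≤q⇒p≤q {p} {q} le with ℚₚ.∣p∣≡p∨∣p∣≡-p p
... | inj₁ eq = subst (_≤ℚ q) eq le
... | inj₂ eq = ℚₚ.≤-trans p≤0 (ℚₚ.≤-trans (ℚₚ.0≤∣p∣ p) le)
  where
  p≤0 : p ≤ℚ 0ℚ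
  p≤0 = subst₂ _≤ℚ_ (ℚₚ.+-identityʳ p) (ℚₚ.+-inverseʳ p) (ℚₚ.+-monoʳ-≤ p (subst (0ℚ ≤ℚ_) eq (ℚₚ.0≤∣p∣ p)))

close-≤ : ∀ x y {δ} → ℚ.∣ x - y ∣ ≤ℚ δ → x ≤ℚ y + δ
close-≤ x y {δ} le = subst (_≤ℚ y + δ) (cancel x y) (ℚₚ.+-monoʳ-≤ y (∣p∣≤q⇒p≤q le))
  where
  cancel : ∀ x y → y + (x - y) ≡ x
  cancel = solve 2 (λ x y → y :+ (x :- y) := x) refl
    where open ℚ-Solver.+-*-Solver

close-≥ : ∀ x y {δ} → ℚ.∣ x - y ∣ ≤ℚ δ → y ≤ℚ x + δ
close-≥ x y {δ} le = close-≤ y x (subst (_≤ℚ δ) (trans (sym (ℚₚ.∣-p∣≡∣p∣ (x - y))) (cong ℚ.∣_∣ (swap-sub x y))) le)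
  where
  swap-sub : ∀ x y → - (x - y) ≡ y - x
  swap-sub = solve 2 (λ x y → :- (x :- y) := y :- x) refl
    where open ℚ-Solver.+-*-Solver

out+in : ∀ G D v → length (E⁺ G D v) +ℕ length (E⁻ G D v) ≡ degree G v
out+in G D v = trans (cong₂ _+ℕ_
    (length-filter-tabulate (λ e → tail G D e ≟ᶠ v) #E id) (length-filter-tabulate (λ e → head G D e ≟ᶠ v) #E id))
  (trans (sym (Σᶠ-+ #E _ _)) (trans (Σᶠ-cong #E both) (trans (Σᶠ-+ #E _ _) (sym (degree-Σ G v)))))
  where
  open Graph G
  both : ∀ e → [ tail G D e ≐ v ] 1 +ℕ [ head G D e ≐ v ] 1 ≡ [ end₁ e ≐ v ] 1 +ℕ [ end₂ e ≐ v ] 1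
  both e with D e
  ... | true  = refl
  ... | false = ℕₚ.+-comm ([ end₂ e ≐ v ] 1) _

at-most-one : ∀ ε → 0ℚ <ℚ ε → ∃ λ ε′ → 0ℚ <ℚ ε′ × ε′ ≤ℚ 1ℚ × ε′ ≤ℚ ε
at-most-one ε 0<ε with ε ℚ.≤? 1ℚ
... | yes ε≤1 = ε , 0<ε , ε≤1 , ℚₚ.≤-refl
... | no  ε≰1 = 1ℚ , ℚₚ.positive⁻¹ 1ℚ , ℚₚ.≤-refl , ℚₚ.<⇒≤ (ℚₚ.≰⇒> ε≰1)

-- Let t + 1 edges leave u.  Comparing the flow through u with the bounds, an
-- edge leaving u has a value below 2t / (2t - 1), and an edge entering u one
-- above it; the signs are opposite when t + 1 edges enter u.  So no edge joins
-- two vertices of the same kind.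
flow-bipartite : ∀ G t → 1 ≤ t → Regular G (2 *ℕ t +ℕ 1) → ∀ r → HasNowhereZeroFlow G r →
  ∀ x → ι (2 *ℕ t ∸ 1) * x ≡ ι 2 → r <ᴿ fromℚ (ι 2 + x) → Bipartite G
flow-bipartite G t@(suc t′) _ regular r (_ , D , f , bounded , conserved) x wx≡2 (ε , 0<ε , N , r+ε≤) =
  big , λ e → two-sided e big (proper e)
  where
  open Graph G
  ε′ : ℚ
  ε′ = proj₁ (at-most-one ε 0<ε)
  0<ε′ : 0ℚ <ℚ ε′
  0<ε′ = proj₁ (proj₂ (at-most-one ε 0<ε))
  ε′≤1 : ε′ ≤ℚ 1ℚ
  ε′≤1 = proj₁ (proj₂ (proj₂ (at-most-one ε 0<ε)))
  ε′≤ε : ε′ ≤ℚ ε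
  ε′≤ε = proj₂ (proj₂ (proj₂ (at-most-one ε 0<ε)))
  -- An eighth, since `no-slack` asks for a margin of `8δ`; the cap `ε′ ≤ 1` makes `lo = 1 - δ`
  -- nonnegative.
  δ : ℚ
  δ = ε′ * (+ 1 / 8)
  0<δ : 0ℚ <ℚ δ
  0<δ = subst (_<ℚ δ) (ℚₚ.*-zeroˡ (+ 1 / 8)) (ℚₚ.*-monoˡ-<-pos (+ 1 / 8) 0<ε′)
  8δ≡ε′ : ι 8 * δ ≡ ε′
  8δ≡ε′ = trans (solve 1 (λ z → con (ι 8) :* (z :* con (+ 1 / 8)) := z) refl ε′) refl
    where open ℚ-Solver.+-*-Solver
  δ≤1 : δ ≤ℚ 1ℚ
  δ≤1 = ℚₚ.≤-trans (ℚₚ.*-monoʳ-≤-nonNeg (+ 1 / 8) ε′≤1) (toWitness {a? = 1ℚ * (+ 1 / 8) ℚ.≤? 1ℚ} tt)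
  lower : ∀ e → ∃ λ k → ∀ n → k ≤ n → 1ℚ ≤ℚ seq (f e) n + δ
  lower e = proj₁ (bounded e) δ 0<δ
  upper′ : ∀ e → ∃ λ k → ∀ n → k ≤ n → seq (f e) n ≤ℚ seq r n + - 1ℚ + δ
  upper′ e = proj₂ (bounded e) δ 0<δ
  balanced : ∀ v → ∃ λ k → ∀ n → k ≤ n → ℚ.∣ seq (∑ G (E⁺ G D v) f) n - seq (∑ G (E⁻ G D v) f) n ∣ ≤ℚ δ
  balanced v = conserved v δ 0<δ
  -- One index past all moduli of convergence; their sums serve as upper bounds. From here on the
  -- flow is a rational approximation `g`.
  n₁ n₂ n₃ n : ℕ
  n₁ = Σᶠ #E (proj₁ ∘ lower)
  n₂ = Σᶠ #E (proj₁ ∘ upper′)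
  n₃ = Σᶠ #V (proj₁ ∘ balanced)
  n  = N +ℕ (n₁ +ℕ (n₂ +ℕ n₃))
  n₁≤n : n₁ ≤ n
  n₁≤n = ℕₚ.≤-trans (ℕₚ.m≤m+n n₁ _) (ℕₚ.m≤n+m _ N)
  n₂≤n : n₂ ≤ n
  n₂≤n = ℕₚ.≤-trans (ℕₚ.m≤m+n n₂ n₃) (ℕₚ.≤-trans (ℕₚ.m≤n+m _ n₁) (ℕₚ.m≤n+m _ N))
  n₃≤n : n₃ ≤ n
  n₃≤n = ℕₚ.≤-trans (ℕₚ.m≤n+m n₃ n₂) (ℕₚ.≤-trans (ℕₚ.m≤n+m _ n₁) (ℕₚ.m≤n+m _ N))
  g : Edge G → ℚ
  g e = seq (f e) n
  lo hi : ℚ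
  lo = 1ℚ - δ
  hi = seq r n + - 1ℚ + δ
  lo≤ : ∀ e → lo ≤ℚ g e
  lo≤ e = subst (lo ≤ℚ_) (cancel (g e) δ)
    (ℚₚ.+-monoˡ-≤ (- δ) (proj₂ (lower e) n (ℕₚ.≤-trans (Σᶠ-≥ #E (proj₁ ∘ lower) e) n₁≤n)))
    where
    cancel : ∀ x y → x + y - y ≡ x
    cancel = solve 2 (λ x y → x :+ y :- y := x) refl
      where open ℚ-Solver.+-*-Solver
  ≤hi : ∀ e → g e ≤ℚ hi
  ≤hi e = proj₂ (upper′ e) n (ℕₚ.≤-trans (Σᶠ-≥ #E (proj₁ ∘ upper′) e) n₂≤n)
  0≤lo : 0ℚ ≤ℚ lo
  0≤lo = subst (_≤ℚ lo) (ℚₚ.+-inverseʳ δ) (ℚₚ.+-monoˡ-≤ (- δ) δ≤1)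
  near : ∀ v → ℚ.∣ ∑ℚ g (E⁺ G D v) - ∑ℚ g (E⁻ G D v) ∣ ≤ℚ δ
  near v = subst₂ (λ y z → ℚ.∣ y - z ∣ ≤ℚ δ) (seq-∑ℚ G f (E⁺ G D v) n) (seq-∑ℚ G f (E⁻ G D v) n)
    (proj₂ (balanced v) n (ℕₚ.≤-trans (Σᶠ-≥ #V (proj₁ ∘ balanced) v) n₃≤n))
  out≤in : ∀ v → ∑ℚ g (E⁺ G D v) ≤ℚ ∑ℚ g (E⁻ G D v) + δ
  out≤in v = close-≤ (∑ℚ g (E⁺ G D v)) (∑ℚ g (E⁻ G D v)) (near v)
  in≤out : ∀ v → ∑ℚ g (E⁻ G D v) ≤ℚ ∑ℚ g (E⁺ G D v) + δ
  in≤out v = close-≥ (∑ℚ g (E⁺ G D v)) (∑ℚ g (E⁻ G D v)) (near v)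
  open Sums g lo≤ ≤hi
  R≤ : seq r n + ι 8 * δ ≤ℚ ι 2 + x
  R≤ = ℚₚ.≤-trans (ℚₚ.+-monoʳ-≤ (seq r n) (ℚₚ.≤-trans (ℚₚ.≤-reflexive 8δ≡ε′) ε′≤ε))
    (r+ε≤ n (ℕₚ.m≤m+n N _))
  total : ∀ v → length (E⁺ G D v) +ℕ length (E⁻ G D v) ≡ suc (t +ℕ t)
  total v = trans (out+in G D v) (trans (regular v) (lemma t))
    where
    open +-*-Solver
    lemma : ∀ t → 2 *ℕ t +ℕ 1 ≡ suc (t +ℕ t)
    lemma = solve 1 (λ t → con 2 :* t :+ con 1 := con 1 :+ (t :+ t)) refl
  complement : ∀ {i j} → i +ℕ j ≡ suc (t +ℕ t) → suc t ≤ i → j ≤ t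
  complement {i} {j} eq t<i = ℕₚ.+-cancelˡ-≤ (suc t) j t
    (ℕₚ.≤-trans (ℕₚ.+-monoˡ-≤ j t<i) (ℕₚ.≤-reflexive eq))
  complement′ : ∀ {i j} → i +ℕ j ≡ suc (t +ℕ t) → ¬ suc t ≤ i → suc t ≤ j
  complement′ {i} {j} eq t≮i = ℕₚ.+-cancelˡ-≤ t (suc t) j
    (ℕₚ.≤-trans (ℕₚ.≤-reflexive (trans (ℕₚ.+-suc t t) (sym eq))) (ℕₚ.+-monoˡ-≤ j (ℕₚ.≤-pred (ℕₚ.≰⇒> t≮i))))
  -- Adding the two estimates cancels `g e` and leaves `(2t + 1) lo ≤ (2t - 1) hi + 2δ`, which
  -- `no-slack` excludes with `w = 2t - 1`.
  impossible : ∀ e → g e + ι t * lo ≤ℚ ι t * hi + δ → ¬ (ι (suc t) * lo ≤ℚ g e + ι (t ∸ 1) * hi + δ)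
  impossible e p q = no-slack w x (seq r n) δ (ℕₚ.m≤n+m 1 _) 0<δ
    (trans (cong (λ k → ι k * x) (sym w≡)) wx≡2) R≤ (cancel-≤ (g e) (subst₂ _≤ℚ_ left right (ℚₚ.+-mono-≤ p q)))
    where
    w : ℕ
    w = t′ +ℕ t′ +ℕ 1
    w≡ : 2 *ℕ t ∸ 1 ≡ w
    w≡ = lemma t′
      where
      open +-*-Solver
      lemma : ∀ t → t +ℕ suc (t +ℕ 0) ≡ t +ℕ t +ℕ 1
      lemma = solve 1 (λ t → t :+ (con 1 :+ (t :+ con 0)) := t :+ t :+ con 1) refl
    cancel-≤ : ∀ z {a b} → z + a ≤ℚ z + b → a ≤ℚ b
    cancel-≤ z {a} {b} le = subst₂ _≤ℚ_ (lemma z a) (lemma z b) (ℚₚ.+-monoʳ-≤ (- z) le)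
      where
      lemma : ∀ z a → - z + (z + a) ≡ a
      lemma = solve 2 (λ z a → :- z :+ (z :+ a) := a) refl
        where open ℚ-Solver.+-*-Solver
    left : g e + ι t * lo + ι (suc t) * lo ≡ g e + ι (w +ℕ 2) * lo
    left = trans (ℚₚ.+-assoc (g e) _ _) (cong (λ z → g e + z)
      (trans (sym (ℚₚ.*-distribʳ-+ lo (ι t) (ι (suc t)))) (cong (_* lo) (trans (sym (ι-+ t (suc t))) (cong ι (lemma t′))))))
      where
      open +-*-Solver
      lemma : ∀ t → suc t +ℕ suc (suc t) ≡ t +ℕ t +ℕ 1 +ℕ 2
      lemma = solve 1 (λ t → con 1 :+ t :+ (con 2 :+ t) := t :+ t :+ con 1 :+ con 2) refl
    right : ι t * hi + δ + (g e + ι t′ * hi + δ) ≡ g e + (ι w * hi + (δ + δ))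
    right = trans (lemma (ι t) (ι t′) hi δ (g e)) (cong (λ z → g e + (z * hi + (δ + δ)))
      (trans (sym (ι-+ t t′)) (cong ι (count t′))))
      where
      lemma : ∀ a b h d z → a * h + d + (z + b * h + d) ≡ z + ((a + b) * h + (d + d))
      lemma = solve 5 (λ a b h d z → a :* h :+ d :+ (z :+ b :* h :+ d) := z :+ ((a :+ b) :* h :+ (d :+ d))) refl
        where open ℚ-Solver.+-*-Solver
      count : ∀ t → suc t +ℕ t ≡ t +ℕ t +ℕ 1
      count = solve 1 (λ t → con 1 :+ t :+ t := t :+ t :+ con 1) refl
        where open +-*-Solver
  big : Vertex G → Bool
  big v = does (suc t ℕₚ.≤? length (E⁺ G D v))
  proper : ∀ e → big (tail G D e) ≢ big (head G D e)
  proper e = go (suc t ℕₚ.≤? length (E⁺ G D v)) (suc t ℕₚ.≤? length (E⁺ G D u))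
    where
    v u : Vertex G
    v = tail G D e
    u = head G D e
    e∈out : e ∈ E⁺ G D v
    e∈out = ∈ₚ.∈-filter⁺ (λ e → tail G D e ≟ᶠ v) (∈ₚ.∈-allFin e) refl
    e∈in : e ∈ E⁻ G D u
    e∈in = ∈ₚ.∈-filter⁺ (λ e → head G D e ≟ᶠ u) (∈ₚ.∈-allFin e) refl
    go : (p : Dec (suc t ≤ length (E⁺ G D v))) (q : Dec (suc t ≤ length (E⁺ G D u))) → does p ≢ does q
    go (yes p) (yes q) _ = impossible e
      (light 0≤lo {X = E⁺ G D v} {Y = E⁻ G D v} (out≤in v) e∈out p (complement (total v) p))
      (heavy 0≤lo {X = E⁺ G D u} {Y = E⁻ G D u} (out≤in u) e∈in q (complement (total u) q))
    go (no p) (no q) _ = impossible e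
      (light 0≤lo {X = E⁻ G D u} {Y = E⁺ G D u} (in≤out u) e∈in (complement′ (total u) q) (ℕₚ.≤-pred (ℕₚ.≰⇒> q)))
      (heavy 0≤lo {X = E⁻ G D v} {Y = E⁺ G D v} (in≤out v) e∈out (complement′ (total v) p) (ℕₚ.≤-pred (ℕₚ.≰⇒> p)))
  two-sided : ∀ e (c : Vertex G → Bool) → c (tail G D e) ≢ c (head G D e) → c (end₁ e) ≢ c (end₂ e)
  two-sided e with D e
  ... | true  = λ _ → id
  ... | false = λ _ ne → ne ∘ sym

-- Classes and perfect matchings of regular graphs

unique-lookup : ∀ {A : Set} {xs : List A} → Unique xs → ∀ i j → List.lookup xs i ≡ List.lookup xs j → i ≡ j
unique-lookup (_ ∷ _)   zero    zero    _  = refl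
unique-lookup {xs = _ ∷ xs} (x∉ ∷ _) zero (suc j) eq =
  contradiction eq (All.lookup x∉ (∈ₚ.∈-lookup {xs = xs} j))
unique-lookup {xs = _ ∷ xs} (x∉ ∷ _) (suc i) zero eq =
  contradiction (sym eq) (All.lookup x∉ (∈ₚ.∈-lookup {xs = xs} i))
unique-lookup (_ ∷ xs!) (suc i) (suc j) eq = cong suc (unique-lookup xs! i j eq)

module Degree (G : Graph) where
  open Graph G

  star : Vertex G → List (Edge G)
  star v = filter (λ e → incident? G e v) (allFin #E)

  star-unique : ∀ v → Unique (star v)
  star-unique v = Uniqueₚ.filter⁺ (λ e → incident? G e v) (Uniqueₚ.allFin⁺ #E)

  at-most-degree : ∀ {m} v (g : Fin m → Edge G) → (∀ i j → g i ≡ g j → i ≡ j) →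
    (∀ i → Incident G (g i) v) → m ≤ degree G v
  at-most-degree v g g-injective inc = injective⇒≤ {f = λ i → Any.index (member i)} λ {i} {j} eq →
    g-injective i j (trans (lookup-index (member i))
      (trans (cong (List.lookup (star v)) eq) (sym (lookup-index (member j)))))
    where
    member : ∀ i → g i ∈ star v
    member i = ∈ₚ.∈-filter⁺ (λ e → incident? G e v) (∈ₚ.∈-allFin (g i)) (inc i)

  at : ∀ v → Fin (degree G v) → Edge G
  at v = List.lookup (star v)

  at-incident : ∀ v i → Incident G (at v i) v
  at-incident v i = proj₂ (∈ₚ.∈-filter⁻ (λ e → incident? G e v) {xs = allFin #E} (∈ₚ.∈-lookup {xs = star v} i))

  at-injective : ∀ v i j → at v i ≡ at v j → i ≡ j
  at-injective v = unique-lookup (star-unique v)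

  colours-injective : ∀ {k} (c : EdgeColorable G k) v i j → proj₁ c (at v i) ≡ proj₁ c (at v j) → i ≡ j
  colours-injective (c , proper) v i j eq with i ≟ᶠ j
  ... | yes i≡j = i≡j
  ... | no  i≢j = contradiction eq (proper (at v i) (at v j)
    (i≢j ∘ at-injective v i j , v , at-incident v i , at-incident v j))

  degree≤colours : ∀ {k} → EdgeColorable G k → ∀ v → degree G v ≤ k
  degree≤colours c v = injective⇒≤ {f = proj₁ c ∘ at v} λ {i} {j} → colours-injective c v i j

open Degree

-- A vertex is supplied because `Δ` is 0 on the empty graph, which is regular of every degree.
maximum-degree : ∀ G {k} → Regular G k → Vertex G → Δ G ≡ k
maximum-degree G@record { #V = suc _ } {k} regular _ = ℕₚ.≤-antisym
  (Extrema.max≤v⁺ z≤n (Allₚ.map⁺ (All.universal (ℕₚ.≤-reflexive ∘ regular) (allFin (Graph.#V G)))))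
  (Extrema.v≤max⁺ 0 (List.map (degree G) (allFin (Graph.#V G))) (inj₂ (here (ℕₚ.≤-reflexive (sym (regular zero))))))

regular-class1 : ∀ G {k} → Regular G k → EdgeColorable G k → Class1 G
regular-class1 G@record { #V = zero } regular c =
  ((λ e → contradiction (Graph.end₁ G e) λ ()) , λ e → contradiction (Graph.end₁ G e) λ ()) , λ _ _ → z≤n
regular-class1 G@record { #V = suc _ } {k} regular c = subst (IsChromaticIndex G) (sym (maximum-degree G regular zero))
  (c , λ j c′ → subst (_≤ j) (regular zero) (degree≤colours G c′ zero))

regular-class2 : ∀ G {k} → Regular G k → Vertex G → ¬ EdgeColorable G k → Class2 G
regular-class2 G regular v ¬c (c , _) = ¬c (subst (EdgeColorable G) (maximum-degree G regular v) c)

-- Formulated for a list of edges, to serve both a whole bipartite graph and the edges that a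
-- perfect matching leaves in a cubic graph.
bipartite-colouring : ∀ G (let open Graph G) (side : Vertex G → Bool) k (es : List (Edge G)) → Unique es →
  (∀ {e} → e ∈ es → side (end₁ e) ≢ side (end₂ e)) →
  (∀ v (g : Fin (suc (suc k)) → Edge G) → (∀ i j → g i ≡ g j → i ≡ j) → ¬ (∀ i → g i ∈ es × Incident G (g i) v)) →
  ∃ λ (c : Edge G → Fin (suc k)) → ∀ {e f} → e ∈ es → f ∈ es → Adjacent G e f → c e ≢ c f
bipartite-colouring G side k es es! sides bounded = proj₁ coloured , λ {e} {f} e∈ f∈ (e≢f , v , ev , fv) →
  proj₂ coloured e∈ f∈ e≢f (meet e∈ f∈ ev fv)
  where
  open Graph G
  l r : Edge G → Vertex G
  l e = if side (end₁ e) then end₂ e else end₁ e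
  r e = if side (end₁ e) then end₁ e else end₂ e
  l-incident : ∀ e → Incident G e (l e)
  l-incident e with side (end₁ e)
  ... | true  = inj₂ refl
  ... | false = inj₁ refl
  r-incident : ∀ e → Incident G e (r e)
  r-incident e with side (end₁ e)
  ... | true  = inj₁ refl
  ... | false = inj₂ refl
  end : ∀ {e v} → e ∈ es → Incident G e v → (side v ≡ true × r e ≡ v) ⊎ (side v ≡ false × l e ≡ v)
  end {e} e∈ (inj₁ refl) with side (end₁ e) in eq
  ... | true  = inj₁ (refl , refl)
  ... | false = inj₂ (refl , refl)
  end {e} e∈ (inj₂ refl) with side (end₁ e) in eq | side (end₂ e) in eq′
  ... | true  | true  = contradiction (trans eq (sym eq′)) (sides e∈)
  ... | true  | false = inj₂ (refl , refl)
  ... | false | true  = inj₁ (refl , refl)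
  ... | false | false = contradiction (trans eq (sym eq′)) (sides e∈)
  meet : ∀ {e f v} → e ∈ es → f ∈ es → Incident G e v → Incident G f v → l e ≡ l f ⊎ r e ≡ r f
  meet e∈ f∈ ev fv with end e∈ ev | end f∈ fv
  ... | inj₁ (_ , p) | inj₁ (_ , q) = inj₂ (trans p (sym q))
  ... | inj₂ (_ , p) | inj₂ (_ , q) = inj₁ (trans p (sym q))
  ... | inj₁ (p , _) | inj₂ (q , _) = contradiction (trans (sym p) q) λ ()
  ... | inj₂ (p , _) | inj₁ (q , _) = contradiction (trans (sym p) q) λ ()
  open König _≟ᶠ_ l r k
  coloured : ∃ (Colouring es)
  coloured = könig es es!
    (λ v g inj m → bounded v g inj (λ i → proj₁ (m i) , subst (Incident G (g i)) (proj₂ (m i)) (l-incident (g i))))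
    (λ v g inj m → bounded v g inj (λ i → proj₁ (m i) , subst (Incident G (g i)) (proj₂ (m i)) (r-incident (g i))))

bipartite-colourable : ∀ G k → Regular G (suc k) → Bipartite G → EdgeColorable G (suc k)
bipartite-colourable G k regular (side , sides) = proj₁ c , λ e f → proj₂ c (∈ₚ.∈-allFin e) (∈ₚ.∈-allFin f)
  where
  open Graph G
  c : ∃ λ (c : Edge G → Fin (suc k)) → ∀ {e f} → e ∈ allFin #E → f ∈ allFin #E → Adjacent G e f → c e ≢ c f
  c = bipartite-colouring G side k (allFin #E) (Uniqueₚ.allFin⁺ #E) (λ {e} _ → sides e)
    λ v g inj m → ℕₚ.<-irrefl (sym (regular v)) (at-most-degree G v g inj (proj₂ ∘ m))

colour-class : ∀ {m k} → (Fin m → Fin k) → Fin k → Subset.Subset m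
colour-class c i = Vec.tabulate (λ e → does (c e ≟ᶠ i))

∈-colour-class⁺ : ∀ {m k} (c : Fin m → Fin k) i e → c e ≡ i → e Subset.∈ colour-class c i
∈-colour-class⁺ c i e eq = Vecₚ.lookup⇒[]= e _ (trans (Vecₚ.lookup∘tabulate _ e) (dec-true (c e ≟ᶠ i) eq))

∈-colour-class⁻ : ∀ {m k} (c : Fin m → Fin k) i e → e Subset.∈ colour-class c i → c e ≡ i
∈-colour-class⁻ c i e e∈ with c e ≟ᶠ i in eq
... | yes p = p
... | no  _ = contradiction
  (trans (sym (cong does eq)) (trans (sym (Vecₚ.lookup∘tabulate (λ e → does (c e ≟ᶠ i)) e)) (Vecₚ.[]=⇒lookup e∈))) λ ()

-- The `k + 1` edges at `v` have different colours; if none were `zero`, `punchOut` would inject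
-- them into `k` colours.
colour-class-perfect : ∀ G {k} → Regular G (suc k) → (c : EdgeColorable G (suc k)) →
  PerfectMatching G (colour-class (proj₁ c) zero)
colour-class-perfect G {k} regular c@(col , proper) v with any? (λ i → col (at G v i) ≟ᶠ zero)
... | yes (i , eq) = at G v i , (∈-colour-class⁺ col zero _ eq , at-incident G v i) , λ {e} (e∈ , ev) → unique e e∈ ev
  where
  unique : ∀ e → e Subset.∈ colour-class col zero → Incident G e v → at G v i ≡ e
  unique e e∈ ev with at G v i ≟ᶠ e
  ... | yes p = p
  ... | no  p = contradiction (trans eq (sym (∈-colour-class⁻ col zero e e∈)))
    (proper _ _ (p , v , at-incident G v i , ev))
... | no none = contradiction (subst (_≤ k) (regular v) (injective⇒≤ {f = λ i → punchOut (nonzero i)}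
    λ {i} {j} eq → colours-injective G c v i j (punchOut-injective (nonzero i) (nonzero j) eq))) ℕₚ.1+n≰n
  where
  nonzero : ∀ i → zero ≢ col (at G v i)
  nonzero i eq = none (i , sym eq)

delete-bipartite : ∀ G M → Bipartite G → Bipartite (delete G M)
delete-bipartite G M (side , sides) = side , λ i → sides _

value-< : ∀ {x q} → ι 2 + x <ℚ q → fromℚ (ι 2 + x) <ᴿ fromℚ q
value-< {x} {q} v<q = q - (ι 2 + x)
  , subst (_<ℚ q - (ι 2 + x)) (ℚₚ.+-inverseʳ (ι 2 + x)) (ℚₚ.+-monoˡ-< (- (ι 2 + x)) v<q)
  , 0 , λ _ _ → ℚₚ.≤-reflexive (cancel (ι 2 + x) q)
  where
  cancel : ∀ R q → R + (q - R) ≡ q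
  cancel = solve 2 (λ R q → R :+ (q :- R) := q) refl
    where open ℚ-Solver.+-*-Solver

-- If `q` did not exceed the value, a flow number below `q` would be below the value, and
-- `flow-bipartite` would make `G` bipartite.
value-≤-φ : ∀ G t → 1 ≤ t → Regular G (2 *ℕ t +ℕ 1) → ¬ Bipartite G → ∀ x → ι (2 *ℕ t ∸ 1) * x ≡ ι 2 →
  ∀ q → below (φ-c G) q → below (finite (fromℚ (ι 2 + x))) q
value-≤-φ G t 1≤t regular ¬bip x wx≡2 q ((r , flow) , r<q) with (ι 2 + x) ℚ.<? q
... | yes v<q = value-< {x} v<q
... | no  v≮q = contradiction (flow-bipartite G t 1≤t regular r flow x wx≡2 (r<value r<q)) ¬bip
  where
  r<value : r <ᴿ fromℚ q → r <ᴿ fromℚ (ι 2 + x)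
  r<value (ε , 0<ε , N , h) = ε , 0<ε , N , λ n N≤n → ℚₚ.≤-trans (h n N≤n) (ℚₚ.≮⇒≥ v≮q)

-- Perfect matchings with bipartite complement

undeleted : ∀ G M (b : Bipartite (delete G M)) (let open Graph G) e → ¬ (e Subset.∈ M) →
  proj₁ b (end₁ e) ≢ proj₁ b (end₂ e)
undeleted G M (side , sides) e e∉M = subst (λ e → side (end₁ e) ≢ side (end₂ e))
  (sym (lookup-index e∈rest)) (sides (Any.index e∈rest))
  where
  open Graph G
  e∈rest : e ∈ filter (λ e → ¬? (e ∈? M)) (allFin #E)
  e∈rest = ∈ₚ.∈-filter⁺ (λ e → ¬? (e ∈? M)) (∈ₚ.∈-allFin e) e∉M

two-of-three : ∀ (p q s z : Fin 3) → p ≢ q → p ≢ s → q ≢ s → z ≢ s → z ≡ p ⊎ z ≡ q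
two-of-three p q s z p≢q p≢s q≢s z≢s
  with toWitness {a? = all? λ p → all? λ q → all? λ s → all? λ z →
    (p ≟ᶠ q) ⊎-dec ((p ≟ᶠ s) ⊎-dec ((q ≟ᶠ s) ⊎-dec ((z ≟ᶠ s) ⊎-dec ((z ≟ᶠ p) ⊎-dec (z ≟ᶠ q)))))} tt p q s z
... | inj₁ e                             = contradiction e p≢q
... | inj₂ (inj₁ e)                      = contradiction e p≢s
... | inj₂ (inj₂ (inj₁ e))               = contradiction e q≢s
... | inj₂ (inj₂ (inj₂ (inj₁ e)))        = contradiction e z≢s
... | inj₂ (inj₂ (inj₂ (inj₂ e)))        = e

-- A perfect matching whose removal leaves a bipartite graph restricts to the
-- cubic graph, where König's theorem completes it to a 3-edge-colouring.
module Unmatched {n : ℕ} (P : Pole n 0) (apart : Apart P) (T : Thickening P) (r : ℕ) where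
  open Pole P
  open Thickening T
  open Closed P apart T r

  cubic : Graph
  cubic = record { #V = #V ; #E = 2 +ℕ #E ; end₁ = tl° ; end₂ = hd° ; loopless = loopless° }

  cubic-regular : Regular cubic 3
  cubic-regular v = trans (degree-Σ cubic v) (trans (cong₂ _+ℕ_ (out° v) (in° v))
    (cong suc (trans (ℕₚ.+-suc (α v) (β v)) (cong suc (perfect v)))))

  base : Ê → Fin (2 +ℕ #E)
  base (inj₁ e)       = e
  base (inj₂ (x , _)) = 2 ↑ʳ edge x

  base-Inc : ∀ e v → Inc^ e v → Inc° (base e) v
  base-Inc (inj₁ e) v p = p
  base-Inc (inj₂ (x , inj₁ _)) v p with ends x | p
  ... | inj₁ (p₁ , p₂) | inj₁ q = inj₁ (trans (sym p₁) q)
  ... | inj₁ (p₁ , p₂) | inj₂ q = inj₂ (trans (sym p₂) q)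
  ... | inj₂ (p₁ , p₂) | inj₁ q = inj₂ (trans (sym p₁) q)
  ... | inj₂ (p₁ , p₂) | inj₂ q = inj₁ (trans (sym p₂) q)
  base-Inc (inj₂ (x , inj₂ _)) v p with ends x | p
  ... | inj₁ (p₁ , p₂) | inj₁ q = inj₂ (trans (sym p₂) q)
  ... | inj₁ (p₁ , p₂) | inj₂ q = inj₁ (trans (sym p₁) q)
  ... | inj₂ (p₁ , p₂) | inj₁ q = inj₁ (trans (sym p₂) q)
  ... | inj₂ (p₁ , p₂) | inj₂ q = inj₂ (trans (sym p₁) q)

  Inc-base : ∀ e v → Inc° (base e) v → Inc^ e v
  Inc-base (inj₁ e)       v p = p
  Inc-base (inj₂ (x , z)) v p = subst (λ z → Inc^ (inj₂ (x , z)) v) (splitAt-join r r z)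
    (copy-Inc x (suc (join r r z)) v p)

  no-bipartite-complement : Transmits P {Fin #E} id →
    ¬ (∃ λ M → PerfectMatching graph M × Bipartite (delete graph M))
  no-bipartite-complement tr (M , matching , bip) =
    closed-unmatched tr colour colour-proper λ i → matched-at (2 ↑ʳ i)
    where
    -- The image of `M` in the cubic graph: an edge is covered if it or one of its parallel copies
    -- lies in `M`. Covered edges will receive colour `zero`.
    Covered : Fin (2 +ℕ #E) → Set
    Covered e = ∃ λ m → m Subset.∈ M × base (decode m) ≡ e
    covered? : ∀ e → Dec (Covered e)
    covered? e = any? λ m → (m ∈? M) ×-dec (base (decode m) ≟ᶠ e)
    uncovered : List (Fin (2 +ℕ #E))
    uncovered = filter (λ e → ¬? (covered? e)) (allFin (2 +ℕ #E))
    uncovered⁻ : ∀ {e} → e ∈ uncovered → ¬ Covered e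
    uncovered⁻ e∈ = proj₂ (∈ₚ.∈-filter⁻ (λ e → ¬? (covered? e)) {xs = allFin (2 +ℕ #E)} e∈)
    uncovered⁺ : ∀ {e} → ¬ Covered e → e ∈ uncovered
    uncovered⁺ {e} = ∈ₚ.∈-filter⁺ (λ e → ¬? (covered? e)) (∈ₚ.∈-allFin e)
    sides : ∀ {e} → e ∈ uncovered → proj₁ bip (tl° e) ≢ proj₁ bip (hd° e)
    sides {e} e∈ = subst (λ z → proj₁ bip (tl^ z) ≢ proj₁ bip (hd^ z)) (decode-encode (inj₁ e))
      (undeleted graph M bip (encode (inj₁ e))
        λ m → uncovered⁻ e∈ (encode (inj₁ e) , m , cong base (decode-encode (inj₁ e))))
    -- The edge of `M` at `v` covers one of the three cubic edges there, which leaves at most two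
    -- for the two remaining colours.
    few : ∀ v (g : Fin 3 → Fin (2 +ℕ #E)) → (∀ i j → g i ≡ g j → i ≡ j) →
      ¬ (∀ i → g i ∈ uncovered × Incident cubic (g i) v)
    few v g g-injective at-v with matching v
    ... | m , (m∈ , mv) , _ = ℕₚ.1+n≰n (subst (4 ≤_) (cubic-regular v)
      (at-most-degree cubic v ((base (decode m) ∷ []) ▹ g) injective incident))
      where
      ≢g : ∀ i → base (decode m) ≢ g i
      ≢g i eq = uncovered⁻ (proj₁ (at-v i)) (m , m∈ , eq)
      injective : ∀ i j → ((base (decode m) ∷ []) ▹ g) i ≡ ((base (decode m) ∷ []) ▹ g) j → i ≡ j
      injective zero    zero    _  = refl
      injective zero    (suc j) eq = contradiction eq (≢g j)
      injective (suc i) zero    eq = contradiction (sym eq) (≢g i)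
      injective (suc i) (suc j) eq = cong suc (g-injective i j eq)
      incident : ∀ i → Incident cubic (((base (decode m) ∷ []) ▹ g) i) v
      incident zero    = base-Inc (decode m) v mv
      incident (suc i) = proj₂ (at-v i)
    rest : ∃ λ (c : Fin (2 +ℕ #E) → Fin 2) → ∀ {e f} → e ∈ uncovered → f ∈ uncovered → Adjacent cubic e f → c e ≢ c f
    rest = bipartite-colouring cubic (proj₁ bip) 1 uncovered
      (Uniqueₚ.filter⁺ (λ e → ¬? (covered? e)) (Uniqueₚ.allFin⁺ (2 +ℕ #E))) sides few
    shade : ∀ e → Dec (Covered e) → Fin 3
    shade e (yes _) = zero
    shade e (no  _) = suc (proj₁ rest e)
    colour : Fin (2 +ℕ #E) → Fin 3
    colour e = shade e (covered? e)
    colour-proper : Proper° colour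
    colour-proper e f v e≢f ev fv = go (covered? e) (covered? f)
      where
      go : (p : Dec (Covered e)) (q : Dec (Covered f)) → shade e p ≢ shade f q
      -- Two covered edges at `v` both come from the unique edge of `M` at `v`.
      go (yes (m , m∈ , p)) (yes (l , l∈ , q)) _ = e≢f (trans (sym p) (trans (cong (base ∘ decode) m≡l) q))
        where
        the : ∀ k → k Subset.∈ M → Incident graph k v → proj₁ (matching v) ≡ k
        the k k∈ kv = proj₂ (proj₂ (matching v)) (k∈ , kv)
        m≡l : m ≡ l
        m≡l = trans (sym (the m m∈ (Inc-base (decode m) v (subst (λ e → Inc° e v) (sym p) ev))))
                    (the l l∈ (Inc-base (decode l) v (subst (λ e → Inc° e v) (sym q) fv)))
      go (yes _) (no _) ()
      go (no _) (yes _) ()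
      go (no ¬p) (no ¬q) eq = proj₂ rest (uncovered⁺ ¬p) (uncovered⁺ ¬q) (e≢f , v , ev , fv) (suc-injective eq)
    matched-at : ∀ e → MatchedAt° colour e
    matched-at e v w x y z v≢w ev ew x≢e y≢e z≢e x≢y xv yv zw =
      two-of-three (colour x) (colour y) (colour e) (colour z)
        (colour-proper x y v x≢y xv yv) (colour-proper x e v x≢e xv ev)
        (colour-proper y e v y≢e yv ev) (colour-proper z e w z≢e zw ew)

-- The upper bound

chain : ∀ {n s} → Pole n s → Pole n 0
chain {s = zero}  P = P
chain {s = suc s} P = chain (step P)

chain-thickening : ∀ {n s} {P : Pole n s} → Thickening P → Thickening (chain P)
chain-thickening {s = zero}  T = T
chain-thickening {s = suc s} T = chain-thickening (stepThickening T)

chain-painting : ∀ {n s} {P : Pole n s} {T : Thickening P} → Painting T → Painting (chain-thickening T)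
chain-painting {s = zero}  p = p
chain-painting {s = suc s} p = chain-painting (stepPainting p)

step-apart : ∀ {n s} (P : Pole n (suc s)) → Apart (step P)
step-apart P = (λ ()) , λ ()

chain-apart : ∀ {n s} (P : Pole n s) → Apart P → Apart (chain P)
chain-apart {s = zero}  P apart = apart
chain-apart {s = suc s} P apart = chain-apart (step P) (step-apart P)

chain-vertex : ∀ {n s} (P : Pole n s) → Fin (Pole.#V P) → Fin (Pole.#V (chain P))
chain-vertex {s = zero}  P v = v
chain-vertex {s = suc s} P v = chain-vertex (step P) (8 ↑ʳ v)

step-transmits-edge : ∀ {n s} {P : Pole n (suc s)} (T : Thickening P) →
  Transmits P (Thickening.edge T) → Transmits (step P) (Thickening.edge (stepThickening T))
step-transmits-edge {P = P} T tr = step-transmits P (Thickening.edge T) (Thickening.edge (stepThickening T)) tr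
  (λ { 0F → 0F , refl ; 1F → 1F , refl ; 2F → 2F , refl ; 3F → 3F , refl }) (λ i → 4 ↑ʳ i , refl)

chain-transmits-edge : ∀ {n s} {P : Pole n s} (T : Thickening P) →
  Transmits P (Thickening.edge T) → Transmits (chain P) (Thickening.edge (chain-thickening T))
chain-transmits-edge {s = zero}  T tr = tr
chain-transmits-edge {s = suc s} T tr = chain-transmits-edge (stepThickening T) (step-transmits-edge T tr)

step-transmits-id : ∀ {n s} (P : Pole n (suc s)) →
  Transmits P {Fin (Pole.#E P)} id → Transmits (step P) {Fin (Pole.#E (step P))} id
step-transmits-id P tr = step-transmits P id id tr (λ k → 8 ↑ʳ (k ↑ˡ _) , refl) (λ i → 12 ↑ʳ i , refl)

chain-transmits-id : ∀ {n s} (P : Pole n s) →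
  Transmits P {Fin (Pole.#E P)} id → Transmits (chain P) {Fin (Pole.#E (chain P))} id
chain-transmits-id {s = zero}  P tr = tr
chain-transmits-id {s = suc s} P tr = chain-transmits-id (step P) (step-transmits-id P tr)

reciprocal : ∀ D → 1 ≤ D → ∃ λ x → 0ℚ <ℚ x × ι D * x ≡ 1ℚ
reciprocal (suc m) _ = + 1 / suc m
  , ℚₚ.positive⁻¹ (+ 1 / suc m) {{ℚₚ.normalize-pos 1 (suc m)}}
  , trans (ι*/ 1 m) (ℚₚ.+-identityʳ 1ℚ)

-- Division by `D = (2r + 1)n` turns the bounds of `bounds^` into 1 and `R - 1` with
-- `R = 2 + v + 2/D`, so `n` has to be large. It depends on `r` and `q` only and is fixed before the
-- pole, whose construction starts from it.
φ-≤-value : ∀ r v → ι (2 *ℕ r +ℕ 1) * v ≡ ι 2 → ∀ q → ι 2 + v <ℚ q → ∃ λ n′ →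
  ∀ (P : Pole (suc n′) 0) (apart : Apart P) (T : Thickening P) → below (φ-c (Closing.graph P apart T r)) q
φ-≤-value r v wv≡2 q value<q = n′ , λ P apart T → let open Closing P apart T r in
  φ-c-below graph (val^ ∘ decode) conserves^ x R 2≤R
    (λ e → subst (_≤ℚ ι (val^ (decode e)) * x) Dx≡1 (ι-monoˡ (ℚₚ.<⇒≤ 0<x) (proj₁ (bounds^ (decode e))))
         , ℚₚ.≤-trans (ι-monoˡ (ℚₚ.<⇒≤ 0<x) (proj₂ (bounds^ (decode e)))) (ℚₚ.≤-reflexive top)) R<q
  where
  η : ℚ
  η = q - (ι 2 + v)
  0<η : 0ℚ <ℚ η
  0<η = subst (_<ℚ η) (ℚₚ.+-inverseʳ (ι 2 + v)) (ℚₚ.+-monoˡ-< (- (ι 2 + v)) value<q)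
  d n′ n D : ℕ
  d  = proj₁ (archimedean η 0<η)
  -- Thus `n = 3(d + 1)`, which gives `3x ≤ η`: two of the three `x` are the error in `R`, and the
  -- third makes `R < q` strict.
  n′ = d +ℕ 2 *ℕ suc d
  n  = suc n′
  D  = (2 *ℕ r +ℕ 1) *ℕ n
  n≤D : n ≤ D
  n≤D = ℕₚ.≤-trans (ℕₚ.≤-reflexive (sym (ℕₚ.*-identityˡ n))) (ℕₚ.*-monoˡ-≤ n (ℕₚ.m≤n+m 1 (2 *ℕ r)))
  inverse : ∃ λ x → 0ℚ <ℚ x × ι D * x ≡ 1ℚ
  inverse = reciprocal D (ℕₚ.≤-trans (s≤s z≤n) n≤D)
  x R : ℚ
  x = proj₁ inverse
  R = ι 2 + v + ι 2 * x
  0<x : 0ℚ <ℚ x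
  0<x = proj₁ (proj₂ inverse)
  Dx≡1 : ι D * x ≡ 1ℚ
  Dx≡1 = proj₂ (proj₂ inverse)
  0≤ι* : ∀ k {y} → 0ℚ ≤ℚ y → 0ℚ ≤ℚ ι k * y
  0≤ι* k {y} 0≤y = subst (_≤ℚ ι k * y) (ℚₚ.*-zeroˡ y) (ι-monoˡ {0} {k} 0≤y z≤n)
  2nx≡v : ι 2 * (ι n * x) ≡ v
  2nx≡v = begin
    ι 2 * (ι n * x)                       ≡⟨ cong (_* (ι n * x)) wv≡2 ⟨
    ι (2 *ℕ r +ℕ 1) * v * (ι n * x)       ≡⟨ regroup (ι (2 *ℕ r +ℕ 1)) v (ι n) x ⟩
    v * (ι (2 *ℕ r +ℕ 1) * ι n * x)       ≡⟨ cong (λ z → v * (z * x)) (ι-* (2 *ℕ r +ℕ 1) n) ⟨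
    v * (ι D * x)                         ≡⟨ cong (v *_) Dx≡1 ⟩
    v * 1ℚ                                ≡⟨ ℚₚ.*-identityʳ v ⟩
    v                                     ∎
    where
    open ≡-Reasoning
    regroup : ∀ w v n x → w * v * (n * x) ≡ v * (w * n * x)
    regroup = solve 4 (λ w v n x → w :* v :* (n :* x) := v :* (w :* n :* x)) refl
      where open ℚ-Solver.+-*-Solver
  2≤R : ι 2 ≤ℚ R
  2≤R = subst (_≤ℚ R) (trans (ℚₚ.+-identityʳ _) (ℚₚ.+-identityʳ (ι 2)))
    (ℚₚ.+-mono-≤ (ℚₚ.+-monoʳ-≤ (ι 2) (subst (0ℚ ≤ℚ_) 2nx≡v (0≤ι* 2 (0≤ι* n (ℚₚ.<⇒≤ 0<x)))))
      (0≤ι* 2 (ℚₚ.<⇒≤ 0<x)))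
  top : ι ((2 *ℕ r +ℕ 3) *ℕ n +ℕ 2) * x ≡ R + - 1ℚ
  top = begin
    ι ((2 *ℕ r +ℕ 3) *ℕ n +ℕ 2) * x              ≡⟨ cong (λ k → ι k * x) (split r n) ⟩
    ι (D +ℕ (2 *ℕ n +ℕ 2)) * x                   ≡⟨ cong (_* x) (trans (ι-+ D _) (cong (λ z → ι D + z)
                                                     (trans (ι-+ (2 *ℕ n) 2) (cong (_+ ι 2) (ι-* 2 n))))) ⟩
    (ι D + (ι 2 * ι n + ι 2)) * x                ≡⟨ distribute (ι D) (ι n) x ⟩
    ι D * x + ι 2 * (ι n * x) + ι 2 * x          ≡⟨ cong₂ (λ a b → a + b + ι 2 * x) Dx≡1 2nx≡v ⟩
    1ℚ + v + ι 2 * x                             ≡⟨ shift v x ⟩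
    R + - 1ℚ                                     ∎
    where
    open ≡-Reasoning
    split : ∀ r n → (2 *ℕ r +ℕ 3) *ℕ n +ℕ 2 ≡ (2 *ℕ r +ℕ 1) *ℕ n +ℕ (2 *ℕ n +ℕ 2)
    split = solve 2 (λ r n → (con 2 :* r :+ con 3) :* n :+ con 2
                     := (con 2 :* r :+ con 1) :* n :+ (con 2 :* n :+ con 2)) refl
      where open +-*-Solver
    distribute : ∀ D n x → (D + (ι 2 * n + ι 2)) * x ≡ D * x + ι 2 * (n * x) + ι 2 * x
    distribute = solve 3 (λ D n x → (D :+ (con (ι 2) :* n :+ con (ι 2))) :* x
                          := D :* x :+ con (ι 2) :* (n :* x) :+ con (ι 2) :* x) refl
      where open ℚ-Solver.+-*-Solver
    shift : ∀ v x → 1ℚ + v + ι 2 * x ≡ ι 2 + v + ι 2 * x + - 1ℚ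
    shift = solve 2 (λ v x → con 1ℚ :+ v :+ con (ι 2) :* x
                     := con (ι 2) :+ v :+ con (ι 2) :* x :+ con (- 1ℚ)) refl
      where open ℚ-Solver.+-*-Solver
  3x≤η : ι 3 * x ≤ℚ η
  3x≤η = begin
    ι 3 * x                        ≡⟨ ℚₚ.*-identityʳ (ι 3 * x) ⟨
    ι 3 * x * 1ℚ                   ≤⟨ ℚₚ.*-monoˡ-≤-nonNeg (ι 3 * x) {{ℚ.nonNegative (0≤ι* 3 (ℚₚ.<⇒≤ 0<x))}}
                                       (proj₂ (archimedean η 0<η)) ⟩
    ι 3 * x * (ι (suc d) * η)      ≡⟨ regroup (ι 3) x (ι (suc d)) η ⟩
    ι 3 * ι (suc d) * x * η        ≡⟨ cong (λ z → z * x * η) (ι-* 3 (suc d)) ⟨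
    ι n * x * η                    ≤⟨ ℚₚ.*-monoʳ-≤-nonNeg η {{ℚ.nonNegative (ℚₚ.<⇒≤ 0<η)}} (ι-monoˡ (ℚₚ.<⇒≤ 0<x) n≤D) ⟩
    ι D * x * η                    ≡⟨ cong (_* η) Dx≡1 ⟩
    1ℚ * η                         ≡⟨ ℚₚ.*-identityˡ η ⟩
    η                              ∎
    where
    open ℚₚ.≤-Reasoning
    regroup : ∀ a x b η → a * x * (b * η) ≡ a * b * x * η
    regroup = solve 4 (λ a x b η → a :* x :* (b :* η) := a :* b :* x :* η) refl
      where open ℚ-Solver.+-*-Solver
  R<q : R <ℚ q
  R<q = begin-strict
    ι 2 + v + ι 2 * x          ≡⟨ ℚₚ.+-identityˡ R ⟨
    0ℚ + R                     <⟨ ℚₚ.+-monoˡ-< R 0<x ⟩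
    x + R                      ≡⟨ regroup v x ⟩
    ι 2 + v + ι 3 * x          ≤⟨ ℚₚ.+-monoʳ-≤ (ι 2 + v) 3x≤η ⟩
    ι 2 + v + η                ≡⟨ cancel (ι 2 + v) q ⟩
    q                          ∎
    where
    open ℚₚ.≤-Reasoning
    regroup : ∀ v x → x + (ι 2 + v + ι 2 * x) ≡ ι 2 + v + ι 3 * x
    regroup = solve 2 (λ v x → x :+ (con (ι 2) :+ v :+ con (ι 2) :* x)
                       := con (ι 2) :+ v :+ con (ι 3) :* x) refl
      where open ℚ-Solver.+-*-Solver
    cancel : ∀ R q → R + (q - R) ≡ q
    cancel = solve 2 (λ R q → R :+ (q :- R) := q) refl
      where open ℚ-Solver.+-*-Solver

-- The class 1 and class 2 graphs

class1-graph : ∀ r n → ∃ λ (P : Pole (suc n) 0) → Σ (Apart P) λ apart → Σ (Thickening P) λ T →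
  𝒢 (2 *ℕ suc r +ℕ 3) (Closing.graph P apart T (suc r))
class1-graph r n = P , apart , T , Closing.regular P apart T (suc r)
  , regular-class1 (Closing.graph P apart T (suc r)) (Closing.regular P apart T (suc r))
      -- `Painted` closes with `suc r` copies in either direction, so that each thickened edge has
      -- at least the three parallel edges that `Painting` colours.
      (Painted.colourable P apart T (chain-painting (trianglePainting n)) r)
  , Unmatched.no-bipartite-complement P apart T (suc r)
      (chain-transmits-id P₁ (step-transmits-id (trianglePole (suc n)) (triangle-transmits (suc n))))
  where
  P₁ : Pole (suc n) n
  P₁ = step (trianglePole (suc n))
  P : Pole (suc n) 0
  P = chain P₁
  apart : Apart P
  apart = chain-apart P₁ (step-apart (trianglePole (suc n)))
  T : Thickening P
  T = chain-thickening (triangleThickening n)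

class2-graph : ∀ r n → ∃ λ (P : Pole (suc n) 0) → Σ (Apart P) λ apart → Σ (Thickening P) λ T →
  RegularClass2 (2 *ℕ r +ℕ 3) (Closing.graph P apart T r)
class2-graph r n = P , apart , T , Closing.regular P apart T r
  , regular-class2 (Closing.graph P apart T r) (Closing.regular P apart T r) (chain-vertex P₁ 0F)
      (Closed.not-colourable P apart T r
        (chain-transmits-edge T₁ (step-transmits-edge (spokeThickening (suc n)) (spoke-transmits (suc n)))))
  where
  P₁ : Pole (suc n) n
  -- The first step is taken explicitly: in `spokePole` the ends `u₁` and `u₂` coincide, and `Apart`
  -- holds only after a step.
  P₁ = step (spokePole (suc n))
  T₁ : Thickening P₁
  T₁ = stepThickening (spokeThickening (suc n))
  P : Pole (suc n) 0
  P = chain P₁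
  apart : Apart P
  apart = chain-apart P₁ (step-apart (spokePole (suc n)))
  T : Thickening P
  T = chain-thickening T₁

corollary2p9 : (t : ℕ) (2≤t : 2 ≤ t) →
    let value = finite (fromℚ (+ 2 / 1 + _/_ (+ 2) (2 *ℕ t ∸ 1) {{2t-1≢0 2≤t}}))
    in (Φ⁽¹⁾ (2 *ℕ t +ℕ 1) ≃ value) × (Φ⁽²⁾ (2 *ℕ t +ℕ 1) ≃ value)
-- Since `t = r + 2`, there are `suc r = t - 1` copies in either direction, and the degree
-- `2 * suc r + 3` equals `2t + 1`.
corollary2p9 t@(suc (suc r)) 2≤t@(s≤s (s≤s _)) =
  (λ q → mk⇔ (λ { ((G , regular , _ , unmatched) , b) → value-≤-φ G t 1≤t regular
                    (λ bip → unmatched (matching G regular bip)) v wv≡2 q b })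
             (λ value<q → let n , φ< = φ-≤-value (suc r) v wv≡2′ q (≤-gap value<q)
                              P , apart , T , g = class1-graph r n
                          in (Closing.graph P apart T (suc r) , subst (λ k → 𝒢 k (Closing.graph P apart T (suc r))) k≡ g)
                             , φ< P apart T))
  , λ q → mk⇔ (λ { ((G , regular , class2) , b) → value-≤-φ G t 1≤t regular
                     (λ bip → class2 (class1 G regular bip)) v wv≡2 q b })
              (λ value<q → let n , φ< = φ-≤-value (suc r) v wv≡2′ q (≤-gap value<q)
                               P , apart , T , g = class2-graph (suc r) n
                           in (Closing.graph P apart T (suc r) , subst (λ k → RegularClass2 k (Closing.graph P apart T (suc r))) k≡ g)
                              , φ< P apart T)
  where
  v : ℚ
  v = _/_ (+ 2) (2 *ℕ t ∸ 1) {{2t-1≢0 2≤t}}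
  1≤t : 1 ≤ t
  1≤t = s≤s z≤n
  wv≡2 : ι (2 *ℕ t ∸ 1) * v ≡ ι 2
  wv≡2 = ι*/ 2 (r +ℕ 1 *ℕ t)
  w≡ : 2 *ℕ t ∸ 1 ≡ 2 *ℕ suc r +ℕ 1
  w≡ = solve 1 (λ r → con 1 :+ r :+ (con 1 :+ (con 1 :+ r) :+ con 0)
                := con 2 :* (con 1 :+ r) :+ con 1) refl r
    where open +-*-Solver
  k≡ : 2 *ℕ suc r +ℕ 3 ≡ 2 *ℕ t +ℕ 1
  k≡ = solve 1 (λ r → con 2 :* (con 1 :+ r) :+ con 3 := con 2 :* (con 2 :+ r) :+ con 1) refl r
    where open +-*-Solver
  wv≡2′ : ι (2 *ℕ suc r +ℕ 1) * v ≡ ι 2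
  wv≡2′ = trans (cong (λ k → ι k * v) (sym w≡)) wv≡2
  ≤-gap : ∀ {p q} → fromℚ p <ᴿ fromℚ q → p <ℚ q
  ≤-gap {p} {q} (ε , 0<ε , N , h) = ℚₚ.<-≤-trans
    (subst (_<ℚ p + ε) (ℚₚ.+-identityʳ p) (ℚₚ.+-monoʳ-< p 0<ε)) (h N ℕₚ.≤-refl)
  regular′ : ∀ G → Regular G (2 *ℕ t +ℕ 1) → Regular G (suc (2 *ℕ t))
  regular′ G regular u = trans (regular u) (ℕₚ.+-comm _ 1)
  colouring : ∀ G → Regular G (2 *ℕ t +ℕ 1) → Bipartite G → EdgeColorable G (suc (2 *ℕ t))
  colouring G regular = bipartite-colourable G (2 *ℕ t) (regular′ G regular)
  class1 : ∀ G → Regular G (2 *ℕ t +ℕ 1) → Bipartite G → Class1 G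
  class1 G regular bip = regular-class1 G (regular′ G regular) (colouring G regular bip)
  matching : ∀ G → Regular G (2 *ℕ t +ℕ 1) → Bipartite G →
    ∃ λ M → PerfectMatching G M × Bipartite (delete G M)
  matching G regular bip = colour-class (proj₁ (colouring G regular bip)) zero
    , colour-class-perfect G (regular′ G regular) (colouring G regular bip) , delete-bipartite G _ bip
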